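{- For $m\ge1$ let $F_m(t)=\sum_{r\ge0}b(m^r)t^r$ and $F^*_m(t)=\sum_{r\ge0}b^*(m^r)t^r$, where $b(m^r)$ (resp. $b^*(m^r)$) is the number of alternating (resp. reverse alternating) permutations in $\mathfrak S_{mr}$ all of whose cycles have length $m$ (cycle type $\langle m^r\rangle$). Then, umbrally: (a) If $m$ is odd and $m\ge3$, $$F_m(t)=F^*_m(t)=\exp\left[\frac1m\left(\sum_{d\mid m}\mu(d)(-1)^{(d-1)/2}E^{m/d}\right)\tan^{ -1}t\right].$$ (b) $F_1(t)=\sinh(E\tan^{ -1}t)+\frac{1}{\sqrt{1+t^2}}\cosh(E\tan^{ -1}t)$ and $F_1^*(t)=\sinh(E\tan^{ -1}t)+\sqrt{1+t^2}\cosh(E\tan^{ -1}t)$.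
   Context: A permutation $a_1\cdots a_n$ is alternating if $a_1>a_2<a_3>\cdots$ and reverse alternating if $a_1<a_2>a_3<\cdots$. $\mu$ is the Möbius function and $\tan^{ -1}$ is the arctangent power series. Euler numbers $E_n$: $\sum_{n\ge0}E_nx^n/n!=\sec x+\tan x$. Umbral evaluation: the right-hand sides are expanded as formal power series in $t$ whose coefficients are polynomials in an indeterminate $E$; each coefficient is expanded in powers of $E$ and then, as the last step, each $E^k$ is replaced by $E_k$. -}

module Defs where

open import Data.Bool using (Bool; true; false; _∧_; not; if_then_else_)
open import Data.Nat as ℕ using (ℕ; zero; suc; _∸_; _!; _≡ᵇ_; _<ᵇ_)
open import Data.Nat.Properties using (_!≢0)
open import Data.Nat.DivMod using (_/_; _%_)
open import Data.Nat.Divisibility using (_∣?_)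
open import Data.Nat.Primality using (prime?)
open import Data.Integer as ℤ using (ℤ; +_)
open import Data.Rational as ℚ using (ℚ; 0ℚ; 1ℚ; _+_; _*_; -_)
open import Data.Fin as Fin using (Fin; toℕ)
open import Data.Fin.Properties using () renaming (_≟_ to _≟ᶠ_)
open import Data.List as List using (List; []; _∷_; _++_; map; concatMap; allFin; filter; length)
open import Data.Vec as Vec using (Vec; []; _∷_; lookup)
open import Relation.Nullary using (does)

ℕtoℚ : ℕ → ℚ
ℕtoℚ n = + n ℚ./ 1

ℤtoℚ : ℤ → ℚ
ℤtoℚ z = z ℚ./ 1

invFact : ℕ → ℚ
invFact k = ℚ._/_ (+ 1) (k !) {{k !≢0}}

negOnePow : ℕ → ℚ
negOnePow zero = 1ℚ
negOnePow (suc k) = - negOnePow k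

isEven : ℕ → Bool
isEven n = n % 2 ≡ᵇ 0

Σℚ≤ : ℕ → (ℕ → ℚ) → ℚ
Σℚ≤ zero f = f 0
Σℚ≤ (suc n) f = Σℚ≤ n f + f (suc n)

nth : List ℚ → ℕ → ℚ
nth [] _ = 0ℚ
nth (x ∷ xs) zero = x
nth (x ∷ xs) (suc n) = nth xs n

QSeries : Set
QSeries = ℕ → ℚ

_·q_ : QSeries → QSeries → QSeries
(f ·q g) n = Σℚ≤ n (λ i → f i * g (n ∸ i))

cosS : QSeries
cosS n = if isEven n then negOnePow (n / 2) * invFact n else 0ℚ

sinS : QSeries
sinS n = if isEven n then 0ℚ else negOnePow (n / 2) * invFact n

-- first n+1 coefficients of sec x = 1 / cos x (cos has constant term 1):
-- s_0 = 1,  s_n = - Σ_{k=1}^{n} cos_k s_{n-k}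
secList : ℕ → List ℚ
secList zero = 1ℚ ∷ []
secList (suc n) = prev ++ (- Σℚ≤ n (λ j → cosS (suc j) * nth prev (n ∸ j))) ∷ []
  where prev = secList n

secS : QSeries
secS n = nth (secList n) n

tanS : QSeries
tanS = sinS ·q secS

-- Euler numbers: Σ E_n x^n / n! = sec x + tan x
euler : ℕ → ℚ
euler n = ℕtoℚ (n !) * (secS n + tanS n)

atanS : QSeries
atanS zero = 0ℚ
atanS (suc k) = if isEven (suc k) then 0ℚ else negOnePow (k / 2) * (+ 1 ℚ./ suc k)

fallingℚ : ℚ → ℕ → ℚ
fallingℚ α zero = 1ℚ
fallingℚ α (suc j) = fallingℚ α j * (α ℚ.- ℕtoℚ j)

binomℚ : ℚ → ℕ → ℚ
binomℚ α j = fallingℚ α j * invFact j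

onePlusTSqPow : ℚ → QSeries
onePlusTSqPow α n = if isEven n then binomℚ α (n / 2) else 0ℚ

sqrtS : QSeries
sqrtS = onePlusTSqPow (+ 1 ℚ./ 2)

invSqrtS : QSeries
invSqrtS = onePlusTSqPow (ℤ.-[1+ 0 ] ℚ./ 2)

-- Polynomials in the umbral indeterminate E (coefficient lists, constant first)

Poly : Set
Poly = List ℚ

padd : Poly → Poly → Poly
padd [] q = q
padd (a ∷ p) [] = a ∷ p
padd (a ∷ p) (b ∷ q) = (a + b) ∷ padd p q

pscale : ℚ → Poly → Poly
pscale c p = map (c *_) p

pmul : Poly → Poly → Poly
pmul [] q = []
pmul (a ∷ p) q = padd (pscale a q) (0ℚ ∷ pmul p q)

Epow : ℕ → Poly
Epow zero = 1ℚ ∷ []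
Epow (suc k) = 0ℚ ∷ Epow k

Σpoly≤ : ℕ → (ℕ → Poly) → Poly
Σpoly≤ zero f = f 0
Σpoly≤ (suc n) f = padd (Σpoly≤ n f) (f (suc n))

-- umbral evaluation: expand in powers of E, then replace E^k by E_k
umbralFrom : ℕ → Poly → ℚ
umbralFrom k [] = 0ℚ
umbralFrom k (a ∷ p) = a * euler k + umbralFrom (suc k) p

umbral : Poly → ℚ
umbral = umbralFrom 0

PSeries : Set
PSeries = ℕ → Poly

liftQ : QSeries → PSeries
liftQ f n = f n ∷ []

_·p_ : PSeries → PSeries → PSeries
(f ·p g) n = Σpoly≤ n (λ i → pmul (f i) (g (n ∸ i)))

_+p_ : PSeries → PSeries → PSeries
(f +p g) n = padd (f n) (g n)

onePS : PSeries
onePS zero = 1ℚ ∷ []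
onePS (suc n) = []

powPS : PSeries → ℕ → PSeries
powPS f zero = onePS
powPS f (suc k) = f ·p powPS f k

scalePS : Poly → PSeries → PSeries
scalePS c X n = pmul c (X n)

-- Σ_{k≥0} w_k X^k, for X with zero constant term (so only k ≤ n
-- contributes to the coefficient of t^n)
wSum : (ℕ → ℚ) → PSeries → PSeries
wSum w X n = Σpoly≤ n (λ k → pscale (w k) (powPS X k n))

expPS : PSeries → PSeries
expPS = wSum invFact

sinhPS : PSeries → PSeries
sinhPS = wSum (λ k → if isEven k then 0ℚ else invFact k)

coshPS : PSeries → PSeries
coshPS = wSum (λ k → if isEven k then invFact k else 0ℚ)

primeDivisorsUpTo : ℕ → ℕ → ℕ
primeDivisorsUpTo zero n = 0
primeDivisorsUpTo (suc k) n =
  (if does (prime? (suc k)) ∧ does (suc k ∣? n) then suc else (λ x → x))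
    (primeDivisorsUpTo k n)

hasSquareDivisorUpTo : ℕ → ℕ → Bool  -- ∃ d ∈ [2..k+1], d² ∣ n
hasSquareDivisorUpTo zero n = false
hasSquareDivisorUpTo (suc k) n =
  if does ((suc (suc k) ℕ.* suc (suc k)) ∣? n) then true else hasSquareDivisorUpTo k n

mobius : ℕ → ℤ
mobius n = if hasSquareDivisorUpTo n n then + 0
           else (if isEven (primeDivisorsUpTo n n) then + 1 else ℤ.-[1+ 0 ])

-- c_m = (1/m) Σ_{d ∣ m} μ(d) (-1)^{(d-1)/2} E^{m/d}   (d = suc j, so (d-1)/2 = j/2)
cPoly : (m : ℕ) → .{{ℕ.NonZero m}} → Poly
cPoly m = pscale (+ 1 ℚ./ m)
  (Σpoly≤ m (λ j → if does (suc j ∣? m)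
                     then pscale (ℤtoℚ (mobius (suc j)) * negOnePow (j / 2)) (Epow (m / suc j))
                     else []))

rhsA : (m : ℕ) → .{{ℕ.NonZero m}} → PSeries
rhsA m = expPS (scalePS (cPoly m) (liftQ atanS))

Eatan : PSeries
Eatan = scalePS (Epow 1) (liftQ atanS)

rhsB : PSeries
rhsB = sinhPS Eatan +p (liftQ invSqrtS ·p coshPS Eatan)

rhsB* : PSeries
rhsB* = sinhPS Eatan +p (liftQ sqrtS ·p coshPS Eatan)

-- Permutations of {0,…,n-1}, written in one-line notation a_1 ⋯ a_n

allVecs : (k n : ℕ) → List (Vec (Fin k) n)
allVecs k zero = [] ∷ []
allVecs k (suc n) = concatMap (λ v → map (_∷ v) (allFin k)) (allVecs k n)

notIn : ∀ {k n} → Fin k → Vec (Fin k) n → Bool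
notIn x [] = true
notIn x (y ∷ ys) = not (does (x ≟ᶠ y)) ∧ notIn x ys

distinct : ∀ {k n} → Vec (Fin k) n → Bool
distinct [] = true
distinct (x ∷ xs) = notIn x xs ∧ distinct xs

perms : (n : ℕ) → List (Vec (Fin n) n)
perms n = filter (λ v → Relation.Nullary.Decidable.Core.T? (distinct v)) (allVecs n n)
  where import Relation.Nullary.Decidable.Core

altFrom : Bool → List ℕ → Bool
altFrom d [] = true
altFrom d (x ∷ []) = true
altFrom d (x ∷ y ∷ xs) = (if d then y <ᵇ x else x <ᵇ y) ∧ altFrom (not d) (y ∷ xs)

valuesOf : ∀ {n} → Vec (Fin n) n → List ℕ
valuesOf v = List.map toℕ (Vec.toList v)

isAlternating : ∀ {n} → Vec (Fin n) n → Bool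
isAlternating v = altFrom true (valuesOf v)

isReverseAlternating : ∀ {n} → Vec (Fin n) n → Bool
isReverseAlternating v = altFrom false (valuesOf v)

iter : ∀ {n} → Vec (Fin n) n → ℕ → Fin n → Fin n
iter σ zero i = i
iter σ (suc j) i = lookup σ (iter σ j i)

cycleLenIs : ∀ {n} → Vec (Fin n) n → ℕ → Fin n → Bool
cycleLenIs σ m i = does (iter σ m i ≟ᶠ i) ∧ noEarly (m ∸ 1)
  where
    noEarly : ℕ → Bool
    noEarly zero = true
    noEarly (suc k) = not (does (iter σ (suc k) i ≟ᶠ i)) ∧ noEarly k

allCyclesLength : ∀ {n} → ℕ → Vec (Fin n) n → Bool
allCyclesLength {n} m σ = List.foldr _∧_ true (List.map (cycleLenIs σ m) (allFin n))

countBy : ∀ {A : Set} → (A → Bool) → List A → ℕ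
countBy p [] = 0
countBy p (x ∷ xs) = if p x then suc (countBy p xs) else countBy p xs

b : ℕ → ℕ → ℕ
b m r = countBy (λ σ → isAlternating σ ∧ allCyclesLength m σ) (perms (m ℕ.* r))

b* : ℕ → ℕ → ℕ
b* m r = countBy (λ σ → isReverseAlternating σ ∧ allCyclesLength m σ) (perms (m ℕ.* r))

{-# OPTIONS --safe #-}
module Submission where

-- A permutation with all cycles of length m and no descents outside a set T is, by the
-- Gessel-Reutenauer correspondence, a multiset of primitive necklaces of length m whose content
-- is the composition of T.  Inclusion-exclusion over the subsets T of the alternating descent set
-- therefore turns b and b* into signed sums over necklace multisets.  Marking one of the m r
-- rotations and removing the copies up to the marked one gives
--   m r G(r; λ) = Σ_{j ≥ 1} Σ_{d ∣ m} μ(d) G(r - j; λ ∪ (jd)^{m/d}),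
-- where λ lists the multiplicities of letters already removed and Möbius inversion has replaced
-- primitive words by all words.  For r = 0 the sum is Foulkes' character value
--   G(0; λ) = κ^e ∏ (-1)^⌊λᵢ/2⌋ E_o,
-- with e even and o odd parts in λ and κ ∈ {0, 1, -1}; it follows from 1 + sin = cos (sec + tan) and
-- sin (sec + tan) = sec + tan - cos.  So odd j contribute c_m(E) (arctan)′, while even j
-- contribute, with the coefficient κ Σ_{d ∣ m} μ(d) that vanishes for m ≥ 3, a factor that is a power
-- of 1 + t²; the recurrence becomes the differential equation of the right-hand side.

open import Defs
open import Algebra.Structures using (IsCommutativeSemiring; IsCommutativeRing)
open import Data.Bool using (Bool; true; false; not; if_then_else_; _∧_; T)
open import Data.Bool.Properties using (not-involutive; T?)
open import Data.Empty using (⊥; ⊥-elim)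
import Data.Fin as Fin
open import Data.Fin using (Fin; toℕ; zero; suc)
import Data.Fin.Properties as Finₚ
open import Data.Fin.Properties using () renaming (_≟_ to _≟ᶠ_)
import Data.Integer as ℤ
import Data.Integer.Properties as ℤₚ
open import Data.List using (List; []; _∷_; _++_; map; concatMap; allFin; filter; tabulate; length; foldr; replicate)
import Data.List.Properties as Listₚ
open import Data.List.Relation.Unary.All using (All)
import Data.List.Relation.Unary.All as Allₚ
open import Data.List.Relation.Unary.All.Properties using (¬Any⇒All¬)
import Data.List.Relation.Unary.Any as Anyₚ
import Data.Nat as ℕ
open import Data.Nat using (ℕ; zero; suc; _+_; _*_; _∸_; _≤_; _<_; _/_; _%_; z≤n; s≤s; _!; NonZero; >-nonZero)
import Data.Nat.Coprimality as Coprimality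
open import Data.Nat.DivMod using (_mod_)
import Data.Nat.DivMod as DM
open import Data.Nat.Divisibility using (_∣_; _∣?_; divides)
import Data.Nat.Divisibility as ∣ₚ
open import Data.Nat.ListAction using (sum)
open import Data.Nat.Primality using (Prime; prime?; euclidsLemma; prime⇒nonZero; prime⇒nonTrivial; prime⇒irreducible)
open import Data.Nat.Primality.Factorisation using (factorise; PrimeFactorisation)
import Data.Nat.Properties as ℕₚ
open import Data.Nat.Properties using (≤-trans; _!≢0)
open import Data.Product using (_×_; _,_; proj₁; proj₂; ∃)
import Data.Rational as ℚ
open import Data.Rational using (ℚ; 0ℚ; 1ℚ) renaming (_+_ to _+ℚ_; _*_ to _*ℚ_; -_ to -ℚ_; _-_ to _-ℚ_)
import Data.Rational.Properties as ℚₚ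
open import Data.Rational.Solver using (module +-*-Solver)
import Data.Rational.Unnormalised as ℚᵘ
import Data.Rational.Unnormalised.Properties as ℚᵘₚ
open import Data.Sum using (_⊎_; inj₁; inj₂; [_,_]′)
open import Data.Unit using (⊤; tt)
import Data.Vec as Vec
open import Data.Vec using (Vec; []; _∷_; lookup)
import Data.Vec.Properties as Vecₚ
open import Function using (_∘_; id)
open import Relation.Binary.Definitions using (tri<; tri≈; tri>)
open import Relation.Binary.PropositionalEquality using (_≡_; _≢_; refl; sym; trans; cong; cong₂; subst; subst₂; module ≡-Reasoning)
open import Relation.Nullary using (Dec; yes; no; ¬_; does)
open import Relation.Nullary.Decidable using (_×-dec_; _⊎-dec_; _→-dec_; ¬?)

open +-*-Solver using (solve; _:+_; _:*_; _:-_; :-_; _:=_; con)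

-- The obstacle is that the signed weight of a content is not multiplicative over sums of contents:
-- removing copies of a necklace cannot be factored out of the sum, so the removed multiplicities
-- must be carried along, and only the case `r = 0` can be evaluated directly. The induction closes
-- because of the shape of that value. Apart from signs, the list enters only through the number of
-- its odd parts, which shifts the index of the Euler numbers, and the number of its even parts,
-- which is an exponent of `κ`. Shifting the index by `k` is what multiplication by `E^k` becomes
-- after umbral evaluation, so the unknown of the recurrence is a sequence indexed by the shift `o`.
-- The number `κ` depends only on the parity of `m r + sum λ`, which the recurrence preserves, so it
-- is constant throughout. Since `m` is odd, so are all `d` and `m / d`, and powers of signs and of
-- `κ` collapse by `κ³ = κ`. For `m = 1` and odd `r`, `κ = 0` leaves the plain exponential; for even
-- `r`, `κ = ±1` gives the factor `(1 + t²)^(-κ/2)`. As arctan is odd, the two cases are the sinh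
-- and the cosh term.

vecsOver : {A : Set} → List A → (n : ℕ) → List (Vec A n)
vecsOver xs zero = [] ∷ []
vecsOver xs (suc n) = concatMap (λ v → map (_∷ v) xs) (vecsOver xs n)

-- Finite sums over enumerated types

module Sums {R : Set} (_⊹_ _·_ : R → R → R) (0# 1# : R)
            (isCSR : IsCommutativeSemiring _≡_ _⊹_ _·_ 0# 1#) where
  open IsCommutativeSemiring isCSR
    using (+-assoc; +-comm; +-identityˡ; +-identityʳ; *-identityˡ; *-identityʳ; *-assoc; distribˡ; distribʳ; zeroˡ; zeroʳ)

  ∑ : {A : Set} → List A → (A → R) → R
  ∑ [] f = 0#
  ∑ (x ∷ xs) f = f x ⊹ ∑ xs f

  ∑-cong : {A : Set} (xs : List A) {f g : A → R} → (∀ x → f x ≡ g x) → ∑ xs f ≡ ∑ xs g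
  ∑-cong [] e = refl
  ∑-cong (x ∷ xs) e = cong₂ _⊹_ (e x) (∑-cong xs e)

  ∑-zero : {A : Set} (xs : List A) {f : A → R} → (∀ x → f x ≡ 0#) → ∑ xs f ≡ 0#
  ∑-zero [] e = refl
  ∑-zero (x ∷ xs) e = trans (cong₂ _⊹_ (e x) (∑-zero xs e)) (+-identityˡ 0#)

  interchange : ∀ a b c d → (a ⊹ b) ⊹ (c ⊹ d) ≡ (a ⊹ c) ⊹ (b ⊹ d)
  interchange a b c d =
    trans (+-assoc a b _) (trans (cong (a ⊹_)
      (trans (sym (+-assoc b c d)) (trans (cong (_⊹ d) (+-comm b c)) (+-assoc c b d))))
      (sym (+-assoc a c _)))

  ∑-+ : {A : Set} (xs : List A) (f g : A → R) → ∑ xs (λ x → f x ⊹ g x) ≡ ∑ xs f ⊹ ∑ xs g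
  ∑-+ [] f g = sym (+-identityˡ 0#)
  ∑-+ (x ∷ xs) f g = trans (cong ((f x ⊹ g x) ⊹_) (∑-+ xs f g)) (interchange (f x) (g x) _ _)

  ∑-*ˡ : {A : Set} (xs : List A) (c : R) (f : A → R) → ∑ xs (λ x → c · f x) ≡ c · ∑ xs f
  ∑-*ˡ [] c f = sym (zeroʳ c)
  ∑-*ˡ (x ∷ xs) c f = trans (cong ((c · f x) ⊹_) (∑-*ˡ xs c f)) (sym (distribˡ c (f x) _))

  ∑-*ʳ : {A : Set} (xs : List A) (c : R) (f : A → R) → ∑ xs (λ x → f x · c) ≡ ∑ xs f · c
  ∑-*ʳ [] c f = sym (zeroˡ c)
  ∑-*ʳ (x ∷ xs) c f = trans (cong ((f x · c) ⊹_) (∑-*ʳ xs c f)) (sym (distribʳ c (f x) _))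

  ∑-swap : {A B : Set} (xs : List A) (ys : List B) (f : A → B → R) →
           ∑ xs (λ x → ∑ ys (f x)) ≡ ∑ ys (λ y → ∑ xs (λ x → f x y))
  ∑-swap [] ys f = sym (∑-zero ys (λ _ → refl))
  ∑-swap (x ∷ xs) ys f = trans (cong (∑ ys (f x) ⊹_) (∑-swap xs ys f)) (sym (∑-+ ys (f x) _))

  ∑-++ : {A : Set} (xs ys : List A) (f : A → R) → ∑ (xs ++ ys) f ≡ ∑ xs f ⊹ ∑ ys f
  ∑-++ [] ys f = sym (+-identityˡ _)
  ∑-++ (x ∷ xs) ys f = trans (cong (f x ⊹_) (∑-++ xs ys f)) (sym (+-assoc (f x) _ _))

  ∑-map : {A B : Set} (g : A → B) (xs : List A) (f : B → R) → ∑ (map g xs) f ≡ ∑ xs (f ∘ g)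
  ∑-map g [] f = refl
  ∑-map g (x ∷ xs) f = cong (f (g x) ⊹_) (∑-map g xs f)

  ∑-concatMap : {A B : Set} (g : A → List B) (xs : List A) (f : B → R) →
                ∑ (concatMap g xs) f ≡ ∑ xs (λ x → ∑ (g x) f)
  ∑-concatMap g [] f = refl
  ∑-concatMap g (x ∷ xs) f = trans (∑-++ (g x) _ f) (cong (∑ (g x) f ⊹_) (∑-concatMap g xs f))

  ind : {P : Set} → Dec P → R
  ind (yes _) = 1#
  ind (no _) = 0#

  ind-yes : {P : Set} (p? : Dec P) → P → ind p? ≡ 1#
  ind-yes (yes _) p = refl
  ind-yes (no ¬p) p = ⊥-elim (¬p p)

  ind-no : {P : Set} (p? : Dec P) → ¬ P → ind p? ≡ 0#
  ind-no (yes p) ¬p = ⊥-elim (¬p p)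
  ind-no (no _) ¬p = refl

  ind-⇔ : {P Q : Set} (p? : Dec P) (q? : Dec Q) → (P → Q) → (Q → P) → ind p? ≡ ind q?
  ind-⇔ (yes p) q? f g = sym (ind-yes q? (f p))
  ind-⇔ (no ¬p) q? f g = sym (ind-no q? (¬p ∘ g))

  ind-× : {P Q : Set} (p? : Dec P) (q? : Dec Q) → ind (p? ×-dec q?) ≡ ind p? · ind q?
  ind-× (yes p) (yes q) = sym (*-identityˡ 1#)
  ind-× (yes p) (no ¬q) = sym (*-identityˡ 0#)
  ind-× (no ¬p) q? = sym (zeroˡ _)

  ind-cong : {P : Set} (p? : Dec P) {x y : R} → (P → x ≡ y) → ind p? · x ≡ ind p? · y
  ind-cong (yes p) e = cong (1# ·_) (e p)
  ind-cong (no ¬p) e = trans (zeroˡ _) (sym (zeroˡ _))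

  -- Over ℕ and ℚ, `∑-dirac` expresses that every element occurs exactly once in the list, in the
  -- form in which sums consume it.
  record Enumeration (A : Set) : Set where
    field
      elements : List A
      _≟_ : (x y : A) → Dec (x ≡ y)
      ∑-dirac : ∀ a (f : A → R) → ∑ elements (λ x → ind (x ≟ a) · f x) ≡ f a

    ∑-unique : {P : A → Set} (P? : ∀ x → Dec (P x)) (f : A → R) (a : A) → P a → (∀ x → P x → x ≡ a) →
               ∑ elements (λ x → ind (P? x) · f x) ≡ f a
    ∑-unique P? f a pa uniq =
      trans (∑-cong elements (λ x → cong (_· f x)
              (ind-⇔ (P? x) (x ≟ a) (uniq x) (λ { refl → pa })))) (∑-dirac a f)

    ∑-unique₁ : {P : A → Set} (P? : ∀ x → Dec (P x)) (a : A) → P a → (∀ x → P x → x ≡ a) →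
                ∑ elements (λ x → ind (P? x)) ≡ 1#
    ∑-unique₁ P? a pa uniq =
      trans (∑-cong elements (λ x → sym (*-identityʳ _))) (∑-unique P? (λ _ → 1#) a pa uniq)

  open Enumeration

  ∑-tabulate : ∀ {B : Set} n (g : Fin n → B) (f : B → R) →
               ∑ (tabulate g) f ≡ ∑ (allFin n) (f ∘ g)
  ∑-tabulate zero g f = refl
  ∑-tabulate (suc n) g f = cong (f (g zero) ⊹_)
    (trans (∑-tabulate n (g ∘ suc) f) (sym (∑-tabulate n suc (f ∘ g))))

  ∑-allFin-suc : ∀ n (f : Fin (suc n) → R) → ∑ (allFin (suc n)) f ≡ f zero ⊹ ∑ (allFin n) (f ∘ suc)
  ∑-allFin-suc n f = cong (f zero ⊹_) (∑-tabulate n suc f)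

  finEnum : ∀ n → Enumeration (Fin n)
  finEnum n = record { elements = allFin n ; _≟_ = _≟ᶠ_ ; ∑-dirac = dirac n }
    where
    dirac : ∀ n a (f : Fin n → R) → ∑ (allFin n) (λ x → ind (x ≟ᶠ a) · f x) ≡ f a
    dirac (suc n) zero f =
      trans (cong₂ _⊹_ (*-identityˡ _)
        (trans (∑-tabulate n suc _) (∑-zero (allFin n) (λ x → zeroˡ _)))) (+-identityʳ _)
    dirac (suc n) (suc a) f =
      trans (cong₂ _⊹_ (zeroˡ _)
        (trans (∑-tabulate n suc _) (trans (∑-cong (allFin n) (λ x → cong (_· f (suc x))
           (ind-⇔ (suc x ≟ᶠ suc a) (x ≟ᶠ a) (λ { refl → refl }) (λ { refl → refl }))))
           (dirac n a (f ∘ suc))))) (+-identityˡ _)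

  ∑-vecsOver-suc : {A : Set} (xs : List A) (n : ℕ) (f : Vec A (suc n) → R) →
                   ∑ (vecsOver xs (suc n)) f ≡ ∑ (vecsOver xs n) (λ v → ∑ xs (λ x → f (x ∷ v)))
  ∑-vecsOver-suc xs n f =
    trans (∑-concatMap (λ v → map (_∷ v) xs) (vecsOver xs n) f)
          (∑-cong (vecsOver xs n) (λ v → ∑-map (_∷ v) xs f))

  vecEnum : {A : Set} → Enumeration A → ∀ n → Enumeration (Vec A n)
  vecEnum {A} EA n = record { elements = vecsOver (elements EA) n ; _≟_ = Vecₚ.≡-dec (_≟_ EA) ; ∑-dirac = dirac n }
    where
    _≟ⱽ_ : ∀ {n} (v w : Vec A n) → Dec (v ≡ w)
    _≟ⱽ_ = Vecₚ.≡-dec (_≟_ EA)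
    dirac : ∀ n a (f : Vec A n → R) → ∑ (vecsOver (elements EA) n) (λ v → ind (v ≟ⱽ a) · f v) ≡ f a
    dirac zero [] f = trans (+-identityʳ _) (trans (cong (_· f []) (ind-yes ([] ≟ⱽ []) refl)) (*-identityˡ _))
    dirac (suc n) (a ∷ as) f =
      trans (∑-vecsOver-suc (elements EA) n _)
      (trans (∑-cong (vecsOver (elements EA) n) (λ v →
        trans (∑-cong (elements EA) (λ x → trans (cong (_· f (x ∷ v))
                 (trans (ind-⇔ ((x ∷ v) ≟ⱽ (a ∷ as)) ((v ≟ⱽ as) ×-dec (_≟_ EA x a))
                               (λ { refl → refl , refl }) (λ { (refl , refl) → refl }))
                        (ind-× (v ≟ⱽ as) (_≟_ EA x a))))
                 (*-assoc _ _ _)))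
        (trans (∑-*ˡ (elements EA) (ind (v ≟ⱽ as)) _)
               (cong (ind (v ≟ⱽ as) ·_) (∑-dirac EA a (λ x → f (x ∷ v)))))))
      (dirac n as (λ v → f (a ∷ v))))

  -- The correspondence is a relation rather than a pair of functions, since the two sides need to
  -- be matched only where `P` and `Q` hold. Both sums equal the double sum of `g b` over the pairs
  -- with `P a × Q b × X a b`, collapsed in either order.
  ∑-bijection : {A B : Set} (EA : Enumeration A) (EB : Enumeration B)
    {P : A → Set} {Q : B → Set} {X : A → B → Set}
    (P? : ∀ a → Dec (P a)) (Q? : ∀ b → Dec (Q b)) (X? : ∀ a b → Dec (X a b))
    (f : A → R) (g : B → R) →
    (∀ a → P a → ∃ λ b → Q b × X a b) → (∀ b → Q b → ∃ λ a → P a × X a b) →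
    (∀ a b b′ → Q b → Q b′ → X a b → X a b′ → b ≡ b′) → (∀ a a′ b → P a → P a′ → X a b → X a′ b → a ≡ a′) →
    (∀ a b → P a → Q b → X a b → f a ≡ g b) →
    ∑ (elements EA) (λ a → ind (P? a) · f a) ≡ ∑ (elements EB) (λ b → ind (Q? b) · g b)
  ∑-bijection EA EB {P} {Q} {X} P? Q? X? f g to from to! from! f≡g =
    trans (∑-cong (elements EA) (λ a → expandA a (P? a)))
    (trans (∑-swap (elements EA) (elements EB) _)
           (∑-cong (elements EB) (λ b → sym (expandB b (Q? b)))))
    where
    PQX? : ∀ a b → Dec (P a × Q b × X a b)
    PQX? a b = P? a ×-dec (Q? b ×-dec X? a b)
    expandA : ∀ a (p? : Dec (P a)) → ind p? · f a ≡ ∑ (elements EB) (λ b → ind (PQX? a b) · g b)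
    expandA a (no ¬p) = trans (zeroˡ _) (sym (∑-zero (elements EB) (λ b →
      trans (cong (_· g b) (ind-no (PQX? a b) (¬p ∘ proj₁))) (zeroˡ _))))
    expandA a (yes p) with to a p
    ... | b , qb , x = trans (*-identityˡ _) (trans (f≡g a b p qb x)
      (sym (∑-unique EB (PQX? a) g b (p , qb , x) (λ b′ (_ , qb′ , x′) → to! a b′ b qb′ qb x′ x))))
    expandB : ∀ b (q? : Dec (Q b)) → ind q? · g b ≡ ∑ (elements EA) (λ a → ind (PQX? a b) · g b)
    expandB b (no ¬q) = trans (zeroˡ _) (sym (∑-zero (elements EA) (λ a →
      trans (cong (_· g b) (ind-no (PQX? a b) (¬q ∘ proj₁ ∘ proj₂))) (zeroˡ _))))
    expandB b (yes q) with from b q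
    ... | a , pa , x = trans (*-identityˡ _)
      (sym (∑-unique EA (λ a → PQX? a b) (λ _ → g b) a (pa , q , x)
        (λ a′ (pa′ , _ , x′) → from! a′ a b pa′ pa x′ x)))

module N = Sums _+_ _*_ 0 1 ℕₚ.+-*-isCommutativeSemiring
module Q = Sums _+ℚ_ _*ℚ_ 0ℚ 1ℚ (IsCommutativeRing.isCommutativeSemiring ℚₚ.+-*-isCommutativeRing)

open N using (Enumeration) public

module _ {A : Set} (EA : Enumeration A) {P : A → Set} (P? : ∀ a → Dec (P a)) where

  open Enumeration EA

  -- Apply `∑-dirac` to the indicator of the failure of `P`: the sum vanishes if `P` holds along the
  -- list, and it equals that indicator at `a`.
  elements-complete : Allₚ.All P elements → ∀ a → P a
  elements-complete all a = read (P? a) (trans (sym (∑-dirac a (λ x → N.ind (¬? (P? x))))) (vanish elements all))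
    where
    vanish : ∀ xs → Allₚ.All P xs → N.∑ xs (λ x → N.ind (x ≟ a) * N.ind (¬? (P? x))) ≡ 0
    vanish [] Allₚ.[] = refl
    vanish (x ∷ xs) (p Allₚ.∷ ps) = cong₂ _+_
      (trans (cong (N.ind (x ≟ a) *_) (N.ind-no (¬? (P? x)) (λ ¬p → ¬p p))) (ℕₚ.*-zeroʳ (N.ind (x ≟ a))))
      (vanish xs ps)
    read : (p? : Dec (P a)) → N.ind (¬? p?) ≡ 0 → P a
    read (yes p) _ = p
    read (no _) ()

  ∀-dec : Dec (∀ a → P a)
  ∀-dec with Allₚ.all? P? elements
  ... | no ¬all = no (λ all → ¬all (Allₚ.universal all _))
  ... | yes all = yes (elements-complete all)

∃-dec : {A : Set} (EA : Enumeration A) {P : A → Set} → (∀ a → Dec (P a)) → (∃ P) ⊎ (∀ a → ¬ P a)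
∃-dec EA P? with Anyₚ.any? P? (Enumeration.elements EA)
... | yes any = inj₁ (Anyₚ.satisfied any)
... | no ¬any = inj₂ (elements-complete EA (¬? ∘ P?) (¬Any⇒All¬ _ ¬any))

allVecs≡vecsOver : ∀ k n → allVecs k n ≡ vecsOver (allFin k) n
allVecs≡vecsOver k zero = refl
allVecs≡vecsOver k (suc n) = cong (concatMap (λ v → map (_∷ v) (allFin k))) (allVecs≡vecsOver k n)

-- Casting natural numbers to rationals

ℕtoℚ-+ : ∀ a b → ℕtoℚ (a + b) ≡ ℕtoℚ a +ℚ ℕtoℚ b
ℕtoℚ-+ a b = ℚₚ.toℚᵘ-injective (begin
  ℚ.toℚᵘ (ℕtoℚ (a + b))                    ≈⟨ ℚₚ.toℚᵘ-fromℚᵘ (ℚᵘ.mkℚᵘ (ℤ.+ (a + b)) 0) ⟩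
  ℚᵘ.mkℚᵘ (ℤ.+ (a + b)) 0                    ≈⟨ ℚᵘ.*≡* (cong (ℤ._* ℤ.+ 1) (cong₂ ℤ._+_ (sym (ℤₚ.*-identityʳ (ℤ.+ a))) (sym (ℤₚ.*-identityʳ (ℤ.+ b))))) ⟩
  ℚᵘ.mkℚᵘ (ℤ.+ a) 0 ℚᵘ.+ ℚᵘ.mkℚᵘ (ℤ.+ b) 0     ≈⟨ ℚᵘₚ.+-cong (ℚₚ.toℚᵘ-fromℚᵘ (ℚᵘ.mkℚᵘ (ℤ.+ a) 0)) (ℚₚ.toℚᵘ-fromℚᵘ (ℚᵘ.mkℚᵘ (ℤ.+ b) 0)) ⟨
  ℚ.toℚᵘ (ℕtoℚ a) ℚᵘ.+ ℚ.toℚᵘ (ℕtoℚ b)     ≈⟨ ℚₚ.toℚᵘ-homo-+ (ℕtoℚ a) (ℕtoℚ b) ⟨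
  ℚ.toℚᵘ (ℕtoℚ a +ℚ ℕtoℚ b)                ∎)
  where open ℚᵘₚ.≃-Reasoning

ℕtoℚ-* : ∀ a b → ℕtoℚ (a * b) ≡ ℕtoℚ a *ℚ ℕtoℚ b
ℕtoℚ-* zero b = sym (ℚₚ.*-zeroˡ (ℕtoℚ b))
ℕtoℚ-* (suc a) b = begin
  ℕtoℚ (b + a * b)                        ≡⟨ ℕtoℚ-+ b (a * b) ⟩
  ℕtoℚ b +ℚ ℕtoℚ (a * b)                  ≡⟨ cong₂ _+ℚ_ (sym (ℚₚ.*-identityˡ (ℕtoℚ b))) (ℕtoℚ-* a b) ⟩
  1ℚ *ℚ ℕtoℚ b +ℚ ℕtoℚ a *ℚ ℕtoℚ b        ≡⟨ ℚₚ.*-distribʳ-+ (ℕtoℚ b) 1ℚ (ℕtoℚ a) ⟨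
  (1ℚ +ℚ ℕtoℚ a) *ℚ ℕtoℚ b                ≡⟨ cong (_*ℚ ℕtoℚ b) (ℕtoℚ-+ 1 a) ⟨
  ℕtoℚ (suc a) *ℚ ℕtoℚ b                  ∎
  where open ≡-Reasoning

*-inverse-ℕ : ∀ n .{{_ : NonZero n}} → ℕtoℚ n *ℚ (ℤ.+ 1 ℚ./ n) ≡ 1ℚ
*-inverse-ℕ (suc n) = ℚₚ.toℚᵘ-injective (begin
  ℚ.toℚᵘ (ℕtoℚ (suc n) *ℚ (ℤ.+ 1 ℚ./ suc n))            ≈⟨ ℚₚ.toℚᵘ-homo-* (ℕtoℚ (suc n)) (ℤ.+ 1 ℚ./ suc n) ⟩
  ℚ.toℚᵘ (ℕtoℚ (suc n)) ℚᵘ.* ℚ.toℚᵘ (ℤ.+ 1 ℚ./ suc n)   ≈⟨ ℚᵘₚ.*-cong (ℚₚ.toℚᵘ-fromℚᵘ (ℚᵘ.mkℚᵘ (ℤ.+ suc n) 0)) (ℚₚ.toℚᵘ-fromℚᵘ (ℚᵘ.mkℚᵘ (ℤ.+ 1) n)) ⟩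
  ℚᵘ.mkℚᵘ (ℤ.+ suc n) 0 ℚᵘ.* ℚᵘ.mkℚᵘ (ℤ.+ 1) n            ≈⟨ ℚᵘ.*≡* (cong ℤ.+_ (trans (ℕₚ.*-identityʳ _) (trans (ℕₚ.*-identityʳ (suc n)) (sym (trans (ℕₚ.*-identityˡ _) (ℕₚ.*-identityˡ _)))))) ⟩
  ℚ.toℚᵘ 1ℚ                                           ∎)
  where open ℚᵘₚ.≃-Reasoning

*-cancel-ℕ : ∀ n .{{_ : NonZero n}} {x y : ℚ} → ℕtoℚ n *ℚ x ≡ ℕtoℚ n *ℚ y → x ≡ y
*-cancel-ℕ n {x} {y} e = trans (sym (undo x)) (trans (cong ((ℤ.+ 1 ℚ./ n) *ℚ_) e) (undo y))
  where
  undo : ∀ z → (ℤ.+ 1 ℚ./ n) *ℚ (ℕtoℚ n *ℚ z) ≡ z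
  undo z = trans (sym (ℚₚ.*-assoc (ℤ.+ 1 ℚ./ n) (ℕtoℚ n) z))
    (trans (cong (_*ℚ z) (trans (ℚₚ.*-comm (ℤ.+ 1 ℚ./ n) (ℕtoℚ n)) (*-inverse-ℕ n))) (ℚₚ.*-identityˡ z))

ℕtoℚ-∑ : {A : Set} (xs : List A) (f : A → ℕ) → ℕtoℚ (N.∑ xs f) ≡ Q.∑ xs (ℕtoℚ ∘ f)
ℕtoℚ-∑ [] f = refl
ℕtoℚ-∑ (x ∷ xs) f = trans (ℕtoℚ-+ (f x) _) (cong (ℕtoℚ (f x) +ℚ_) (ℕtoℚ-∑ xs f))

ℕtoℚ-ind : {P : Set} (p? : Dec P) → ℕtoℚ (N.ind p?) ≡ Q.ind p?
ℕtoℚ-ind (yes _) = refl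
ℕtoℚ-ind (no _) = refl

-- Counting over Fin n

open N using (finEnum; vecEnum) public

count : ∀ {n} {P : Fin n → Set} → (∀ k → Dec (P k)) → ℕ
count {n} P? = N.∑ (allFin n) (λ k → N.ind (P? k))

∑ₙ-mono : {A : Set} (xs : List A) {f g : A → ℕ} → (∀ x → f x ≤ g x) → N.∑ xs f ≤ N.∑ xs g
∑ₙ-mono [] h = z≤n
∑ₙ-mono (x ∷ xs) h = ℕₚ.+-mono-≤ (h x) (∑ₙ-mono xs h)

ind-mono : {P Q : Set} (p? : Dec P) (q? : Dec Q) → (P → Q) → N.ind p? ≤ N.ind q?
ind-mono (no _) q? h = z≤n
ind-mono (yes p) q? h = ℕₚ.≤-reflexive (sym (N.ind-yes q? (h p)))

count-mono : ∀ {n} {P Q : Fin n → Set} (P? : ∀ k → Dec (P k)) (Q? : ∀ k → Dec (Q k)) →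
             (∀ k → P k → Q k) → count P? ≤ count Q?
count-mono {n} P? Q? h = ∑ₙ-mono (allFin n) (λ k → ind-mono (P? k) (Q? k) (h k))

count-⇔ : ∀ {n} {P Q : Fin n → Set} (P? : ∀ k → Dec (P k)) (Q? : ∀ k → Dec (Q k)) →
          (∀ k → P k → Q k) → (∀ k → Q k → P k) → count P? ≡ count Q?
count-⇔ {n} P? Q? h h′ = N.∑-cong (allFin n) (λ k → N.ind-⇔ (P? k) (Q? k) (h k) (h′ k))

count-mono-< : ∀ {n} {P Q : Fin n → Set} (P? : ∀ k → Dec (P k)) (Q? : ∀ k → Dec (Q k)) →
               (∀ k → P k → Q k) → (i : Fin n) → Q i → ¬ P i → count P? < count Q?
count-mono-< {n} {P} {Q} P? Q? h i qi ¬pi = subst (_≤ count Q?)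
  (trans (N.∑-+ (allFin n) _ _) (cong (_+ count P?) one))
  (∑ₙ-mono (allFin n) (λ k → pointwise k (k ≟ᶠ i)))
  where
  one : N.∑ (allFin n) (λ k → N.ind (k ≟ᶠ i)) ≡ 1
  one = Enumeration.∑-unique₁ (finEnum n) (_≟ᶠ i) i refl (λ _ e → e)
  pointwise : ∀ k (d : Dec (k ≡ i)) → N.ind d + N.ind (P? k) ≤ N.ind (Q? k)
  pointwise k (no _) = ind-mono (P? k) (Q? k) (h k)
  pointwise k (yes refl) = ℕₚ.≤-reflexive
    (trans (cong suc (N.ind-no (P? i) ¬pi)) (sym (N.ind-yes (Q? i) qi)))

count-<toℕ : ∀ {n} (i : Fin n) → count (λ (k : Fin n) → toℕ k ℕ.<? toℕ i) ≡ toℕ i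
count-<toℕ {suc n} zero = trans (N.∑-allFin-suc n (λ k → N.ind (toℕ k ℕ.<? 0)))
  (N.∑-zero (allFin n) (λ k → N.ind-no (suc (toℕ k) ℕ.<? 0) (λ ())))
count-<toℕ {suc n} (suc i) = trans (N.∑-allFin-suc n (λ k → N.ind (toℕ k ℕ.<? suc (toℕ i)))) (cong suc
  (trans (count-⇔ (λ (k : Fin n) → suc (toℕ k) ℕ.<? suc (toℕ i)) (λ k → toℕ k ℕ.<? toℕ i) (λ _ → ℕ.s<s⁻¹) (λ _ → ℕ.s<s)) (count-<toℕ i)))

count-≤toℕ : ∀ {n} (i : Fin n) → count (λ (k : Fin n) → toℕ k ℕ.≤? toℕ i) ≡ suc (toℕ i)
count-≤toℕ {suc n} zero = trans (N.∑-allFin-suc n (λ k → N.ind (toℕ k ℕ.≤? 0)))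
  (cong suc (N.∑-zero (allFin n) (λ k → N.ind-no (suc (toℕ k) ℕ.≤? 0) (λ ()))))
count-≤toℕ {suc n} (suc i) = trans (N.∑-allFin-suc n (λ k → N.ind (toℕ k ℕ.≤? suc (toℕ i)))) (cong suc
  (trans (count-⇔ (λ (k : Fin n) → suc (toℕ k) ℕ.≤? suc (toℕ i)) (λ k → toℕ k ℕ.≤? toℕ i) (λ _ → ℕ.s≤s⁻¹) (λ _ → s≤s)) (count-≤toℕ i)))

∑-allFin-1 : ∀ n → N.∑ (allFin n) (λ _ → 1) ≡ n
∑-allFin-1 zero = refl
∑-allFin-1 (suc n) = trans (N.∑-allFin-suc n (λ _ → 1)) (cong suc (∑-allFin-1 n))

count-< : ∀ {n} {P : Fin n → Set} (P? : ∀ k → Dec (P k)) (i : Fin n) → ¬ P i → count P? < n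
count-< {n} P? i ¬pi = ℕₚ.<-≤-trans (count-mono-< P? (λ _ → yes tt) _ i tt ¬pi) (ℕₚ.≤-reflexive (∑-allFin-1 n))

module _ {n} (π : Fin n → Fin n) (inj : ∀ {i j} → π i ≡ π j → i ≡ j) where

  injective⇒surjective : ∀ x → ∃ λ k → π k ≡ x
  injective⇒surjective x with Finₚ.any? (λ k → π k ≟ᶠ x)
  ... | yes h = h
  ... | no none = ⊥-elim (squeeze π inj x (λ k e → none (k , e)))
    where
    squeeze : ∀ {n} (π : Fin n → Fin n) → (∀ {i j} → π i ≡ π j → i ≡ j) → ∀ x → ¬ (∀ k → π k ≢ x)
    -- A missed value can be punched out, which leaves an injection into a smaller `Fin`.
    squeeze {suc n} π inj x miss = ℕₚ.1+n≰n (Finₚ.injective⇒≤ {f = λ k → Fin.punchOut (miss k ∘ sym)}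
      (λ {i} {j} e → inj (Finₚ.punchOut-injective (miss i ∘ sym) (miss j ∘ sym) e)))

  ∑-permute : (f : Fin n → ℕ) → N.∑ (allFin n) (f ∘ π) ≡ N.∑ (allFin n) f
  ∑-permute f = begin
    N.∑ F (λ k → f (π k))
      ≡⟨ N.∑-cong F (λ k → sym (Enumeration.∑-dirac (finEnum n) (π k) f)) ⟩
    N.∑ F (λ k → N.∑ F (λ x → N.ind (x ≟ᶠ π k) * f x))
      ≡⟨ N.∑-swap F F _ ⟩
    N.∑ F (λ x → N.∑ F (λ k → N.ind (x ≟ᶠ π k) * f x))
      ≡⟨ N.∑-cong F (λ x → let (k , e) = injective⇒surjective x in
           Enumeration.∑-unique (finEnum n) (λ k → x ≟ᶠ π k) (λ _ → f x) k (sym e) (λ k′ e′ → inj (trans (sym e′) (sym e)))) ⟩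
    N.∑ F f ∎
    where
    open ≡-Reasoning
    F = allFin n

  -- There are `toℕ (π i)` values below `π i`, and each is taken exactly once. So a permutation is
  -- determined by the relative order of its values.
  permutation-rank : ∀ i → toℕ (π i) ≡ count (λ k → toℕ (π k) ℕ.<? toℕ (π i))
  permutation-rank i = trans (sym (count-<toℕ (π i))) (sym (∑-permute (λ x → N.ind (toℕ x ℕ.<? toℕ (π i)))))

-- Sorted sequences and standardisation

SortedBy : {A : Set} {n : ℕ} → (A → ℕ) → (Fin n → A) → Set
SortedBy key W = ∀ i j → toℕ i < toℕ j → key (W i) ≤ key (W j)

module Standardisation {A : Set} (EA : Enumeration A) (key : A → ℕ) (key-inj : ∀ {x y} → key x ≡ key y → x ≡ y) where

  open Enumeration EA using (_≟_)

  SameCounts : ∀ {n} → (v W : Fin n → A) → Set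
  SameCounts v W = ∀ a → count (λ k → v k ≟ a) ≡ count (λ k → W k ≟ a)

  ∑-by-counts : ∀ {n} (v : Fin n → A) (f : A → ℕ) →
                N.∑ (allFin n) (f ∘ v) ≡ N.∑ (Enumeration.elements EA) (λ a → count (λ k → v k ≟ a) * f a)
  ∑-by-counts {n} v f = begin
    N.∑ F (λ k → f (v k))
      ≡⟨ N.∑-cong F (λ k → sym (trans (N.∑-cong E (λ a → cong (_* f a) (N.ind-⇔ (v k ≟ a) (a ≟ v k) sym sym))) (Enumeration.∑-dirac EA (v k) f))) ⟩
    N.∑ F (λ k → N.∑ E (λ a → N.ind (v k ≟ a) * f a)) ≡⟨ N.∑-swap F E _ ⟩
    N.∑ E (λ a → N.∑ F (λ k → N.ind (v k ≟ a) * f a)) ≡⟨ N.∑-cong E (λ a → N.∑-*ʳ F (f a) _) ⟩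
    N.∑ E (λ a → count (λ k → v k ≟ a) * f a) ∎
    where
    open ≡-Reasoning
    F = allFin n
    E = Enumeration.elements EA

  same-counts-∑ : ∀ {n} (v W : Fin n → A) → SameCounts v W → (f : A → ℕ) →
                  N.∑ (allFin n) (f ∘ v) ≡ N.∑ (allFin n) (f ∘ W)
  same-counts-∑ v W same f = trans (∑-by-counts v f)
    (trans (N.∑-cong (Enumeration.elements EA) (λ a → cong (_* f a) (same a))) (sym (∑-by-counts W f)))

  module _ {n : ℕ} (v : Fin n → A) where

    -- The tie-break by position makes the standardisation of a sequence with repetitions a
    -- permutation.
    Precedes : Fin n → Fin n → Set
    Precedes k i = key (v k) < key (v i) ⊎ (key (v k) ≡ key (v i) × toℕ k < toℕ i)

    precedes? : ∀ k i → Dec (Precedes k i)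
    precedes? k i = (key (v k) ℕ.<? key (v i)) ⊎-dec ((key (v k) ℕ.≟ key (v i)) ×-dec (toℕ k ℕ.<? toℕ i))

    precedes-irrefl : ∀ i → ¬ Precedes i i
    precedes-irrefl i (inj₁ lt) = ℕₚ.<-irrefl refl lt
    precedes-irrefl i (inj₂ (_ , lt)) = ℕₚ.<-irrefl refl lt

    precedes-trans : ∀ {i j k} → Precedes i j → Precedes j k → Precedes i k
    precedes-trans (inj₁ p) (inj₁ q) = inj₁ (ℕₚ.<-trans p q)
    precedes-trans (inj₁ p) (inj₂ (q , _)) = inj₁ (ℕₚ.<-≤-trans p (ℕₚ.≤-reflexive q))
    precedes-trans (inj₂ (p , _)) (inj₁ q) = inj₁ (ℕₚ.≤-<-trans (ℕₚ.≤-reflexive p) q)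
    precedes-trans (inj₂ (p , p′)) (inj₂ (q , q′)) = inj₂ (trans p q , ℕₚ.<-trans p′ q′)

    precedes-total : ∀ i j → i ≢ j → Precedes i j ⊎ Precedes j i
    precedes-total i j i≢j with ℕₚ.<-cmp (key (v i)) (key (v j)) | ℕₚ.<-cmp (toℕ i) (toℕ j)
    ... | tri< p _ _ | _ = inj₁ (inj₁ p)
    ... | tri> _ _ p | _ = inj₂ (inj₁ p)
    ... | tri≈ _ e _ | tri< p _ _ = inj₁ (inj₂ (e , p))
    ... | tri≈ _ e _ | tri> _ _ p = inj₂ (inj₂ (sym e , p))
    ... | tri≈ _ e _ | tri≈ _ e′ _ = ⊥-elim (i≢j (Finₚ.toℕ-injective e′))

    rank : Fin n → ℕ
    rank i = count (λ k → precedes? k i)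

    rank-< : ∀ i → rank i < n
    rank-< i = count-< (λ k → precedes? k i) i (precedes-irrefl i)

    std : Fin n → Fin n
    std i = Fin.fromℕ< (rank-< i)

    toℕ-std : ∀ i → toℕ (std i) ≡ rank i
    toℕ-std i = Finₚ.toℕ-fromℕ< (rank-< i)

    std-mono : ∀ {i j} → Precedes i j → toℕ (std i) < toℕ (std j)
    std-mono {i} {j} p = subst₂ _<_ (sym (toℕ-std i)) (sym (toℕ-std j))
      (count-mono-< (λ k → precedes? k i) (λ k → precedes? k j) (λ k r → precedes-trans r p) i p (precedes-irrefl i))

    std-injective : ∀ {i j} → std i ≡ std j → i ≡ j
    std-injective {i} {j} e with i ≟ᶠ j
    ... | yes i≡j = i≡j
    ... | no i≢j with precedes-total i j i≢j
    ... | inj₁ p = ⊥-elim (ℕₚ.<-irrefl (cong toℕ e) (std-mono p))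
    ... | inj₂ p = ⊥-elim (ℕₚ.<-irrefl (cong toℕ (sym e)) (std-mono p))

  sorted-≤ : ∀ {n} {W : Fin n → A} → SortedBy key W → ∀ i j → toℕ i ≤ toℕ j → key (W i) ≤ key (W j)
  sorted-≤ sorted i j i≤j with ℕₚ.m≤n⇒m<n∨m≡n i≤j
  ... | inj₁ lt = sorted i j lt
  ... | inj₂ e rewrite Finₚ.toℕ-injective e = ℕₚ.≤-refl

  -- If `W` had too small a key at `p = std v i`, all entries of `W` up to `p` would lie below the
  -- key of `v i`; as `v` and `W` have the same multiplicities, at least `p + 1` entries of `v`
  -- would lie below it, more than the rank allows. Too large a key is excluded by counting the
  -- entries up to that key.
  sorted-std : ∀ {n} {v W : Fin n → A} → SortedBy key W → SameCounts v W → ∀ i → W (std v i) ≡ v i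
  sorted-std {n} {v} {W} sorted same i = key-inj (ℕₚ.≤-antisym (ℕₚ.≮⇒≥ above) (ℕₚ.≮⇒≥ below))
    where
    c = key (v i)
    p = std v i
    below : ¬ (key (W p) < c)
    below lt = ℕₚ.<-irrefl refl (begin-strict
      toℕ p                                     <⟨ ℕₚ.n<1+n _ ⟩
      suc (toℕ p)                               ≡⟨ count-≤toℕ p ⟨
      count (λ (k : Fin n) → toℕ k ℕ.≤? toℕ p)            ≤⟨ count-mono (λ (k : Fin n) → toℕ k ℕ.≤? toℕ p) (λ k → key (W k) ℕ.<? c) (λ k k≤p → ℕₚ.≤-<-trans (sorted-≤ sorted k p k≤p) lt) ⟩
      count (λ k → key (W k) ℕ.<? c)            ≡⟨ same-counts-∑ v W same (λ a → N.ind (key a ℕ.<? c)) ⟨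
      count (λ k → key (v k) ℕ.<? c)            ≤⟨ count-mono (λ k → key (v k) ℕ.<? c) (λ k → precedes? v k i) (λ k → inj₁) ⟩
      rank v i                                  ≡⟨ toℕ-std v i ⟨
      toℕ p ∎)
      where open ℕₚ.≤-Reasoning
    above : ¬ (c < key (W p))
    above lt = ℕₚ.<-irrefl refl (begin-strict
      toℕ p                                     ≡⟨ toℕ-std v i ⟩
      rank v i                                  <⟨ count-mono-< (λ k → precedes? v k i) (λ k → key (v k) ℕ.≤? c)
                                                     (λ { k (inj₁ l) → ℕₚ.<⇒≤ l ; k (inj₂ (e , _)) → ℕₚ.≤-reflexive e }) i ℕₚ.≤-refl (precedes-irrefl v i) ⟩
      count (λ k → key (v k) ℕ.≤? c)            ≡⟨ same-counts-∑ v W same (λ a → N.ind (key a ℕ.≤? c)) ⟩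
      count (λ k → key (W k) ℕ.≤? c)            ≤⟨ count-mono (λ k → key (W k) ℕ.≤? c) (λ (k : Fin n) → toℕ k ℕ.<? toℕ p) (λ k le → ℕₚ.≰⇒> (λ p≤k → ℕₚ.<⇒≱ lt (ℕₚ.≤-trans (sorted-≤ sorted p k p≤k) le))) ⟩
      count (λ (k : Fin n) → toℕ k ℕ.<? toℕ p)            ≡⟨ count-<toℕ p ⟩
      toℕ p ∎)
      where open ℕₚ.≤-Reasoning

  -- The standardisation of a sorted sequence is the identity, so `sorted-std` compares the two
  -- lists entry by entry.
  sorted-unique : ∀ {n} {v W : Fin n → A} → SortedBy key v → SortedBy key W → SameCounts v W → ∀ i → W i ≡ v i
  sorted-unique {n} {v} {W} sv sW same i = trans (cong W (sym std≡)) (sorted-std sW same i)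
    where
    to : ∀ k → Precedes v k i → toℕ k < toℕ i
    to k (inj₁ lt) = ℕₚ.≰⇒> (λ i≤k → ℕₚ.<⇒≱ lt (sorted-≤ sv i k i≤k))
    to k (inj₂ (_ , lt)) = lt
    from : ∀ k → toℕ k < toℕ i → Precedes v k i
    from k lt with ℕₚ.m≤n⇒m<n∨m≡n (sv k i lt)
    ... | inj₁ l = inj₁ l
    ... | inj₂ e = inj₂ (e , lt)
    std≡ : std v i ≡ i
    std≡ = Finₚ.toℕ-injective (trans (toℕ-std v i) (trans (count-⇔ (λ k → precedes? v k i) (λ k → toℕ k ℕ.<? toℕ i) to from) (count-<toℕ i)))

-- Words as periodic sequences, and their lexicographic codes

codeₙ : ℕ → ℕ → (ℕ → ℕ) → ℕ
codeₙ q zero h = 0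
codeₙ q (suc k) h = h 0 * q ℕ.^ k + codeₙ q k (h ∘ suc)

codeₙ-cong : ∀ q k {h h′ : ℕ → ℕ} → (∀ i → h i ≡ h′ i) → codeₙ q k h ≡ codeₙ q k h′
codeₙ-cong q zero e = refl
codeₙ-cong q (suc k) e = cong₂ _+_ (cong (_* q ℕ.^ k) (e 0)) (codeₙ-cong q k (e ∘ suc))

codeₙ-< : ∀ q k {h : ℕ → ℕ} → (∀ i → h i < q) → codeₙ q k h < q ℕ.^ k
codeₙ-< q zero h< = s≤s z≤n
codeₙ-< q (suc k) {h} h< = begin-strict
  h 0 * q ℕ.^ k + codeₙ q k (h ∘ suc)   <⟨ ℕₚ.+-monoʳ-< (h 0 * q ℕ.^ k) (codeₙ-< q k (h< ∘ suc)) ⟩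
  h 0 * q ℕ.^ k + q ℕ.^ k               ≡⟨ ℕₚ.+-comm (h 0 * q ℕ.^ k) _ ⟩
  suc (h 0) * q ℕ.^ k                   ≤⟨ ℕₚ.*-monoˡ-≤ (q ℕ.^ k) (h< 0) ⟩
  q * q ℕ.^ k ∎
  where open ℕₚ.≤-Reasoning

codeₙ-lead-< : ∀ q k (h h′ : ℕ → ℕ) → (∀ i → h i < q) → h 0 < h′ 0 → codeₙ q (suc k) h < codeₙ q (suc k) h′
codeₙ-lead-< q k h h′ h< lt = begin-strict
  h 0 * q ℕ.^ k + codeₙ q k (h ∘ suc)   <⟨ ℕₚ.+-monoʳ-< (h 0 * q ℕ.^ k) (codeₙ-< q k (h< ∘ suc)) ⟩
  h 0 * q ℕ.^ k + q ℕ.^ k               ≡⟨ ℕₚ.+-comm (h 0 * q ℕ.^ k) _ ⟩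
  suc (h 0) * q ℕ.^ k                   ≤⟨ ℕₚ.*-monoˡ-≤ (q ℕ.^ k) lt ⟩
  h′ 0 * q ℕ.^ k                        ≤⟨ ℕₚ.m≤m+n _ _ ⟩
  codeₙ q (suc k) h′ ∎
  where open ℕₚ.≤-Reasoning

codeₙ-lead-≤ : ∀ q k (h h′ : ℕ → ℕ) → (∀ i → h′ i < q) → codeₙ q (suc k) h ≤ codeₙ q (suc k) h′ → h 0 ≤ h′ 0
codeₙ-lead-≤ q k h h′ h′< le = ℕₚ.≮⇒≥ (λ lt → ℕₚ.<⇒≱ (codeₙ-lead-< q k h′ h h′< lt) le)

codeₙ-injective : ∀ q k {h h′ : ℕ → ℕ} → (∀ i → h i < q) → (∀ i → h′ i < q) →
                  codeₙ q k h ≡ codeₙ q k h′ → ∀ i → i < k → h i ≡ h′ i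
codeₙ-injective q (suc k) {h} {h′} h< h′< e = go
  where
  lead : h 0 ≡ h′ 0
  lead = ℕₚ.≤-antisym (codeₙ-lead-≤ q k h h′ h′< (ℕₚ.≤-reflexive e)) (codeₙ-lead-≤ q k h′ h h< (ℕₚ.≤-reflexive (sym e)))
  rest : codeₙ q k (h ∘ suc) ≡ codeₙ q k (h′ ∘ suc)
  rest = ℕₚ.+-cancelˡ-≡ (h 0 * q ℕ.^ k) _ _ (trans e (cong (λ x → x * q ℕ.^ k + codeₙ q k (h′ ∘ suc)) (sym lead)))
  go : ∀ i → i < suc k → h i ≡ h′ i
  go zero _ = lead
  go (suc i) (s≤s lt) = codeₙ-injective q k (h< ∘ suc) (h′< ∘ suc) rest i lt

-- Rotation moves the leading digit to the end, so the code of a rotated word has to be split at its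
-- last digit.
codeₙ-snoc : ∀ q k (h : ℕ → ℕ) → codeₙ q (suc k) h ≡ codeₙ q k h * q + h k
codeₙ-snoc q zero h = trans (ℕₚ.+-identityʳ _) (ℕₚ.*-identityʳ (h 0))
codeₙ-snoc q (suc k) h = begin
  h 0 * (q * q ℕ.^ k) + codeₙ q (suc k) (h ∘ suc)
    ≡⟨ cong ((h 0 * (q * q ℕ.^ k)) +_) (codeₙ-snoc q k (h ∘ suc)) ⟩
  h 0 * (q * q ℕ.^ k) + (codeₙ q k (h ∘ suc) * q + h (suc k))
    ≡⟨ ℕₚ.+-assoc (h 0 * (q * q ℕ.^ k)) (codeₙ q k (h ∘ suc) * q) (h (suc k)) ⟨
  h 0 * (q * q ℕ.^ k) + codeₙ q k (h ∘ suc) * q + h (suc k)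
    ≡⟨ cong (λ x → x + codeₙ q k (h ∘ suc) * q + h (suc k)) (trans (cong (h 0 *_) (ℕₚ.*-comm q _)) (sym (ℕₚ.*-assoc (h 0) (q ℕ.^ k) q))) ⟩
  h 0 * q ℕ.^ k * q + codeₙ q k (h ∘ suc) * q + h (suc k)
    ≡⟨ cong (_+ h (suc k)) (ℕₚ.*-distribʳ-+ q (h 0 * q ℕ.^ k) (codeₙ q k (h ∘ suc))) ⟨
  (h 0 * q ℕ.^ k + codeₙ q k (h ∘ suc)) * q + h (suc k) ∎
  where open ≡-Reasoning

iterate : {A : Set} → (A → A) → ℕ → A → A
iterate g zero x = x
iterate g (suc k) x = g (iterate g k x)

iterate-+ : {A : Set} (g : A → A) (j k : ℕ) (x : A) → iterate g (j + k) x ≡ iterate g j (iterate g k x)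
iterate-+ g zero k x = refl
iterate-+ g (suc j) k x = cong g (iterate-+ g j k x)

vec-ext : {A : Set} {n : ℕ} {xs ys : Vec A n} → (∀ i → lookup xs i ≡ lookup ys i) → xs ≡ ys
vec-ext {xs = []} {[]} e = refl
vec-ext {xs = x ∷ xs} {y ∷ ys} e = cong₂ _∷_ (e zero) (vec-ext (e ∘ suc))

module Words (q m₀ : ℕ) where

  m : ℕ
  m = suc m₀

  Word : Set
  Word = Vec (Fin q) m

  wordEnum : Enumeration Word
  wordEnum = vecEnum (finEnum q) m

  _≟ʷ_ : (w v : Word) → Dec (w ≡ v)
  _≟ʷ_ = Enumeration._≟_ wordEnum

  get : Word → ℕ → Fin q
  get w i = lookup w (i mod m)

  get-cong : ∀ w i j → i % m ≡ j % m → get w i ≡ get w j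
  get-cong w i j e = cong (lookup w) (Finₚ.toℕ-injective
    (trans (Finₚ.toℕ-fromℕ< _) (trans e (sym (Finₚ.toℕ-fromℕ< _)))))

  get-toℕ : ∀ w (i : Fin m) → get w (toℕ i) ≡ lookup w i
  get-toℕ w i = cong (lookup w) (Finₚ.toℕ-injective
    (trans (Finₚ.toℕ-fromℕ< _) (DM.m<n⇒m%n≡m (Finₚ.toℕ<n i))))

  word-ext : ∀ {w v} → (∀ i → i < m → get w i ≡ get v i) → w ≡ v
  word-ext {w} {v} e = vec-ext (λ i → trans (sym (get-toℕ w i)) (trans (e (toℕ i) (Finₚ.toℕ<n i)) (get-toℕ v i)))

  fromSeq : (ℕ → Fin q) → Word
  fromSeq h = Vec.tabulate (h ∘ toℕ)

  get-fromSeq : ∀ h i → get (fromSeq h) i ≡ h (i % m)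
  get-fromSeq h i = trans (Vecₚ.lookup∘tabulate (h ∘ toℕ) (i mod m)) (cong h (Finₚ.toℕ-fromℕ< _))

  rot : Word → Word
  rot w = fromSeq (get w ∘ suc)

  suc-% : ∀ i → suc (i % m) % m ≡ suc i % m
  suc-% i = trans (DM.%-distribˡ-+ 1 (i % m) m)
    (trans (cong (λ x → (1 % m + x) % m) (DM.m%n%n≡m%n i m)) (sym (DM.%-distribˡ-+ 1 i m)))

  get-rot : ∀ w i → get (rot w) i ≡ get w (suc i)
  get-rot w i = trans (get-fromSeq (get w ∘ suc) i) (get-cong w (suc (i % m)) (suc i) (suc-% i))

  rotⁿ : ℕ → Word → Word
  rotⁿ = iterate rot

  get-rotⁿ : ∀ k w i → get (rotⁿ k w) i ≡ get w (k + i)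
  get-rotⁿ zero w i = refl
  get-rotⁿ (suc k) w i = trans (get-rot (rotⁿ k w) i) (trans (get-rotⁿ k w (suc i)) (cong (get w) (ℕₚ.+-suc k i)))

  rotⁿ-m : ∀ w → rotⁿ m w ≡ w
  rotⁿ-m w = word-ext (λ i _ → trans (get-rotⁿ m w i)
    (get-cong w (m + i) i (trans (cong (_% m) (ℕₚ.+-comm m i)) (DM.[m+n]%n≡m%n i m))))

  rot-rotⁿ : ∀ k w → rot (rotⁿ k w) ≡ rotⁿ k (rot w)
  rot-rotⁿ zero w = refl
  rot-rotⁿ (suc k) w = cong rot (rot-rotⁿ k w)

  -- Another `m₀` rotations complete a full turn, so rotation is invertible.
  rot-injective : ∀ {w v} → rot w ≡ rot v → w ≡ v
  rot-injective {w} {v} e = trans (sym (rotⁿ-m w)) (trans (rot-rotⁿ m₀ w)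
    (trans (cong (rotⁿ m₀) e) (trans (sym (rot-rotⁿ m₀ v)) (rotⁿ-m v))))

  seq : Word → ℕ → ℕ
  seq w i = toℕ (get w i)

  seq-< : ∀ w i → seq w i < q
  seq-< w i = Finₚ.toℕ<n (get w i)

  code : Word → ℕ
  code w = codeₙ q m (seq w)

  code-injective : ∀ {w v} → code w ≡ code v → w ≡ v
  code-injective {w} {v} e = word-ext (λ i i<m → Finₚ.toℕ-injective (codeₙ-injective q m (seq-< w) (seq-< v) e i i<m))

  code-head-≤ : ∀ w v → code w ≤ code v → toℕ (get w 0) ≤ toℕ (get v 0)
  code-head-≤ w v = codeₙ-lead-≤ q m₀ (seq w) (seq v) (seq-< v)

  code-rot : ∀ w → code (rot w) ≡ codeₙ q m₀ (seq w ∘ suc) * q + toℕ (get w 0)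
  code-rot w = trans (codeₙ-cong q m (λ i → cong toℕ (get-rot w i)))
    (trans (codeₙ-snoc q m₀ (seq w ∘ suc)) (cong (λ x → codeₙ q m₀ (seq w ∘ suc) * q + toℕ x)
      (get-cong w m 0 (DM.n%n≡0 m))))

  -- Equal leading letters cancel, so the tails are in the same order; rotation moves the tails up
  -- one place and appends the same letter to both.
  code-rot-≤ : ∀ w v → get w 0 ≡ get v 0 → code w ≤ code v → code (rot w) ≤ code (rot v)
  code-rot-≤ w v e le = subst₂ _≤_ (sym (code-rot w)) (sym (code-rot v))
    (ℕₚ.+-mono-≤ (ℕₚ.*-monoˡ-≤ q (ℕₚ.+-cancelˡ-≤ (toℕ (get v 0) * q ℕ.^ m₀) _ _
      (subst (λ x → toℕ x * q ℕ.^ m₀ + codeₙ q m₀ (seq w ∘ suc) ≤ code v) e le))) (ℕₚ.≤-reflexive (cong toℕ e)))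

  Primitive : Word → Set
  Primitive w = ∀ (d : Fin m) → 0 < toℕ d → rotⁿ (toℕ d) w ≢ w

  primitive? : ∀ w → Dec (Primitive w)
  primitive? w = Finₚ.all? (λ d → (0 ℕ.<? toℕ d) →-dec ¬? (rotⁿ (toℕ d) w ≟ʷ w))

-- The Gessel-Reutenauer correspondence

ascending-chain : ∀ {n} (g : Fin n → Fin n) (i : Fin n) →
  (∀ k → toℕ (iterate g k i) < toℕ (iterate g (suc k) i)) → ⊥
ascending-chain {n} g i asc = ℕₚ.<⇒≱ (Finₚ.toℕ<n (iterate g n i)) (climb n)
  where
  climb : ∀ k → k ≤ toℕ (iterate g k i)
  climb zero = z≤n
  climb (suc k) = ℕₚ.≤-<-trans (climb k) (asc k)

descending-chain : ∀ {n} (g : Fin n → Fin n) (i : Fin n) →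
  (∀ k → toℕ (iterate g (suc k) i) < toℕ (iterate g k i)) → ⊥
descending-chain {n} g i desc = ℕₚ.<⇒≱ (Finₚ.toℕ<n i) (ℕₚ.≤-trans (ℕₚ.m≤m+n n _) (climb n))
  where
  climb : ∀ k → k + toℕ (iterate g k i) ≤ toℕ i
  climb zero = ℕₚ.≤-refl
  climb (suc k) = ℕₚ.≤-trans (subst (_≤ k + toℕ (iterate g k i)) (ℕₚ.+-suc k _) (ℕₚ.+-monoʳ-≤ k (desc k))) (climb k)

-- A map of a fibre into itself that preserves the order has no moving points.
no-drift : ∀ {A : Set} {n} (W : Fin n → A) (g : Fin n → Fin n) (i : Fin n) →
  (∀ x → W x ≡ W i → W (g x) ≡ W i) →
  (∀ x y → W x ≡ W i → W y ≡ W i → toℕ x < toℕ y → toℕ (g x) < toℕ (g y)) → g i ≡ i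
no-drift W g i fix mono = go (ℕₚ.<-cmp (toℕ (g i)) (toℕ i))
  where
  fibre : ∀ k → W (iterate g k i) ≡ W i
  fibre zero = refl
  fibre (suc k) = fix _ (fibre k)
  down : toℕ (g i) < toℕ i → ∀ k → toℕ (iterate g (suc k) i) < toℕ (iterate g k i)
  down lt zero = lt
  down lt (suc k) = mono _ _ (fibre (suc k)) (fibre k) (down lt k)
  up : toℕ i < toℕ (g i) → ∀ k → toℕ (iterate g k i) < toℕ (iterate g (suc k) i)
  up lt zero = lt
  up lt (suc k) = mono _ _ (fibre k) (fibre (suc k)) (up lt k)
  go : _ → g i ≡ i
  go (tri≈ _ e _) = Finₚ.toℕ-injective e
  go (tri< lt _ _) = ⊥-elim (descending-chain g i (down lt))
  go (tri> _ _ lt) = ⊥-elim (ascending-chain g i (up lt))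

iter-shift : ∀ {n} (π : Vec (Fin n) n) t i → iter π (suc t) i ≡ iter π t (lookup π i)
iter-shift π zero i = refl
iter-shift π (suc t) i = cong (lookup π) (iter-shift π t i)

iter-+ : ∀ {n} (π : Vec (Fin n) n) s t i → iter π (s + t) i ≡ iter π s (iter π t i)
iter-+ π zero t i = refl
iter-+ π (suc s) t i = cong (lookup π) (iter-+ π s t i)

IsInjective : ∀ {n} → Vec (Fin n) n → Set
IsInjective π = ∀ i j → lookup π i ≡ lookup π j → i ≡ j

isInjective? : ∀ {n} (π : Vec (Fin n) n) → Dec (IsInjective π)
isInjective? π = Finₚ.all? (λ i → Finₚ.all? (λ j → (lookup π i ≟ᶠ lookup π j) →-dec (i ≟ᶠ j)))

-- The fibres of `f` are consecutive blocks on which `π` increases; thus every descent of `π` lies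
-- at a border between blocks.
Compatible : ∀ {q n} → Vec (Fin n) n → Vec (Fin q) n → Set
Compatible π f = ∀ i j → toℕ i < toℕ j →
  toℕ (lookup f i) ≤ toℕ (lookup f j) × (lookup f i ≡ lookup f j → toℕ (lookup π i) < toℕ (lookup π j))

compatible? : ∀ {q n} (π : Vec (Fin n) n) (f : Vec (Fin q) n) → Dec (Compatible π f)
compatible? π f = Finₚ.all? (λ i → Finₚ.all? (λ j → (toℕ i ℕ.<? toℕ j) →-dec
  ((toℕ (lookup f i) ℕ.≤? toℕ (lookup f j)) ×-dec ((lookup f i ≟ᶠ lookup f j) →-dec (toℕ (lookup π i) ℕ.<? toℕ (lookup π j))))))

AllCycles : ∀ {n} → ℕ → Vec (Fin n) n → Set
AllCycles m π = ∀ i → iter π m i ≡ i × (∀ (d : Fin m) → 0 < toℕ d → iter π (toℕ d) i ≢ i)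

allCycles? : ∀ {n} m (π : Vec (Fin n) n) → Dec (AllCycles m π)
allCycles? m π = Finₚ.all? (λ i → (iter π m i ≟ᶠ i) ×-dec
  Finₚ.all? (λ d → (0 ℕ.<? toℕ d) →-dec ¬? (iter π (toℕ d) i ≟ᶠ i)))

module NecklaceMultisets (q m₀ : ℕ) where

  open Words q m₀ public
  open Standardisation wordEnum code code-injective public

  wcount : ∀ {n} → Vec Word n → Word → ℕ
  wcount W w = count (λ k → lookup W k ≟ʷ w)

  RotClosed : ∀ {n} → Vec Word n → Set
  RotClosed W = ∀ w → wcount W w ≡ wcount W (rot w)

  -- A multiset of r primitive necklaces of length m, represented by the
  -- sorted list of all m r rotations of its members.
  Admissible : ∀ {n} → Vec Word n → Set
  Admissible W = SortedBy code (lookup W) × RotClosed W × (∀ k → Primitive (lookup W k))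

  admissible? : ∀ {n} (W : Vec Word n) → Dec (Admissible W)
  admissible? W =
    Finₚ.all? (λ i → Finₚ.all? (λ j → (toℕ i ℕ.<? toℕ j) →-dec (code (lookup W i) ℕ.≤? code (lookup W j))))
    ×-dec (∀-dec wordEnum (λ w → wcount W w ℕ.≟ wcount W (rot w))
    ×-dec Finₚ.all? (λ k → primitive? (lookup W k)))

  heads : ∀ {n} → Vec Word n → Vec (Fin q) n
  heads W = Vec.map (λ w → get w 0) W

  module _ {n : ℕ} (f : Vec (Fin q) n) where

    word : Vec (Fin n) n → Fin n → Word
    word π i = fromSeq (λ t → lookup f (iter π t i))

    GoodPerm : Vec (Fin n) n → Set
    GoodPerm π = IsInjective π × AllCycles m π × Compatible π f

    GoodWords : Vec Word n → Set
    GoodWords W = Admissible W × heads W ≡ f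

    Matches : Vec (Fin n) n → Vec Word n → Set
    Matches π W = ∀ i → lookup W i ≡ word π i

    module FromPerm (π : Vec (Fin n) n) (good : GoodPerm π) where

      π-inj = proj₁ good
      cycles = proj₁ (proj₂ good)
      compat = proj₂ (proj₂ good)

      iter-* : ∀ a i → iter π (a * m) i ≡ i
      iter-* zero i = refl
      iter-* (suc a) i = trans (iter-+ π m (a * m) i) (trans (proj₁ (cycles _)) (iter-* a i))

      iter-% : ∀ t i → iter π (t % m) i ≡ iter π t i
      iter-% t i = trans (cong (iter π (t % m)) (sym (iter-* (t / m) i)))
        (trans (sym (iter-+ π (t % m) (t / m * m) i)) (cong (λ s → iter π s i) (sym (DM.m≡m%n+[m/n]*n t m))))

      get-word : ∀ i t → get (word π i) t ≡ lookup f (iter π t i)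
      get-word i t = trans (get-fromSeq (λ t → lookup f (iter π t i)) t) (cong (lookup f) (iter-% t i))

      word-rot : ∀ i → word π (lookup π i) ≡ rot (word π i)
      word-rot i = word-ext (λ t _ → trans (get-word _ t) (trans (cong (lookup f) (sym (iter-shift π t i)))
        (sym (trans (get-rot (word π i) t) (get-word i (suc t))))))

      word-rotⁿ : ∀ d i → word π (iter π d i) ≡ rotⁿ d (word π i)
      word-rotⁿ zero i = refl
      word-rotⁿ (suc d) i = trans (word-rot (iter π d i)) (cong rot (word-rotⁿ d i))

      -- Either the first letters already differ, or they agree and compatibility hands the same
      -- comparison to the images under `π`. Truncation after `k` letters turns this into an
      -- induction.
      codes-≤ : ∀ k i j → toℕ i < toℕ j →
        codeₙ q k (λ t → toℕ (lookup f (iter π t i))) ≤ codeₙ q k (λ t → toℕ (lookup f (iter π t j)))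
      codes-≤ zero i j lt = z≤n
      codes-≤ (suc k) i j lt with ℕₚ.m≤n⇒m<n∨m≡n (proj₁ (compat i j lt))
      ... | inj₁ f< = ℕₚ.<⇒≤ (codeₙ-lead-< q k (λ t → toℕ (lookup f (iter π t i))) (λ t → toℕ (lookup f (iter π t j))) (λ t → Finₚ.toℕ<n _) f<)
      ... | inj₂ f≡ = ℕₚ.+-mono-≤ (ℕₚ.≤-reflexive (cong (_* q ℕ.^ k) f≡))
        (subst₂ _≤_ (shift i) (shift j)
          (codes-≤ k _ _ (proj₂ (compat i j lt) (Finₚ.toℕ-injective f≡))))
        where
        shift : ∀ i → codeₙ q k (λ t → toℕ (lookup f (iter π t (lookup π i)))) ≡
                      codeₙ q k (λ t → toℕ (lookup f (iter π (suc t) i)))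
        shift i = codeₙ-cong q k (λ t → cong (toℕ ∘ lookup f) (sym (iter-shift π t i)))

      word-sorted : SortedBy code (word π)
      word-sorted i j lt = subst₂ _≤_ (eq i) (eq j) (codes-≤ m i j lt)
        where
        eq : ∀ i → codeₙ q m (λ t → toℕ (lookup f (iter π t i))) ≡ code (word π i)
        eq i = codeₙ-cong q m (λ t → cong toℕ (sym (get-word i t)))

      -- Positions carrying the same word read equal letters at every step, so compatibility never
      -- lets their order change.
      iter-mono : ∀ d x y → word π x ≡ word π y → toℕ x < toℕ y → toℕ (iter π d x) < toℕ (iter π d y)
      iter-mono zero x y e lt = lt
      iter-mono (suc d) x y e lt = proj₂ (compat _ _ (iter-mono d x y e lt))
        (trans (sym (get-word x d)) (trans (cong (λ w → get w d) e) (get-word y d)))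

      -- If the word had a proper period `d`, then `d` steps of `π` would map its fibre into itself
      -- and preserve the order there, hence fix `i`, against the length of its cycle.
      word-primitive : ∀ i → Primitive (word π i)
      word-primitive i d 0<d periodic = proj₂ (cycles i) d 0<d
        (no-drift (word π) (iter π (toℕ d)) i
          (λ x e → trans (word-rotⁿ (toℕ d) x) (trans (cong (rotⁿ (toℕ d)) e) periodic))
          (λ x y ex ey → iter-mono (toℕ d) x y (trans ex (sym ey))))

      words : Vec Word n
      words = Vec.tabulate (word π)

      lookup-words : ∀ i → lookup words i ≡ word π i
      lookup-words = Vecₚ.lookup∘tabulate (word π)

      words-good : GoodWords words
      words-good = (sorted , closed , (λ k → subst Primitive (sym (lookup-words k)) (word-primitive k))) , heads≡
        where
        sorted : SortedBy code (lookup words)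
        sorted i j lt = subst₂ _≤_ (cong code (sym (lookup-words i))) (cong code (sym (lookup-words j))) (word-sorted i j lt)
        closed : RotClosed words
        closed w = trans
          (count-⇔ (λ k → lookup words k ≟ʷ w) (λ k → lookup words (lookup π k) ≟ʷ rot w)
            (λ k e → trans (step k) (cong rot e)) (λ k e → rot-injective (trans (sym (step k)) e)))
          (∑-permute (lookup π) (λ {i} {j} → π-inj i j) (λ k → N.ind (lookup words k ≟ʷ rot w)))
          where
          step : ∀ k → lookup words (lookup π k) ≡ rot (lookup words k)
          step k = trans (lookup-words (lookup π k)) (trans (word-rot k) (cong rot (sym (lookup-words k))))
        heads≡ : heads words ≡ f
        heads≡ = vec-ext (λ i → trans (Vecₚ.lookup-map i (λ w → get w 0) words)
          (trans (cong (λ w → get w 0) (lookup-words i)) (get-word i 0)))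

      -- The values of `π` are ordered like the rotated words, with ties broken by position. Hence
      -- `π` can be recovered from its words, which is the uniqueness half of the correspondence.
      perm≡std : ∀ i → lookup π i ≡ std (rot ∘ word π) i
      perm≡std i = Finₚ.toℕ-injective (trans (permutation-rank (lookup π) (λ {i} {j} → π-inj i j) i)
        (trans (count-⇔ (λ k → toℕ (lookup π k) ℕ.<? toℕ (lookup π i)) (λ k → precedes? v k i) to from)
               (sym (toℕ-std v i))))
        where
        v : Fin n → Word
        v = rot ∘ word π
        mono : ∀ k i → Precedes v k i → toℕ (lookup π k) < toℕ (lookup π i)
        mono k i (inj₁ lt) = ℕₚ.≰⇒> (λ le → ℕₚ.<⇒≱ lt
          (subst₂ _≤_ (cong code (word-rot i)) (cong code (word-rot k)) (sorted-≤ {W = word π} word-sorted _ _ le)))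
        mono k i (inj₂ (e , lt)) = iter-mono 1 k i (rot-injective (code-injective e)) lt
        from : ∀ k → Precedes v k i → toℕ (lookup π k) < toℕ (lookup π i)
        from k = mono k i
        to : ∀ k → toℕ (lookup π k) < toℕ (lookup π i) → Precedes v k i
        to k lt with k ≟ᶠ i
        ... | yes refl = ⊥-elim (ℕₚ.<-irrefl refl lt)
        ... | no k≢i with precedes-total v k i k≢i
        ... | inj₁ p = p
        ... | inj₂ p = ⊥-elim (ℕₚ.<-asym lt (mono i k p))

    module FromWords (W : Vec Word n) (good : GoodWords W) where

      sorted = proj₁ (proj₁ good)
      closed = proj₁ (proj₂ (proj₁ good))
      prim = proj₂ (proj₂ (proj₁ good))

      v : Fin n → Word
      v = rot ∘ lookup W

      π : Vec (Fin n) n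
      π = Vec.tabulate (std v)

      lookup-π : ∀ i → lookup π i ≡ std v i
      lookup-π = Vecₚ.lookup∘tabulate (std v)

      same : SameCounts v (lookup W)
      same a = trans (count-⇔ (λ k → v k ≟ʷ a) (λ k → lookup W k ≟ʷ u)
                 (λ k e → rot-injective (trans e (sym rot-u))) (λ k e → trans (cong rot e) rot-u))
               (trans (closed u) (cong (wcount W) rot-u))
        where
        -- `u` is the word whose rotation is `a`; closure under rotation equates their
        -- multiplicities.
        u = rotⁿ m₀ a
        rot-u : rot u ≡ a
        rot-u = rotⁿ-m a

      W-π : ∀ i → lookup W (lookup π i) ≡ rot (lookup W i)
      W-π i = trans (cong (lookup W) (lookup-π i)) (sorted-std sorted same i)

      W-iter : ∀ t i → lookup W (iter π t i) ≡ rotⁿ t (lookup W i)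
      W-iter zero i = refl
      W-iter (suc t) i = trans (W-π (iter π t i)) (cong rot (W-iter t i))

      f≡head : ∀ i → lookup f i ≡ get (lookup W i) 0
      f≡head i = trans (cong (λ g → lookup g i) (sym (proj₂ good))) (Vecₚ.lookup-map i (λ w → get w 0) W)

      matches : Matches π W
      matches i = word-ext (λ t t<m → sym (begin
        get (word π i) t                    ≡⟨ get-fromSeq (λ t → lookup f (iter π t i)) t ⟩
        lookup f (iter π (t % m) i)         ≡⟨ f≡head _ ⟩
        get (lookup W (iter π (t % m) i)) 0 ≡⟨ cong (λ w → get w 0) (W-iter (t % m) i) ⟩
        get (rotⁿ (t % m) (lookup W i)) 0   ≡⟨ get-rotⁿ (t % m) (lookup W i) 0 ⟩
        get (lookup W i) (t % m + 0)        ≡⟨ cong (get (lookup W i)) (trans (ℕₚ.+-identityʳ _) (DM.m<n⇒m%n≡m t<m)) ⟩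
        get (lookup W i) t                  ∎))
        where open ≡-Reasoning

      π-compat : Compatible π f
      π-compat i j lt = subst₂ _≤_ (cong toℕ (sym (f≡head i))) (cong toℕ (sym (f≡head j))) (code-head-≤ (lookup W i) (lookup W j) (sorted i j lt)) , strict
        where
        strict : lookup f i ≡ lookup f j → toℕ (lookup π i) < toℕ (lookup π j)
        strict e = subst₂ _<_ (cong toℕ (sym (lookup-π i))) (cong toℕ (sym (lookup-π j))) (std-mono v precedes)
          where
          precedes : Precedes v i j
          precedes with ℕₚ.m≤n⇒m<n∨m≡n (code-rot-≤ (lookup W i) (lookup W j)
                          (trans (sym (f≡head i)) (trans e (f≡head j))) (sorted i j lt))
          ... | inj₁ p = inj₁ p
          ... | inj₂ p = inj₂ (p , lt)

      iter-mono : ∀ d x y → lookup W x ≡ lookup W y → toℕ x < toℕ y → toℕ (iter π d x) < toℕ (iter π d y)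
      iter-mono zero x y e lt = lt
      iter-mono (suc d) x y e lt = proj₂ (π-compat _ _ (iter-mono d x y e lt))
        (trans (f≡head _) (trans (cong (λ w → get w 0)
          (trans (W-iter d x) (trans (cong (rotⁿ d) e) (sym (W-iter d y))))) (sym (f≡head _))))

      π-good : GoodPerm π
      π-good = (λ i j e → std-injective v (trans (sym (lookup-π i)) (trans e (lookup-π j))))
             -- After `m` steps the word at a position is again the same; order preservation on its
             -- fibre turns this into a return of the position itself.
             , (λ i → no-drift (lookup W) (iter π m) i
                  (λ x e → trans (W-iter m x) (trans (rotⁿ-m _) e))
                  (λ x y ex ey → iter-mono m x y (trans ex (sym ey)))
                , λ d 0<d e → prim i d 0<d (trans (sym (W-iter (toℕ d) i)) (cong (lookup W) e)))
             , π-compat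

    goodPerm? : ∀ π → Dec (GoodPerm π)
    goodPerm? π = isInjective? π ×-dec (allCycles? m π ×-dec compatible? π f)

    goodWords? : ∀ W → Dec (GoodWords W)
    goodWords? W = admissible? W ×-dec Vecₚ.≡-dec _≟ᶠ_ (heads W) f

    matches? : ∀ π W → Dec (Matches π W)
    matches? π W = Finₚ.all? (λ i → lookup W i ≟ʷ word π i)

    gessel-reutenauer : Q.∑ (vecsOver (allFin n) n) (λ π → Q.ind (goodPerm? π)) ≡
                        Q.∑ (vecsOver (vecsOver (allFin q) m) n) (λ W → Q.ind (goodWords? W))
    gessel-reutenauer =
      trans (Q.∑-cong (vecsOver (allFin n) n) (λ π → sym (ℚₚ.*-identityʳ _)))
      (trans (Q.∑-bijection (Q.vecEnum (Q.finEnum n) n) (Q.vecEnum (Q.vecEnum (Q.finEnum q) m) n)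
        goodPerm? goodWords? matches? (λ _ → 1ℚ) (λ _ → 1ℚ)
        (λ π good → let open FromPerm π good in words , words-good , lookup-words)
        (λ W good → let open FromWords W good in π , π-good , matches)
        (λ π W W′ _ _ x x′ → vec-ext (λ i → trans (x i) (sym (x′ i))))
        (λ π π′ W good good′ x x′ → vec-ext (λ i →
          trans (FromPerm.perm≡std π good i)
          (trans (std-cong (λ k → cong rot (trans (sym (x k)) (x′ k))) i) (sym (FromPerm.perm≡std π′ good′ i)))))
        (λ _ _ _ _ _ → refl))
      (Q.∑-cong (vecsOver (vecsOver (allFin q) m) n) (λ W → ℚₚ.*-identityʳ _)))
      where
      std-cong : ∀ {u v : Fin n → Word} → (∀ k → u k ≡ v k) → ∀ i → std u i ≡ std v i
      std-cong {u} {v} e i = Finₚ.toℕ-injective (trans (toℕ-std u i) (trans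
        (count-⇔ (λ k → precedes? u k i) (λ k → precedes? v k i)
          (λ k → subst₂ (λ x y → code x < code y ⊎ (code x ≡ code y × toℕ k < toℕ i)) (e k) (e i))
          (λ k → subst₂ (λ x y → code x < code y ⊎ (code x ≡ code y × toℕ k < toℕ i)) (sym (e k)) (sym (e i))))
        (sym (toℕ-std v i))))

-- Sorted lists with prescribed multiplicities

module _ {A : Set} (EA : Enumeration A) where

  open Enumeration EA

  ind*-≤ : ∀ {P : Set} (p? : Dec P) x → N.ind p? * x ≤ x
  ind*-≤ (yes _) x = ℕₚ.≤-reflexive (ℕₚ.+-identityʳ x)
  ind*-≤ (no _) x = z≤n

  ∑-zero⁻¹ : (M : A → ℕ) → N.∑ elements M ≡ 0 → ∀ a → M a ≡ 0
  ∑-zero⁻¹ M e a = ℕₚ.n≤0⇒n≡0 (subst₂ _≤_ (∑-dirac a M) e (∑ₙ-mono elements (λ x → ind*-≤ (x ≟ a) (M x))))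

  -- The bound `c` on the key of the current candidate is the fuel of the search: each better
  -- candidate lowers it.
  minimal : (key : A → ℕ) (M : A → ℕ) (c : ℕ) (a : A) → 0 < M a → key a ≤ c →
            ∃ λ a₀ → 0 < M a₀ × (∀ a′ → 0 < M a′ → key a₀ ≤ key a′)
  minimal key M c a pos le with ∃-dec EA (λ a′ → (0 ℕ.<? M a′) ×-dec (key a′ ℕ.<? key a))
  ... | inj₂ none = a , pos , λ a′ pos′ → ℕₚ.≮⇒≥ (λ lt → none a′ (pos′ , lt))
  minimal key M zero a pos le | inj₁ (a′ , pos′ , lt) = ⊥-elim (ℕₚ.n≮0 (ℕₚ.<-≤-trans lt le))
  minimal key M (suc c) a pos le | inj₁ (a′ , pos′ , lt) = minimal key M c a′ pos′ (ℕ.s≤s⁻¹ (ℕₚ.<-≤-trans lt le))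

  count-∷ : ∀ {n} (x : A) (W : Vec A n) a →
            count (λ k → lookup (x ∷ W) k ≟ a) ≡ N.ind (x ≟ a) + count (λ k → lookup W k ≟ a)
  count-∷ {n} x W a = N.∑-allFin-suc n (λ k → N.ind (lookup (x ∷ W) k ≟ a))

  count-member : ∀ {n} (W : Vec A n) i → 0 < count (λ k → lookup W k ≟ lookup W i)
  count-member {n} W i = ℕₚ.≤-trans (s≤s z≤n)
    (count-mono-< (λ _ → no id) (λ k → lookup W k ≟ lookup W i) (λ _ ()) i refl id)

  -- Selection sort on a multiplicity function: one copy of an element of least key is put in front,
  -- and the rest is built from the reduced multiplicities.
  sorted-exists : (key : A → ℕ) (n : ℕ) (M : A → ℕ) → N.∑ elements M ≡ n →
    ∃ λ (W : Vec A n) → SortedBy key (lookup W) × (∀ a → count (λ k → lookup W k ≟ a) ≡ M a)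
  sorted-exists key zero M e = [] , (λ ()) , λ a → sym (∑-zero⁻¹ M e a)
  sorted-exists key (suc n) M e with ∃-dec EA (λ a → 0 ℕ.<? M a)
  ... | inj₂ none with () ← trans (sym e) (N.∑-zero elements (λ a → ℕₚ.n≤0⇒n≡0 (ℕₚ.≮⇒≥ (none a))))
  ... | inj₁ (a , pos) with minimal key M (key a) a pos ℕₚ.≤-refl
  ... | a₀ , pos₀ , least = a₀ ∷ proj₁ IH , sorted , counts
    where
    M′ : A → ℕ
    M′ x = M x ∸ N.ind (x ≟ a₀)
    split : ∀ x (d : Dec (x ≡ a₀)) → M x ≡ N.ind d + (M x ∸ N.ind d)
    split x (no _) = refl
    split x (yes refl) = sym (ℕₚ.m+[n∸m]≡n pos₀)
    total : N.∑ elements M′ ≡ n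
    total = ℕₚ.suc-injective (trans (sym (trans (N.∑-cong elements (λ x → split x (x ≟ a₀)))
      (trans (N.∑-+ elements _ M′) (cong (_+ N.∑ elements M′) (∑-unique₁ (_≟ a₀) a₀ refl (λ _ e → e)))))) e)
    IH = sorted-exists key n M′ total
    counts : ∀ a → count (λ k → lookup (a₀ ∷ proj₁ IH) k ≟ a) ≡ M a
    counts a = trans (count-∷ a₀ (proj₁ IH) a) (trans (cong₂ _+_ (N.ind-⇔ (a₀ ≟ a) (a ≟ a₀) sym sym) (proj₂ (proj₂ IH) a))
      (sym (split a (a ≟ a₀))))
    sorted : SortedBy key (lookup (a₀ ∷ proj₁ IH))
    sorted zero zero ()
    sorted zero (suc j) _ = least _ (ℕₚ.<-≤-trans (subst (0 <_) (proj₂ (proj₂ IH) _) (count-member (proj₁ IH) j))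
      (ℕₚ.m∸n≤m (M _) (N.ind (lookup (proj₁ IH) j ≟ a₀))))
    sorted (suc i) zero ()
    sorted (suc i) (suc j) (s≤s lt) = proj₁ (proj₂ IH) i j lt

-- When `h k` equals `h 0`, this says that a sum over a full turn is invariant under a cyclic shift.
∑-telescope : ∀ (h : ℕ → ℕ) k → h 0 + N.∑ (allFin k) (λ t → h (suc (toℕ t))) ≡ N.∑ (allFin k) (h ∘ toℕ) + h k
∑-telescope h zero = ℕₚ.+-identityʳ (h 0)
∑-telescope h (suc k) = begin
  h 0 + N.∑ (allFin (suc k)) (λ t → h (suc (toℕ t)))
    ≡⟨ cong (h 0 +_) (trans (N.∑-allFin-suc k (λ t → h (suc (toℕ t)))) (∑-telescope (h ∘ suc) k)) ⟩
  h 0 + (N.∑ (allFin k) (h ∘ suc ∘ toℕ) + h (suc k))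
    ≡⟨ ℕₚ.+-assoc (h 0) _ _ ⟨
  h 0 + N.∑ (allFin k) (h ∘ suc ∘ toℕ) + h (suc k)
    ≡⟨ cong (_+ h (suc k)) (N.∑-allFin-suc k (h ∘ toℕ)) ⟨
  N.∑ (allFin (suc k)) (h ∘ toℕ) + h (suc k) ∎
  where open ≡-Reasoning

∑-ind-≤ : ∀ r c → c ≤ r → N.∑ (allFin r) (λ j → N.ind (suc (toℕ j) ℕ.≤? c)) ≡ c
∑-ind-≤ zero zero le = refl
∑-ind-≤ (suc r) zero le = N.∑-zero (allFin (suc r)) (λ j → N.ind-no (suc (toℕ j) ℕ.≤? 0) (λ ()))
∑-ind-≤ (suc r) (suc c) (s≤s le) = trans (N.∑-allFin-suc r (λ j → N.ind (suc (toℕ j) ℕ.≤? suc c)))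
  (cong suc (trans (N.∑-cong (allFin r) (λ j → N.ind-⇔ (suc (suc (toℕ j)) ℕ.≤? suc c) (suc (toℕ j) ℕ.≤? c) ℕ.s≤s⁻¹ s≤s))
  (∑-ind-≤ r c le)))

_⊞_ : ∀ {q} → Vec ℕ q → Vec ℕ q → Vec ℕ q
_⊞_ = Vec.zipWith _+_

_⋆_ : ∀ {q} → ℕ → Vec ℕ q → Vec ℕ q
j ⋆ α = Vec.map (j *_) α

infixl 6 _⊞_
infixl 7 _⋆_

content : ∀ {q n} → (Fin n → Fin q) → Vec ℕ q
content h = Vec.tabulate (λ a → count (λ k → h k ≟ᶠ a))

-- Marking and removing necklaces

module Recurrence (q m₀ : ℕ) where

  open NecklaceMultisets q m₀ public

  words : List Word
  words = vecsOver (allFin q) m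

  -- In an admissible list all rotations of each necklace are present, so every letter of every
  -- necklace is the head of exactly one entry: the heads carry the content of the whole multiset.
  headContent : ∀ {n} → Vec Word n → Vec ℕ q
  headContent W = content (λ k → get (lookup W k) 0)

  wordContent : Word → Vec ℕ q
  wordContent w = content (λ (t : Fin m) → get w (toℕ t))

  necklaceSum : ℕ → (Vec ℕ q → ℚ) → ℚ
  necklaceSum r ψ = Q.∑ (vecsOver words (m * r)) (λ W → Q.ind (admissible? W) *ℚ ψ (headContent W))

  orbit : Word → Word → ℕ
  orbit w v = count (λ (t : Fin m) → rotⁿ (toℕ t) w ≟ʷ v)

  orbit-rot : ∀ w v → orbit w v ≡ orbit w (rot v)
  orbit-rot w v = trans (N.∑-cong (allFin m) (λ t → N.ind-⇔ (rotⁿ (toℕ t) w ≟ʷ v) (rotⁿ (suc (toℕ t)) w ≟ʷ rot v) (cong rot) rot-injective))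
    (ℕₚ.+-cancelˡ-≡ (h 0) _ _ (trans (∑-telescope h m) (trans (cong (N.∑ (allFin m) (h ∘ toℕ) +_) h-m) (ℕₚ.+-comm _ (h 0)))))
    where
    h : ℕ → ℕ
    h t = N.ind (rotⁿ t w ≟ʷ rot v)
    h-m : h m ≡ h 0
    h-m = cong (λ u → N.ind (u ≟ʷ rot v)) (rotⁿ-m w)

  orbit-total : ∀ w → N.∑ words (orbit w) ≡ m
  orbit-total w = trans (N.∑-cong words (λ v → sym (ℕₚ.*-identityʳ _)))
    (trans (sym (∑-by-counts (λ (t : Fin m) → rotⁿ (toℕ t) w) (λ _ → 1))) (∑-allFin-1 m))

  wcount-total : ∀ {n} (W : Vec Word n) → N.∑ words (wcount W) ≡ n
  wcount-total {n} W = trans (N.∑-cong words (λ v → sym (ℕₚ.*-identityʳ _)))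
    (trans (sym (∑-by-counts (lookup W) (λ _ → 1))) (∑-allFin-1 n))

  rotⁿ-injective : ∀ t {w v} → rotⁿ t w ≡ rotⁿ t v → w ≡ v
  rotⁿ-injective zero e = e
  rotⁿ-injective (suc t) e = rotⁿ-injective t (rot-injective e)

  rotⁿ-comm : ∀ s t w → rotⁿ s (rotⁿ t w) ≡ rotⁿ t (rotⁿ s w)
  rotⁿ-comm s t w = trans (sym (iterate-+ rot s t w)) (trans (cong (λ k → rotⁿ k w) (ℕₚ.+-comm s t)) (iterate-+ rot t s w))

  primitive-rotⁿ : ∀ t {w} → Primitive w → Primitive (rotⁿ t w)
  primitive-rotⁿ t {w} prim d 0<d e = prim d 0<d (rotⁿ-injective t (trans (rotⁿ-comm t (toℕ d) w) e))

  primitive-distinct : ∀ {w} → Primitive w → (s t : Fin m) → toℕ s < toℕ t → rotⁿ (toℕ s) w ≢ rotⁿ (toℕ t) w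
  primitive-distinct {w} prim s t lt e = prim d (subst (0 <_) (sym d≡) (ℕₚ.m<n⇒0<n∸m lt))
    (trans (cong (λ k → rotⁿ k w) d≡) (rotⁿ-injective (toℕ s) (sym (trans e
      (trans (cong (λ k → rotⁿ k w) (sym (ℕₚ.m+[n∸m]≡n (ℕₚ.<⇒≤ lt)))) (iterate-+ rot (toℕ s) (toℕ t ∸ toℕ s) w))))))
    where
    d< : toℕ t ∸ toℕ s < m
    d< = ℕₚ.≤-<-trans (ℕₚ.m∸n≤m (toℕ t) (toℕ s)) (Finₚ.toℕ<n t)
    d = Fin.fromℕ< d<
    d≡ : toℕ d ≡ toℕ t ∸ toℕ s
    d≡ = Finₚ.toℕ-fromℕ< d<

  orbit-member : ∀ {w} → Primitive w → (t : Fin m) → orbit w (rotⁿ (toℕ t) w) ≡ 1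
  orbit-member {w} prim t = Enumeration.∑-unique₁ (finEnum m) (λ s → rotⁿ (toℕ s) w ≟ʷ rotⁿ (toℕ t) w) t refl same
    where
    same : ∀ s → rotⁿ (toℕ s) w ≡ rotⁿ (toℕ t) w → s ≡ t
    same s e with ℕₚ.<-cmp (toℕ s) (toℕ t)
    ... | tri< lt _ _ = ⊥-elim (primitive-distinct prim s t lt e)
    ... | tri≈ _ e′ _ = Finₚ.toℕ-injective e′
    ... | tri> _ _ lt = ⊥-elim (primitive-distinct prim t s lt (sym e))

  orbit-cases : ∀ w v → (∃ λ t → rotⁿ (toℕ t) w ≡ v) ⊎ orbit w v ≡ 0
  orbit-cases w v with ∃-dec (finEnum m) (λ t → rotⁿ (toℕ t) w ≟ʷ v)
  ... | inj₁ h = inj₁ h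
  ... | inj₂ none = inj₂ (N.∑-zero (allFin m) (λ t → N.ind-no (rotⁿ (toℕ t) w ≟ʷ v) (none t)))

  module _ {n : ℕ} (W : Vec Word n) (closed : RotClosed W) where

    wcount-rotⁿ : ∀ t w → wcount W (rotⁿ t w) ≡ wcount W w
    wcount-rotⁿ zero w = refl
    wcount-rotⁿ (suc t) w = trans (sym (closed (rotⁿ t w))) (wcount-rotⁿ t w)

    -- Closure under rotation gives all rotations of `w` the same multiplicity, and primitivity
    -- keeps them distinct; so `j` copies of `w` come with `j` copies of the whole necklace.
    orbit-≤-wcount : ∀ {w} → Primitive w → ∀ j → j ≤ wcount W w → ∀ v → j * orbit w v ≤ wcount W v
    orbit-≤-wcount {w} prim j le v with orbit-cases w v
    ... | inj₂ e rewrite e | ℕₚ.*-zeroʳ j = z≤n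
    ... | inj₁ (t , refl) rewrite orbit-member prim t | ℕₚ.*-identityʳ j | wcount-rotⁿ (toℕ t) w = le

    orbit-room : ∀ {w} → Primitive w → ∀ j → j ≤ wcount W w → j * m ≤ n
    orbit-room {w} prim j le = begin
      j * m                             ≡⟨ cong (j *_) (orbit-total w) ⟨
      j * N.∑ words (orbit w)           ≡⟨ N.∑-*ˡ words j (orbit w) ⟨
      N.∑ words (λ v → j * orbit w v)   ≤⟨ ∑ₙ-mono words (orbit-≤-wcount prim j le) ⟩
      N.∑ words (wcount W)              ≡⟨ wcount-total W ⟩
      n ∎
      where open ℕₚ.≤-Reasoning

  wcount-pos⇒primitive : ∀ {n} (W : Vec Word n) → Admissible W → ∀ v → 0 < wcount W v → Primitive v
  wcount-pos⇒primitive {n} W adm v pos with ∃-dec (finEnum n) (λ k → lookup W k ≟ʷ v)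
  ... | inj₁ (k , refl) = proj₂ (proj₂ adm) k
  ... | inj₂ none = ⊥-elim (ℕₚ.<-irrefl refl (subst (0 <_) (N.∑-zero (allFin n) (λ k → N.ind-no (lookup W k ≟ʷ v) (none k))) pos))

  -- Multiplicities determine an admissible list, so the places at which the copies of the necklace
  -- are inserted need not be tracked.
  Extends : ∀ {n n′} → Word → ℕ → Vec Word n → Vec Word n′ → Set
  Extends w j W W′ = ∀ v → wcount W v ≡ wcount W′ v + j * orbit w v

  extends? : ∀ {n n′} w j (W : Vec Word n) (W′ : Vec Word n′) → Dec (Extends w j W W′)
  extends? w j W W′ = ∀-dec wordEnum (λ v → wcount W v ℕ.≟ wcount W′ v + j * orbit w v)

  extends-content : ∀ {n n′} w j (W : Vec Word n) (W′ : Vec Word n′) → Extends w j W W′ →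
                    headContent W ≡ headContent W′ ⊞ j ⋆ wordContent w
  extends-content {n} {n′} w j W W′ ext = vec-ext (λ a → begin
    lookup (headContent W) a                                 ≡⟨ Vecₚ.lookup∘tabulate _ a ⟩
    count (λ k → get (lookup W k) 0 ≟ᶠ a)                    ≡⟨ ∑-by-counts (lookup W) (h a) ⟩
    N.∑ words (λ v → wcount W v * h a v)                     ≡⟨ N.∑-cong words (λ v → trans (cong (_* h a v) (ext v))
                                                                  (trans (ℕₚ.*-distribʳ-+ (h a v) (wcount W′ v) _) (cong (wcount W′ v * h a v +_) (ℕₚ.*-assoc j (orbit w v) (h a v))))) ⟩
    N.∑ words (λ v → wcount W′ v * h a v + j * (orbit w v * h a v))
                                                             ≡⟨ trans (N.∑-+ words _ _) (cong₂ _+_ (sym (∑-by-counts (lookup W′) (h a)))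
                                                                  (trans (N.∑-*ˡ words j _) (cong (j *_) (sym (∑-by-counts (λ (t : Fin m) → rotⁿ (toℕ t) w) (h a)))))) ⟩
    count (λ k → get (lookup W′ k) 0 ≟ᶠ a) + j * count (λ (t : Fin m) → get (rotⁿ (toℕ t) w) 0 ≟ᶠ a)
                                                             ≡⟨ cong₂ _+_ (sym (Vecₚ.lookup∘tabulate _ a)) (cong (j *_)
                                                                  (trans (N.∑-cong (allFin m) (λ t → cong (λ x → N.ind (x ≟ᶠ a))
                                                                    (trans (get-rotⁿ (toℕ t) w 0) (cong (get w) (ℕₚ.+-identityʳ (toℕ t)))))) (sym (Vecₚ.lookup∘tabulate _ a)))) ⟩
    lookup (headContent W′) a + j * lookup (wordContent w) a ≡⟨ cong (lookup (headContent W′) a +_) (Vecₚ.lookup-map a (j *_) (wordContent w)) ⟨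
    lookup (headContent W′) a + lookup (j ⋆ wordContent w) a ≡⟨ Vecₚ.lookup-zipWith _+_ a (headContent W′) (j ⋆ wordContent w) ⟨
    lookup (headContent W′ ⊞ j ⋆ wordContent w) a            ∎)
    where
    open ≡-Reasoning
    h : Fin q → Word → ℕ
    h a v = N.ind (get v 0 ≟ᶠ a)

  admissible-unique : ∀ {n} {W W′ : Vec Word n} → Admissible W → Admissible W′ → (∀ v → wcount W v ≡ wcount W′ v) → W ≡ W′
  admissible-unique {W = W} {W′} adm adm′ e = vec-ext (λ i → sym (sorted-unique {v = lookup W} {W = lookup W′} (proj₁ adm) (proj₁ adm′) e i))

  module _ {w : Word} (prim : Primitive w) (r j : ℕ) (j≤r : j ≤ r) where

    size : m * (r ∸ j) + j * m ≡ m * r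
    size = trans (cong (m * (r ∸ j) +_) (ℕₚ.*-comm j m)) (trans (sym (ℕₚ.*-distribˡ-+ m (r ∸ j) j)) (cong (m *_) (ℕₚ.m∸n+n≡m j≤r)))

    shrink : (W : Vec Word (m * r)) → Admissible W × j ≤ wcount W w →
             ∃ λ (W′ : Vec Word (m * (r ∸ j))) → Admissible W′ × Extends w j W W′
    shrink W (adm , le) = W′ , (sorted , closed , prims) , (λ v → trans (sym (M+ v)) (cong (_+ j * orbit w v) (sym (counts v))))
      where
      M : Word → ℕ
      M v = wcount W v ∸ j * orbit w v
      M+ : ∀ v → M v + j * orbit w v ≡ wcount W v
      M+ v = ℕₚ.m∸n+n≡m (orbit-≤-wcount W (proj₁ (proj₂ adm)) prim j le v)
      total : N.∑ words M ≡ m * (r ∸ j)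
      total = ℕₚ.+-cancelʳ-≡ (j * m) _ _ (begin
        N.∑ words M + j * m                       ≡⟨ cong (λ x → N.∑ words M + j * x) (orbit-total w) ⟨
        N.∑ words M + j * N.∑ words (orbit w)     ≡⟨ cong (N.∑ words M +_) (N.∑-*ˡ words j (orbit w)) ⟨
        N.∑ words M + N.∑ words (λ v → j * orbit w v) ≡⟨ N.∑-+ words M _ ⟨
        N.∑ words (λ v → M v + j * orbit w v)     ≡⟨ N.∑-cong words M+ ⟩
        N.∑ words (wcount W)                      ≡⟨ wcount-total W ⟩
        m * r                                     ≡⟨ size ⟨
        m * (r ∸ j) + j * m                       ∎)
        where open ≡-Reasoning
      ex = sorted-exists wordEnum code (m * (r ∸ j)) M total
      W′ = proj₁ ex
      sorted = proj₁ (proj₂ ex)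
      counts : ∀ v → wcount W′ v ≡ M v
      counts = proj₂ (proj₂ ex)
      closed : RotClosed W′
      closed v = trans (counts v) (trans (cong₂ (λ x y → x ∸ j * y) (proj₁ (proj₂ adm) v) (orbit-rot w v)) (sym (counts (rot v))))
      prims : ∀ k → Primitive (lookup W′ k)
      prims k = wcount-pos⇒primitive W adm _ (ℕₚ.<-≤-trans (subst (0 <_) (counts _) (count-member wordEnum W′ k))
        (ℕₚ.m∸n≤m (wcount W (lookup W′ k)) (j * orbit w (lookup W′ k))))

    grow : (W′ : Vec Word (m * (r ∸ j))) → Admissible W′ →
           ∃ λ (W : Vec Word (m * r)) → (Admissible W × j ≤ wcount W w) × Extends w j W W′
    grow W′ adm = W , ((sorted , closed , prims) , enough) , counts
      where
      M : Word → ℕ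
      M v = wcount W′ v + j * orbit w v
      total : N.∑ words M ≡ m * r
      total = trans (N.∑-+ words _ _) (trans (cong₂ _+_ (wcount-total W′) (trans (N.∑-*ˡ words j (orbit w)) (cong (j *_) (orbit-total w)))) size)
      ex = sorted-exists wordEnum code (m * r) M total
      W = proj₁ ex
      sorted = proj₁ (proj₂ ex)
      counts : ∀ v → wcount W v ≡ M v
      counts = proj₂ (proj₂ ex)
      closed : RotClosed W
      closed v = trans (counts v) (trans (cong₂ (λ x y → x + j * y) (proj₁ (proj₂ adm) v) (orbit-rot w v)) (sym (counts (rot v))))
      prims : ∀ k → Primitive (lookup W k)
      prims k with orbit-cases w (lookup W k)
      ... | inj₁ (t , e) = subst Primitive e (primitive-rotⁿ (toℕ t) prim)
      ... | inj₂ e = wcount-pos⇒primitive W′ adm _ (subst (0 <_)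
        (trans (counts _) (trans (cong (λ x → wcount W′ (lookup W k) + j * x) e) (trans (cong (wcount W′ (lookup W k) +_) (ℕₚ.*-zeroʳ j)) (ℕₚ.+-identityʳ _))))
        (count-member wordEnum W k))
      enough : j ≤ wcount W w
      enough = subst (j ≤_) (sym (trans (counts w) (cong (λ x → wcount W′ w + j * x) (orbit-member prim zero))))
        (ℕₚ.≤-trans (ℕₚ.≤-reflexive (sym (ℕₚ.*-identityʳ j))) (ℕₚ.m≤n+m (j * 1) (wcount W′ w)))

    -- Taking away `j` copies of the necklace of `w` is a bijection from the multisets that contain
    -- them onto all smaller ones; the content of what was removed stays behind in the argument of
    -- `ψ`.
    remove-orbits : (ψ : Vec ℕ q → ℚ) →
      Q.∑ (vecsOver words (m * r)) (λ W → Q.ind (admissible? W ×-dec (j ℕ.≤? wcount W w)) *ℚ ψ (headContent W)) ≡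
      necklaceSum (r ∸ j) (λ α → ψ (α ⊞ j ⋆ wordContent w))
    remove-orbits ψ = Q.∑-bijection (E (m * r)) (E (m * (r ∸ j)))
      (λ W → admissible? W ×-dec (j ℕ.≤? wcount W w)) admissible? (extends? w j)
      (λ W → ψ (headContent W)) (λ W′ → ψ (headContent W′ ⊞ j ⋆ wordContent w))
      shrink grow
      (λ W W₁ W₂ adm₁ adm₂ x₁ x₂ → admissible-unique adm₁ adm₂ (λ v → ℕₚ.+-cancelʳ-≡ (j * orbit w v) _ _ (trans (sym (x₁ v)) (x₂ v))))
      (λ W₁ W₂ W′ adm₁ adm₂ x₁ x₂ → admissible-unique (proj₁ adm₁) (proj₁ adm₂) (λ v → trans (x₁ v) (sym (x₂ v))))
      (λ W W′ _ _ x → cong ψ (extends-content w j W W′ x))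
      where
      E : ∀ n → Q.Enumeration (Vec Word n)
      E n = Q.vecEnum (Q.vecEnum (Q.finEnum q) m) n

  -- The weight m r is the number of ways to mark a rotation w of a member of
  -- the multiset; marking the j-th copy of w amounts to removing j copies.
  necklace-recurrence : ∀ r (ψ : Vec ℕ q → ℚ) → ℕtoℚ (m * r) *ℚ necklaceSum r ψ ≡
    Q.∑ (allFin r) (λ j → Q.∑ words (λ w → Q.ind (primitive? w) *ℚ
      necklaceSum (r ∸ suc (toℕ j)) (λ α → ψ (α ⊞ suc (toℕ j) ⋆ wordContent w))))
  necklace-recurrence r ψ = begin
    ℕtoℚ (m * r) *ℚ necklaceSum r ψ
      ≡⟨ Q.∑-*ˡ V (ℕtoℚ (m * r)) _ ⟨
    Q.∑ V (λ W → ℕtoℚ (m * r) *ℚ (Q.ind (admissible? W) *ℚ ψ (headContent W)))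
      ≡⟨ Q.∑-cong V (λ W → expand W (admissible? W)) ⟩
    Q.∑ V (λ W → Q.∑ F (λ j → Q.∑ words (λ w → Q.ind (primitive? w) *ℚ (term (suc (toℕ j)) w W))))
      ≡⟨ Q.∑-swap V F _ ⟩
    Q.∑ F (λ j → Q.∑ V (λ W → Q.∑ words (λ w → Q.ind (primitive? w) *ℚ (term (suc (toℕ j)) w W))))
      ≡⟨ Q.∑-cong F (λ j → trans (Q.∑-swap V words _) (Q.∑-cong words (λ w → trans (Q.∑-*ˡ V (Q.ind (primitive? w)) _)
           (Q.ind-cong (primitive? w) (λ prim → remove-orbits prim r (suc (toℕ j)) (Finₚ.toℕ<n j) ψ))))) ⟩
    Q.∑ F (λ j → Q.∑ words (λ w → Q.ind (primitive? w) *ℚ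
      necklaceSum (r ∸ suc (toℕ j)) (λ α → ψ (α ⊞ suc (toℕ j) ⋆ wordContent w)))) ∎
    where
    open ≡-Reasoning
    V = vecsOver words (m * r)
    F = allFin r
    term : ℕ → Word → Vec Word (m * r) → ℚ
    term j w W = Q.ind (admissible? W ×-dec (j ℕ.≤? wcount W w)) *ℚ ψ (headContent W)
    -- The `m r` entries are counted word by word, a word of multiplicity `c` once for each
    -- threshold `j + 1 ≤ c`. Thresholds up to `r` are enough, since each copy of a word brings `m`
    -- entries with it.
    marks : ∀ W → Admissible W → m * r ≡ N.∑ F (λ j → N.∑ words (λ w → N.ind (primitive? w) * N.ind (admissible? W ×-dec (suc (toℕ j) ℕ.≤? wcount W w))))
    marks W adm = trans (sym (wcount-total W)) (trans (N.∑-cong words (λ w → copies w (primitive? w))) (N.∑-swap words F _))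
      where
      copies : ∀ w (p? : Dec (Primitive w)) → wcount W w ≡ N.∑ F (λ j → N.ind p? * N.ind (admissible? W ×-dec (suc (toℕ j) ℕ.≤? wcount W w)))
      copies w (no ¬p) = trans (ℕₚ.n≤0⇒n≡0 (ℕₚ.≮⇒≥ (λ pos → ¬p (wcount-pos⇒primitive W adm w pos)))) (sym (N.∑-zero F (λ _ → refl)))
      copies w (yes p) = trans (sym (∑-ind-≤ r (wcount W w) (ℕₚ.*-cancelʳ-≤ (wcount W w) r m
          (ℕₚ.≤-trans (orbit-room W (proj₁ (proj₂ adm)) p (wcount W w) ℕₚ.≤-refl) (ℕₚ.≤-reflexive (ℕₚ.*-comm m r))))))
        (N.∑-cong F (λ j → trans (N.ind-⇔ (suc (toℕ j) ℕ.≤? wcount W w) (admissible? W ×-dec (suc (toℕ j) ℕ.≤? wcount W w)) (adm ,_) proj₂) (sym (ℕₚ.+-identityʳ _))))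
    expand : ∀ W (d : Dec (Admissible W)) → ℕtoℚ (m * r) *ℚ (Q.ind d *ℚ ψ (headContent W)) ≡
             Q.∑ F (λ j → Q.∑ words (λ w → Q.ind (primitive? w) *ℚ (term (suc (toℕ j)) w W)))
    expand W (no ¬adm) = trans (trans (cong (ℕtoℚ (m * r) *ℚ_) (ℚₚ.*-zeroˡ (ψ (headContent W)))) (ℚₚ.*-zeroʳ (ℕtoℚ (m * r))))
      (sym (Q.∑-zero F (λ j → Q.∑-zero words (λ w → trans (cong (λ x → Q.ind (primitive? w) *ℚ (x *ℚ ψ (headContent W)))
        (Q.ind-no (admissible? W ×-dec (suc (toℕ j) ℕ.≤? wcount W w)) (¬adm ∘ proj₁)))
        (trans (cong (Q.ind (primitive? w) *ℚ_) (ℚₚ.*-zeroˡ (ψ (headContent W)))) (ℚₚ.*-zeroʳ (Q.ind (primitive? w))))))))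
    expand W (yes adm) = begin
      ℕtoℚ (m * r) *ℚ (1ℚ *ℚ Ψ)
        ≡⟨ cong₂ _*ℚ_ (trans (cong ℕtoℚ (marks W adm)) (trans (ℕtoℚ-∑ F _) (Q.∑-cong F (λ j → trans (ℕtoℚ-∑ words _)
             (Q.∑-cong words (λ w → trans (ℕtoℚ-* (N.ind (primitive? w)) _) (cong₂ _*ℚ_ (ℕtoℚ-ind (primitive? w)) (ℕtoℚ-ind (admissible? W ×-dec (suc (toℕ j) ℕ.≤? wcount W w)))))))))) (ℚₚ.*-identityˡ Ψ) ⟩
      Q.∑ F (λ j → Q.∑ words (λ w → Q.ind (primitive? w) *ℚ Q.ind (admissible? W ×-dec (suc (toℕ j) ℕ.≤? wcount W w)))) *ℚ Ψ
        ≡⟨ Q.∑-*ʳ F Ψ _ ⟨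
      Q.∑ F (λ j → Q.∑ words (λ w → Q.ind (primitive? w) *ℚ Q.ind (admissible? W ×-dec (suc (toℕ j) ℕ.≤? wcount W w))) *ℚ Ψ)
        ≡⟨ Q.∑-cong F (λ j → trans (sym (Q.∑-*ʳ words Ψ _)) (Q.∑-cong words (λ w → ℚₚ.*-assoc (Q.ind (primitive? w)) (Q.ind (admissible? W ×-dec (suc (toℕ j) ℕ.≤? wcount W w))) Ψ))) ⟩
      Q.∑ F (λ j → Q.∑ words (λ w → Q.ind (primitive? w) *ℚ (term (suc (toℕ j)) w W))) ∎
      where Ψ = ψ (headContent W)

-- The Möbius function

not-isEven : ∀ n → isEven (suc n) ≡ not (isEven n)
not-isEven zero = refl
not-isEven (suc zero) = refl
not-isEven (suc (suc n)) = not-isEven n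

bool-⇔ : {x y : Bool} → (x ≡ true → y ≡ true) → (y ≡ true → x ≡ true) → x ≡ y
bool-⇔ {false} {false} f g = refl
bool-⇔ {false} {true} f g = g refl
bool-⇔ {true} {y} f g = sym (f refl)

HasSquare : ℕ → Set
HasSquare n = ∃ λ k → 2 ≤ k × k * k ∣ n

if-true⁻¹ : {P : Set} (d : Dec P) {x : Bool} → (if does d then true else x) ≡ true → P ⊎ x ≡ true
if-true⁻¹ (yes p) e = inj₁ p
if-true⁻¹ (no _) e = inj₂ e

if-true : {P : Set} (d : Dec P) {x : Bool} → P ⊎ x ≡ true → (if does d then true else x) ≡ true
if-true (yes p) _ = refl
if-true (no ¬p) (inj₁ p) = ⊥-elim (¬p p)
if-true (no _) (inj₂ e) = e

squareDivisor-sound : ∀ K n → hasSquareDivisorUpTo K n ≡ true → HasSquare n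
squareDivisor-sound (suc K) n e with if-true⁻¹ (suc (suc K) * suc (suc K) ∣? n) e
... | inj₁ div = suc (suc K) , s≤s (s≤s z≤n) , div
... | inj₂ e′ = squareDivisor-sound K n e′

squareDivisor-complete : ∀ K n k → 2 ≤ k → k ≤ suc K → k * k ∣ n → hasSquareDivisorUpTo K n ≡ true
squareDivisor-complete zero n k 2≤k k≤1 div = ⊥-elim (ℕₚ.<⇒≱ 2≤k k≤1)
squareDivisor-complete (suc K) n k 2≤k k≤ div = if-true (suc (suc K) * suc (suc K) ∣? n) (go (ℕₚ.m≤n⇒m<n∨m≡n k≤))
  where
  go : _ → (suc (suc K) * suc (suc K) ∣ n) ⊎ hasSquareDivisorUpTo K n ≡ true
  go (inj₁ (s≤s k≤′)) = inj₂ (squareDivisor-complete K n k 2≤k k≤′ div)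
  go (inj₂ refl) = inj₁ div

hasSquare⇒true : ∀ n .{{_ : NonZero n}} → HasSquare n → hasSquareDivisorUpTo n n ≡ true
hasSquare⇒true n (k , 2≤k , div) = squareDivisor-complete n n k 2≤k
  (ℕₚ.m≤n⇒m≤1+n (ℕₚ.≤-trans (ℕₚ.m≤m*n k k {{ℕ.>-nonZero (ℕₚ.<-trans (s≤s z≤n) 2≤k)}}) (∣ₚ.∣⇒≤ div))) div

prime-1< : ∀ {p} → Prime p → 2 ≤ p
prime-1< pr = ℕ.nonTrivial⇒n>1 _ {{prime⇒nonTrivial pr}}

prime-coprime : ∀ {p k} → Prime p → ¬ (p ∣ k) → Coprimality.Coprime k p
prime-coprime {p} pr p∤k {i} (i∣k , i∣p) with prime⇒irreducible pr i∣p
... | inj₁ e = e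
... | inj₂ refl = ⊥-elim (p∤k i∣k)

if-suc : {P R : Set} (p? : Dec P) (r? : Dec R) (x : ℕ) →
         (if does p? ∧ does r? then suc else (λ x → x)) x ≡ N.ind (p? ×-dec r?) + x
if-suc (yes _) (yes _) x = refl
if-suc (yes _) (no _) x = refl
if-suc (no _) r? x = refl

primeDivisors-suc : ∀ k n → primeDivisorsUpTo (suc k) n ≡ N.ind (prime? (suc k) ×-dec (suc k ∣? n)) + primeDivisorsUpTo k n
primeDivisors-suc k n = if-suc (prime? (suc k)) (suc k ∣? n) (primeDivisorsUpTo k n)

module _ {p : ℕ} (pr : Prime p) where

  private instance
    p≢0 : NonZero p
    p≢0 = prime⇒nonZero pr

  hasSquare-* : ∀ d → ¬ (p ∣ d) → HasSquare (p * d) → HasSquare d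
  hasSquare-* d p∤d (k , 2≤k , div) with p ∣? k
  ... | yes p∣k = ⊥-elim (p∤d (∣ₚ.*-cancelˡ-∣ p (∣ₚ.∣-trans (∣ₚ.*-pres-∣ p∣k p∣k) div)))
  ... | no p∤k = k , 2≤k , Coprimality.coprime-divisor
    (prime-coprime pr (λ p∣kk → [ p∤k , p∤k ]′ (euclidsLemma k k pr p∣kk))) div

  -- Primes other than `p` divide `p * d` exactly when they divide `d`, and `p` itself is counted
  -- once the bound reaches it. The bound is a parameter of the induction; `primeDivisors-stable`
  -- later adjusts it.
  primeDivisors-* : ∀ K d → ¬ (p ∣ d) → primeDivisorsUpTo K (p * d) ≡ N.ind (p ℕ.≤? K) + primeDivisorsUpTo K d
  primeDivisors-* zero d p∤d = sym (trans (ℕₚ.+-identityʳ _) (N.ind-no (p ℕ.≤? 0) (λ le → ℕₚ.<⇒≱ (prime-1< pr) (ℕₚ.≤-trans le z≤n))))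
  primeDivisors-* (suc k) d p∤d = begin
    primeDivisorsUpTo (suc k) (p * d)              ≡⟨ primeDivisors-suc k (p * d) ⟩
    new (p * d) + primeDivisorsUpTo k (p * d)      ≡⟨ cong (new (p * d) +_) (primeDivisors-* k d p∤d) ⟩
    new (p * d) + (N.ind (p ℕ.≤? k) + c)           ≡⟨ ℕₚ.+-assoc (new (p * d)) _ c ⟨
    new (p * d) + N.ind (p ℕ.≤? k) + c             ≡⟨ cong (_+ c) (step (p ℕ.≟ suc k)) ⟩
    N.ind (p ℕ.≤? suc k) + new d + c               ≡⟨ ℕₚ.+-assoc (N.ind (p ℕ.≤? suc k)) (new d) c ⟩
    N.ind (p ℕ.≤? suc k) + (new d + c)             ≡⟨ cong (N.ind (p ℕ.≤? suc k) +_) (primeDivisors-suc k d) ⟨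
    N.ind (p ℕ.≤? suc k) + primeDivisorsUpTo (suc k) d ∎
    where
    open ≡-Reasoning
    c = primeDivisorsUpTo k d
    new : ℕ → ℕ
    new n = N.ind (prime? (suc k) ×-dec (suc k ∣? n))
    step : Dec (p ≡ suc k) → new (p * d) + N.ind (p ℕ.≤? k) ≡ N.ind (p ℕ.≤? suc k) + new d
    step (yes refl) = cong₂ _+_
      (trans (N.ind-yes (prime? (suc k) ×-dec (suc k ∣? (suc k * d))) (pr , ∣ₚ.m∣m*n d)) (sym (N.ind-yes (suc k ℕ.≤? suc k) ℕₚ.≤-refl)))
      (trans (N.ind-no (suc k ℕ.≤? k) ℕₚ.1+n≰n) (sym (N.ind-no (prime? (suc k) ×-dec (suc k ∣? d)) (p∤d ∘ proj₂))))
    step (no p≢) = trans (ℕₚ.+-comm (new (p * d)) _) (cong₂ _+_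
      (N.ind-⇔ (p ℕ.≤? k) (p ℕ.≤? suc k) ℕₚ.m≤n⇒m≤1+n (λ le → [ ℕ.s≤s⁻¹ , (λ e → ⊥-elim (p≢ e)) ]′ (ℕₚ.m≤n⇒m<n∨m≡n le)))
      (N.ind-⇔ (prime? (suc k) ×-dec (suc k ∣? (p * d))) (prime? (suc k) ×-dec (suc k ∣? d))
        (λ (pk , div) → pk , divides-d pk (euclidsLemma p d pk div)) (λ (pk , div) → pk , ∣ₚ.∣n⇒∣m*n p div)))
      where
      divides-d : Prime (suc k) → suc k ∣ p ⊎ suc k ∣ d → suc k ∣ d
      divides-d pk (inj₂ k∣d) = k∣d
      divides-d pk (inj₁ k∣p) with prime⇒irreducible pr k∣p
      ... | inj₁ e = ⊥-elim (ℕₚ.<-irrefl (sym e) (prime-1< pk))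
      ... | inj₂ e = ⊥-elim (p≢ (sym e))

primeDivisors-stable : ∀ t n .{{_ : NonZero n}} → primeDivisorsUpTo (t + n) n ≡ primeDivisorsUpTo n n
primeDivisors-stable zero n = refl
primeDivisors-stable (suc t) n = trans (primeDivisors-suc (t + n) n) (cong₂ _+_
  (N.ind-no (prime? (suc (t + n)) ×-dec (suc (t + n) ∣? n)) (λ (_ , div) → ℕₚ.<⇒≱ (s≤s (ℕₚ.m≤n+m n t)) (∣ₚ.∣⇒≤ div)))
  (primeDivisors-stable t n))

mobius-square : ∀ {p} d .{{_ : NonZero d}} → Prime p → p * p ∣ d → mobius d ≡ ℤ.+ 0
mobius-square {p} d pr div rewrite hasSquare⇒true d (p , prime-1< pr , div) = refl

μ : ℕ → ℚ
μ d = ℤtoℚ (mobius d)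

mobius-prime-* : ∀ {p} d .{{_ : NonZero d}} → Prime p → ¬ (p ∣ d) → μ (p * d) ≡ -ℚ μ d
mobius-prime-* {p} d pr p∤d
  rewrite bool-⇔ {hasSquareDivisorUpTo (p * d) (p * d)} {hasSquareDivisorUpTo d d}
            (λ e → hasSquare⇒true d (hasSquare-* pr d p∤d (squareDivisor-sound (p * d) (p * d) e)))
            (λ e → let (k , 2≤k , div) = squareDivisor-sound d d e in
              hasSquare⇒true (p * d) {{ℕₚ.m*n≢0 p d {{prime⇒nonZero pr}}}} (k , 2≤k , ∣ₚ.∣n⇒∣m*n p div))
        | trans (primeDivisors-* pr (p * d) d p∤d) (cong₂ _+_
            (N.ind-yes (p ℕ.≤? (p * d)) (ℕₚ.m≤m*n p d))
            (trans (cong (λ K → primeDivisorsUpTo K d) (sym (ℕₚ.m∸n+n≡m (ℕₚ.m≤n*m d p {{prime⇒nonZero pr}}))))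
                   (primeDivisors-stable (p * d ∸ d) d)))
        | not-isEven (primeDivisorsUpTo d d)
  with hasSquareDivisorUpTo d d | isEven (primeDivisorsUpTo d d)
... | true | _ = refl
... | false | true = refl
... | false | false = refl

prime-divisor : ∀ e → 2 ≤ e → ∃ λ p → Prime p × p ∣ e
prime-divisor e 2≤e = go (factorise e {{ℕ.>-nonZero (ℕₚ.<-trans (s≤s z≤n) 2≤e)}})
  where
  go : PrimeFactorisation e → ∃ λ p → Prime p × p ∣ e
  go record { factors = [] ; isFactorisation = refl } = ⊥-elim (ℕₚ.<-irrefl refl 2≤e)
  go record { factors = p ∷ ps ; isFactorisation = eq ; factorsPrime = pp Allₚ.∷ _ } =
    p , pp , subst (p ∣_) (sym eq) (∣ₚ.m∣m*n _)

ind-split : {P R : Set} (p? : Dec P) (r? : Dec R) → Q.ind p? ≡ Q.ind (p? ×-dec ¬? r?) +ℚ Q.ind (p? ×-dec r?)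
ind-split (yes _) (yes _) = refl
ind-split (yes _) (no _) = refl
ind-split (no _) r? = refl

-- Fix a prime `p` dividing `e`. Divisors divisible by `p²` contribute nothing, and multiplication
-- by `p` pairs the divisors not divisible by `p` with the remaining ones, with opposite signs. The
-- range may exceed `e`, so that the single range `m` serves the exponents of all words.
mobius-sum : ∀ e n → 1 ≤ e → e ≤ n →
  Q.∑ (allFin n) (λ j → Q.ind (suc (toℕ j) ∣? e) *ℚ μ (suc (toℕ j))) ≡ Q.ind (e ℕ.≟ 1)
mobius-sum e zero 1≤e e≤n = ⊥-elim (ℕₚ.<⇒≱ 1≤e e≤n)
mobius-sum e (suc n) 1≤e e≤n with e ℕ.≟ 1
... | yes refl = Q.Enumeration.∑-unique (Q.finEnum (suc n)) (λ j → suc (toℕ j) ∣? 1) (λ j → μ (suc (toℕ j))) zero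
        (∣ₚ.1∣ 1) (λ j div → Finₚ.toℕ-injective (ℕₚ.suc-injective (∣ₚ.∣1⇒≡1 div)))
... | no e≢1 = begin
  Q.∑ F (λ j → Q.ind (D? j) *ℚ μ̂ j)
    ≡⟨ Q.∑-cong F (λ j → trans (cong (_*ℚ μ̂ j) (ind-split (D? j) (p ∣? suc (toℕ j)))) (ℚₚ.*-distribʳ-+ (μ̂ j) (Q.ind (A? j)) (Q.ind (D? j ×-dec (p ∣? suc (toℕ j)))))) ⟩
  Q.∑ F (λ j → Q.ind (A? j) *ℚ μ̂ j +ℚ Q.ind (D? j ×-dec (p ∣? suc (toℕ j))) *ℚ μ̂ j)
    ≡⟨ Q.∑-+ F (λ j → Q.ind (A? j) *ℚ μ̂ j) (λ j → Q.ind (D? j ×-dec (p ∣? suc (toℕ j))) *ℚ μ̂ j) ⟩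
  Q.∑ F (λ j → Q.ind (A? j) *ℚ μ̂ j) +ℚ Q.∑ F (λ j → Q.ind (D? j ×-dec (p ∣? suc (toℕ j))) *ℚ μ̂ j)
    ≡⟨ cong (Q.∑ F (λ j → Q.ind (A? j) *ℚ μ̂ j) +ℚ_) (trans (Q.∑-cong F drop-squares) pairing) ⟩
  Q.∑ F (λ j → Q.ind (A? j) *ℚ μ̂ j) +ℚ Q.∑ F (λ j → Q.ind (A? j) *ℚ -ℚ μ̂ j)
    ≡⟨ Q.∑-+ F (λ j → Q.ind (A? j) *ℚ μ̂ j) (λ j → Q.ind (A? j) *ℚ -ℚ μ̂ j) ⟨
  Q.∑ F (λ j → Q.ind (A? j) *ℚ μ̂ j +ℚ Q.ind (A? j) *ℚ -ℚ μ̂ j)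
    ≡⟨ Q.∑-zero F (λ j → trans (sym (ℚₚ.*-distribˡ-+ (Q.ind (A? j)) (μ̂ j) (-ℚ μ̂ j))) (trans (cong (Q.ind (A? j) *ℚ_) (ℚₚ.+-inverseʳ (μ̂ j))) (ℚₚ.*-zeroʳ (Q.ind (A? j))))) ⟩
  0ℚ ∎
  where
  open ≡-Reasoning
  F = allFin (suc n)
  μ̂ : Fin (suc n) → ℚ
  μ̂ j = μ (suc (toℕ j))
  pd = prime-divisor e (ℕₚ.≤∧≢⇒< 1≤e (e≢1 ∘ sym))
  p = proj₁ pd
  pr : Prime p
  pr = proj₁ (proj₂ pd)
  p∣e = proj₂ (proj₂ pd)
  instance
    p≢0 : NonZero p
    p≢0 = prime⇒nonZero pr
    e≢0 : NonZero e
    e≢0 = ℕ.>-nonZero 1≤e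
  D? : (j : Fin (suc n)) → Dec (suc (toℕ j) ∣ e)
  D? j = suc (toℕ j) ∣? e
  A? : (j : Fin (suc n)) → Dec (suc (toℕ j) ∣ e × ¬ (p ∣ suc (toℕ j)))
  A? j = D? j ×-dec ¬? (p ∣? suc (toℕ j))
  B? : (j : Fin (suc n)) → Dec ((suc (toℕ j) ∣ e × p ∣ suc (toℕ j)) × ¬ (p * p ∣ suc (toℕ j)))
  B? j = (D? j ×-dec (p ∣? suc (toℕ j))) ×-dec ¬? (p * p ∣? suc (toℕ j))
  drop-squares : ∀ j → Q.ind (D? j ×-dec (p ∣? suc (toℕ j))) *ℚ μ̂ j ≡ Q.ind (B? j) *ℚ μ̂ j
  drop-squares j with p * p ∣? suc (toℕ j)
  ... | no ¬sq = cong (_*ℚ μ̂ j) (Q.ind-⇔ (D? j ×-dec (p ∣? suc (toℕ j))) ((D? j ×-dec (p ∣? suc (toℕ j))) ×-dec yes ¬sq) (_, ¬sq) proj₁)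
  ... | yes sq rewrite mobius-square {p} (suc (toℕ j)) pr sq = trans (ℚₚ.*-zeroʳ (Q.ind (D? j ×-dec (p ∣? suc (toℕ j))))) (sym (ℚₚ.*-zeroʳ (Q.ind ((D? j ×-dec (p ∣? suc (toℕ j))) ×-dec no (λ ¬sq → ¬sq sq)))))
  Times : Fin (suc n) → Fin (suc n) → Set
  Times j j′ = suc (toℕ j) ≡ p * suc (toℕ j′)
  pairing : Q.∑ F (λ j → Q.ind (B? j) *ℚ μ̂ j) ≡ Q.∑ F (λ j → Q.ind (A? j) *ℚ -ℚ μ̂ j)
  pairing = Q.∑-bijection (Q.finEnum (suc n)) (Q.finEnum (suc n)) B? A? (λ j j′ → suc (toℕ j) ℕ.≟ p * suc (toℕ j′))
    μ̂ (λ j → -ℚ μ̂ j) to from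
    (λ j j₁ j₂ _ _ x₁ x₂ → Finₚ.toℕ-injective (ℕₚ.suc-injective (ℕₚ.*-cancelˡ-≡ _ _ p (trans (sym x₁) x₂))))
    (λ j₁ j₂ j _ _ x₁ x₂ → Finₚ.toℕ-injective (ℕₚ.suc-injective (trans x₁ (sym x₂))))
    (λ j j′ _ (_ , p∤) x → trans (cong μ x) (mobius-prime-* (suc (toℕ j′)) pr p∤))
    where
    to : ∀ j → _ → ∃ λ j′ → (suc (toℕ j′) ∣ e × ¬ (p ∣ suc (toℕ j′))) × Times j j′
    to j ((d∣e , divides zero ()) , ¬sq)
    to j ((d∣e , divides (suc t) eq) , ¬sq) = j′ , (subst (_∣ e) (cong suc (sym toℕ-j′)) (∣ₚ.∣-trans t∣d d∣e) ,
         (λ p∣t → ¬sq (subst (p * p ∣_) (sym eq) (∣ₚ.*-monoˡ-∣ p (subst (λ x → p ∣ suc x) toℕ-j′ p∣t))))) ,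
         trans eq (trans (ℕₚ.*-comm (suc t) p) (cong (λ x → p * suc x) (sym toℕ-j′)))
      where
      t∣d : suc t ∣ suc (toℕ j)
      t∣d = divides p (trans eq (ℕₚ.*-comm (suc t) p))
      t< : t < suc n
      t< = ℕₚ.<-≤-trans (∣ₚ.∣⇒≤ t∣d) (Finₚ.toℕ<n j)
      j′ = Fin.fromℕ< t<
      toℕ-j′ : toℕ j′ ≡ t
      toℕ-j′ = Finₚ.toℕ-fromℕ< t<
    from : ∀ j′ → (suc (toℕ j′) ∣ e × ¬ (p ∣ suc (toℕ j′))) →
           ∃ λ j → ((suc (toℕ j) ∣ e × p ∣ suc (toℕ j)) × ¬ (p * p ∣ suc (toℕ j))) × Times j j′
    from j′ (d∣e , p∤d) = j , ((subst (_∣ e) (sym x) pd∣e , subst (p ∣_) (sym x) (∣ₚ.m∣m*n d)) ,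
                               (λ sq → p∤d (∣ₚ.*-cancelˡ-∣ p (subst (p * p ∣_) x sq)))) , x
      where
      d = suc (toℕ j′)
      coprime-lcm : d ∣ e → p * d ∣ e
      coprime-lcm (divides t eq) with euclidsLemma t d pr (subst (p ∣_) eq p∣e)
      ... | inj₁ p∣t = subst (p * d ∣_) (sym eq) (∣ₚ.*-monoˡ-∣ d p∣t)
      ... | inj₂ p∣d = ⊥-elim (p∤d p∣d)
      pd∣e : p * d ∣ e
      pd∣e = coprime-lcm d∣e
      j< : ℕ.pred (p * d) < suc n
      j< = ℕₚ.<-≤-trans (ℕₚ.≤-reflexive (ℕₚ.suc-pred (p * d) {{ℕₚ.m*n≢0 p d}})) (ℕₚ.≤-trans (∣ₚ.∣⇒≤ pd∣e) e≤n)
      j = Fin.fromℕ< j<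
      x : Times j j′
      x = trans (cong suc (Finₚ.toℕ-fromℕ< j<)) (ℕₚ.suc-pred (p * d) {{ℕₚ.m*n≢0 p d}})

-- Periods of words and the passage from primitive words to all words

∑-allFin-+ : ∀ a b (h : ℕ → ℕ) →
  N.∑ (allFin (a + b)) (h ∘ toℕ) ≡ N.∑ (allFin a) (h ∘ toℕ) + N.∑ (allFin b) (λ t → h (a + toℕ t))
∑-allFin-+ zero b h = refl
∑-allFin-+ (suc a) b h = begin
  N.∑ (allFin (suc (a + b))) (h ∘ toℕ)
    ≡⟨ N.∑-allFin-suc (a + b) (h ∘ toℕ) ⟩
  h 0 + N.∑ (allFin (a + b)) (h ∘ suc ∘ toℕ)
    ≡⟨ cong (h 0 +_) (∑-allFin-+ a b (h ∘ suc)) ⟩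
  h 0 + (N.∑ (allFin a) (h ∘ suc ∘ toℕ) + rest)
    ≡⟨ ℕₚ.+-assoc (h 0) _ rest ⟨
  h 0 + N.∑ (allFin a) (h ∘ suc ∘ toℕ) + rest
    ≡⟨ cong (_+ rest) (N.∑-allFin-suc a (h ∘ toℕ)) ⟨
  N.∑ (allFin (suc a)) (h ∘ toℕ) + rest ∎
  where
  open ≡-Reasoning
  rest = N.∑ (allFin b) (λ t → h (suc a + toℕ t))

∑-periodic : ∀ d s .{{_ : NonZero s}} (h : ℕ → ℕ) →
  N.∑ (allFin (d * s)) (λ t → h (toℕ t % s)) ≡ d * N.∑ (allFin s) (h ∘ toℕ)
∑-periodic zero s h = refl
∑-periodic (suc d) s h = trans (∑-allFin-+ s (d * s) (λ t → h (t % s))) (cong₂ _+_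
  (N.∑-cong (allFin s) (λ t → cong h (DM.m<n⇒m%n≡m (Finₚ.toℕ<n t))))
  (trans (N.∑-cong (allFin (d * s)) (λ t → cong h (trans (cong (_% s) (ℕₚ.+-comm s (toℕ t))) (DM.[m+n]%n≡m%n (toℕ t) s))))
         (∑-periodic d s h)))

module PrimitiveWords (q m₀ : ℕ) where

  open Recurrence q m₀ public

  rotⁿ-* : ∀ {w} s → rotⁿ s w ≡ w → ∀ k → rotⁿ (k * s) w ≡ w
  rotⁿ-* s per zero = refl
  rotⁿ-* {w} s per (suc k) = trans (iterate-+ rot s (k * s) w) (trans (cong (rotⁿ s) (rotⁿ-* s per k)) per)

  rotⁿ-% : ∀ {w} s .{{_ : NonZero s}} → rotⁿ s w ≡ w → ∀ t → rotⁿ (t % s) w ≡ rotⁿ t w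
  rotⁿ-% {w} s per t = trans (cong (rotⁿ (t % s)) (sym (rotⁿ-* s per (t / s))))
    (trans (sym (iterate-+ rot (t % s) (t / s * s) w)) (cong (λ k → rotⁿ k w) (sym (DM.m≡m%n+[m/n]*n t s))))

  module _ (w : Word) where

    LeastPeriod : ℕ → Set
    LeastPeriod p = 0 < p × rotⁿ p w ≡ w × (∀ t → 0 < t → t < p → rotⁿ t w ≢ w)

    search : ∀ k → (∃ λ p → p ≤ k × LeastPeriod p) ⊎ (∀ t → 0 < t → t ≤ k → rotⁿ t w ≢ w)
    search zero = inj₂ (λ { (suc t) _ () })
    search (suc k) with search k
    ... | inj₁ (p , p≤k , least) = inj₁ (p , ℕₚ.m≤n⇒m≤1+n p≤k , least)
    ... | inj₂ none with rotⁿ (suc k) w ≟ʷ w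
    ... | yes per = inj₁ (suc k , ℕₚ.≤-refl , s≤s z≤n , per , λ t 0<t t<k → none t 0<t (ℕ.s≤s⁻¹ t<k))
    ... | no ¬per = inj₂ λ t 0<t t≤ → [ (λ t<k → none t 0<t (ℕ.s≤s⁻¹ t<k)) , (λ { refl → ¬per }) ]′ (ℕₚ.m≤n⇒m<n∨m≡n t≤)

    leastPeriod : ∃ LeastPeriod
    leastPeriod with search m
    ... | inj₁ (p , _ , least) = p , least
    ... | inj₂ none = ⊥-elim (none m (s≤s z≤n) ℕₚ.≤-refl (rotⁿ-m w))

    p : ℕ
    p = proj₁ leastPeriod

    instance
      p≢0 : NonZero p
      p≢0 = ℕ.>-nonZero (proj₁ (proj₂ leastPeriod))

    period : rotⁿ p w ≡ w
    period = proj₁ (proj₂ (proj₂ leastPeriod))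

    minimality : ∀ t → 0 < t → t < p → rotⁿ t w ≢ w
    minimality = proj₂ (proj₂ (proj₂ leastPeriod))

    period⇒∣ : ∀ s → rotⁿ s w ≡ w → p ∣ s
    period⇒∣ s per = ∣ₚ.m%n≡0⇒n∣m s p (zero-rem (s % p) refl)
      where
      zero-rem : ∀ x → s % p ≡ x → s % p ≡ 0
      zero-rem zero e = e
      zero-rem (suc x) e = ⊥-elim (minimality (s % p) (subst (0 <_) (sym e) (s≤s z≤n)) (DM.m%n<n s p) (trans (rotⁿ-% p period s) per))

    ∣⇒period : ∀ s → p ∣ s → rotⁿ s w ≡ w
    ∣⇒period s (divides k refl) = rotⁿ-* p period k

    -- The exponent of `w`: the word is the `e`-th power of its initial segment of length `p`.
    e : ℕ
    e = ∣ₚ.quotient (period⇒∣ m (rotⁿ-m w))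

    m≡e*p : m ≡ e * p
    m≡e*p = ∣ₚ._∣_.equality (period⇒∣ m (rotⁿ-m w))

    e≥1 : 1 ≤ e
    e≥1 = ℕₚ.n≢0⇒n>0 (λ e≡0 → ℕₚ.1+n≢0 (trans m≡e*p (cong (_* p) e≡0)))

    periodic⇒∣e : ∀ d s → m ≡ s * d → rotⁿ s w ≡ w → d ∣ e
    periodic⇒∣e d s eq per with period⇒∣ s per
    ... | divides t refl = divides t (ℕₚ.*-cancelʳ-≡ e (t * d) p (trans (sym m≡e*p)
      (trans eq (trans (ℕₚ.*-assoc t p d) (trans (cong (t *_) (ℕₚ.*-comm p d)) (sym (ℕₚ.*-assoc t d p)))))))

    ∣e⇒periodic : ∀ d s .{{_ : NonZero d}} → m ≡ s * d → d ∣ e → rotⁿ s w ≡ w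
    ∣e⇒periodic d s eq (divides t e≡) = ∣⇒period s (divides t (ℕₚ.*-cancelʳ-≡ s (t * p) d (trans (sym eq)
      (trans m≡e*p (trans (cong (_* p) e≡) (trans (ℕₚ.*-assoc t d p) (trans (cong (t *_) (ℕₚ.*-comm d p)) (sym (ℕₚ.*-assoc t p d)))))))))

    primitive⇒e≡1 : Primitive w → e ≡ 1
    primitive⇒e≡1 prim with ℕₚ.m≤n⇒m<n∨m≡n (∣ₚ.∣⇒≤ (period⇒∣ m (rotⁿ-m w)))
    ... | inj₁ p<m = ⊥-elim (prim (Fin.fromℕ< p<m) (subst (0 <_) (sym (Finₚ.toℕ-fromℕ< p<m)) (proj₁ (proj₂ leastPeriod)))
                       (trans (cong (λ k → rotⁿ k w) (Finₚ.toℕ-fromℕ< p<m)) period))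
    ... | inj₂ p≡m = ℕₚ.*-cancelʳ-≡ e 1 p (trans (sym m≡e*p) (trans (sym p≡m) (sym (ℕₚ.*-identityˡ p))))

    e≡1⇒primitive : e ≡ 1 → Primitive w
    e≡1⇒primitive e≡1 d 0<d = minimality (toℕ d) 0<d (subst (toℕ d <_) (trans m≡e*p (trans (cong (_* p) e≡1) (ℕₚ.*-identityˡ p))) (Finₚ.toℕ<n d))

    -- A word is fixed by rotation through `m / d` exactly when `d` divides its exponent; so the sum
    -- of `μ` runs over the divisors of the exponent and detects exponent one.
    primitive-mobius : Q.ind (primitive? w) ≡
      Q.∑ (allFin m) (λ i → Q.ind ((suc (toℕ i) ∣? m) ×-dec (rotⁿ (m / suc (toℕ i)) w ≟ʷ w)) *ℚ μ (suc (toℕ i)))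
    primitive-mobius = trans (Q.ind-⇔ (primitive? w) (e ℕ.≟ 1) primitive⇒e≡1 e≡1⇒primitive)
      (trans (sym (mobius-sum e m e≥1 (ℕₚ.≤-trans (ℕₚ.m≤m*n e p) (ℕₚ.≤-reflexive (sym m≡e*p)))))
      (Q.∑-cong (allFin m) (λ i → cong (_*ℚ μ (suc (toℕ i)))
        (Q.ind-⇔ (suc (toℕ i) ∣? e) ((suc (toℕ i) ∣? m) ×-dec (rotⁿ (m / suc (toℕ i)) w ≟ʷ w))
          (λ d∣e → let d∣m = ∣ₚ.∣-trans d∣e (divides p (trans m≡e*p (ℕₚ.*-comm e p))) in
            d∣m , ∣e⇒periodic (suc (toℕ i)) (m / suc (toℕ i)) (sym (DM.m/n*n≡m d∣m)) d∣e)
          (λ (d∣m , per) → periodic⇒∣e (suc (toℕ i)) (m / suc (toℕ i)) (sym (DM.m/n*n≡m d∣m)) per)))))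

  module _ (s d : ℕ) .{{_ : NonZero s}} (m≡ : m ≡ d * s) where

    Unrolls : Word → Vec (Fin q) s → Set
    Unrolls w u = ∀ (i : Fin m) → lookup w i ≡ lookup u (toℕ i mod s)

    unrolls-get : ∀ w u → Unrolls w u → ∀ i → get w i ≡ lookup u (i mod s)
    unrolls-get w u x i = trans (x (i mod m)) (cong (lookup u) (Finₚ.toℕ-injective (trans (Finₚ.toℕ-fromℕ< _)
      (trans (cong (_% s) (Finₚ.toℕ-fromℕ< _)) (trans (DM.m∣n⇒o%n%m≡o%m s m i (divides d m≡)) (sym (Finₚ.toℕ-fromℕ< _)))))))

    unrolls-content : ∀ w u → Unrolls w u → wordContent w ≡ d ⋆ content (lookup u)
    unrolls-content w u x = vec-ext (λ a → begin
      lookup (wordContent w) a                                 ≡⟨ Vecₚ.lookup∘tabulate _ a ⟩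
      N.∑ (allFin m) (λ t → N.ind (get w (toℕ t) ≟ᶠ a))        ≡⟨ N.∑-cong (allFin m) (λ t → cong (λ y → N.ind (y ≟ᶠ a)) (trans (unrolls-get w u x (toℕ t)) (cong (lookup u) (mod-mod (toℕ t))))) ⟩
      N.∑ (allFin m) (λ t → h a (toℕ t % s))                   ≡⟨ cong (λ k → N.∑ (allFin k) (λ t → h a (toℕ t % s))) m≡ ⟩
      N.∑ (allFin (d * s)) (λ t → h a (toℕ t % s))             ≡⟨ ∑-periodic d s (h a) ⟩
      d * N.∑ (allFin s) (h a ∘ toℕ)                           ≡⟨ cong (d *_) (N.∑-cong (allFin s) (λ t → cong (λ y → N.ind (lookup u y ≟ᶠ a)) (toℕ-mod t))) ⟩
      d * count (λ t → lookup u t ≟ᶠ a)                        ≡⟨ cong (d *_) (Vecₚ.lookup∘tabulate _ a) ⟨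
      d * lookup (content (lookup u)) a                        ≡⟨ Vecₚ.lookup-map a (d *_) (content (lookup u)) ⟨
      lookup (d ⋆ content (lookup u)) a                        ∎)
      where
      open ≡-Reasoning
      h : Fin q → ℕ → ℕ
      h a t = N.ind (lookup u (t mod s) ≟ᶠ a)
      mod-mod : ∀ t → t mod s ≡ (t % s) mod s
      mod-mod t = Finₚ.toℕ-injective (trans (Finₚ.toℕ-fromℕ< _) (trans (sym (DM.m%n%n≡m%n t s)) (sym (Finₚ.toℕ-fromℕ< _))))
      toℕ-mod : ∀ (t : Fin s) → toℕ t mod s ≡ t
      toℕ-mod t = Finₚ.toℕ-injective (trans (Finₚ.toℕ-fromℕ< _) (DM.m<n⇒m%n≡m (Finₚ.toℕ<n t)))

    -- The words fixed by rotation through `s` are the `d`-th powers of arbitrary words of length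
    -- `s`. The periodicity condition disappears, and the content is multiplied by `d`.
    periodic-sum : (φ : Vec ℕ q → ℚ) →
      Q.∑ words (λ w → Q.ind (rotⁿ s w ≟ʷ w) *ℚ φ (wordContent w)) ≡
      Q.∑ (vecsOver (allFin q) s) (λ u → φ (d ⋆ content (lookup u)))
    periodic-sum φ = trans
      (Q.∑-bijection (Q.vecEnum (Q.finEnum q) m) (Q.vecEnum (Q.finEnum q) s) {Q = λ _ → ⊤}
        (λ w → rotⁿ s w ≟ʷ w) (λ _ → yes tt) (λ w u → Finₚ.all? (λ i → lookup w i ≟ᶠ lookup u (toℕ i mod s)))
        (λ w → φ (wordContent w)) (λ u → φ (d ⋆ content (lookup u)))
        to (λ u _ → from u)
        (λ w u u′ _ _ x x′ → vec-ext (λ i → trans (sym (recover w u x i)) (recover w u′ x′ i)))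
        (λ w w′ u _ _ x x′ → vec-ext (λ i → trans (x i) (sym (x′ i))))
        (λ w u _ _ x → cong φ (unrolls-content w u x)))
      (Q.∑-cong (vecsOver (allFin q) s) (λ u → ℚₚ.*-identityˡ _))
      where
      recover : ∀ w u → Unrolls w u → ∀ i → get w (toℕ i) ≡ lookup u i
      recover w u x i = trans (unrolls-get w u x (toℕ i)) (cong (lookup u) (Finₚ.toℕ-injective
        (trans (Finₚ.toℕ-fromℕ< _) (DM.m<n⇒m%n≡m (Finₚ.toℕ<n i)))))
      to : ∀ w → rotⁿ s w ≡ w → ∃ λ u → ⊤ × Unrolls w u
      to w per = u , tt , unrolls
        where
        u = Vec.tabulate (λ (i : Fin s) → get w (toℕ i))
        unrolls : Unrolls w u
        unrolls i = begin
          lookup w i                         ≡⟨ get-toℕ w i ⟨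
          get w (toℕ i)                      ≡⟨ cong (get w) (ℕₚ.+-identityʳ (toℕ i)) ⟨
          get w (toℕ i + 0)                  ≡⟨ get-rotⁿ (toℕ i) w 0 ⟨
          get (rotⁿ (toℕ i) w) 0             ≡⟨ cong (λ v → get v 0) (rotⁿ-% s per (toℕ i)) ⟨
          get (rotⁿ (toℕ i % s) w) 0         ≡⟨ get-rotⁿ (toℕ i % s) w 0 ⟩
          get w (toℕ i % s + 0)              ≡⟨ cong (get w) (trans (ℕₚ.+-identityʳ (toℕ i % s)) (sym (Finₚ.toℕ-fromℕ< (DM.m%n<n (toℕ i) s)))) ⟩
          get w (toℕ (toℕ i mod s))          ≡⟨ Vecₚ.lookup∘tabulate (λ (i : Fin s) → get w (toℕ i)) (toℕ i mod s) ⟨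
          lookup u (toℕ i mod s)             ∎
          where open ≡-Reasoning
      from : ∀ u → ∃ λ w → rotⁿ s w ≡ w × Unrolls w u
      from u = w , word-ext (λ i _ → trans (get-rotⁿ s w i) (trans (unrolls-get w u unrolls (s + i))
          (trans (cong (lookup u) (Finₚ.toℕ-injective (trans (Finₚ.toℕ-fromℕ< _) (trans (cong (_% s) (ℕₚ.+-comm s i))
             (trans (DM.[m+n]%n≡m%n i s) (sym (Finₚ.toℕ-fromℕ< _))))))) (sym (unrolls-get w u unrolls i))))) , unrolls
        where
        w = Vec.tabulate (λ (i : Fin m) → lookup u (toℕ i mod s))
        unrolls : Unrolls w u
        unrolls = Vecₚ.lookup∘tabulate (λ (i : Fin m) → lookup u (toℕ i mod s))

  primitive-sum : (φ : Vec ℕ q → ℚ) → Q.∑ words (λ w → Q.ind (primitive? w) *ℚ φ (wordContent w)) ≡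
    Q.∑ (allFin m) (λ i → Q.ind (suc (toℕ i) ∣? m) *ℚ (μ (suc (toℕ i)) *ℚ
      Q.∑ (vecsOver (allFin q) (m / suc (toℕ i))) (λ u → φ (suc (toℕ i) ⋆ content (lookup u)))))
  primitive-sum φ = begin
    Q.∑ words (λ w → Q.ind (primitive? w) *ℚ Φ w)
      ≡⟨ Q.∑-cong words (λ w → trans (cong (_*ℚ Φ w) (primitive-mobius w)) (sym (Q.∑-*ʳ F (Φ w) (λ i → Q.ind (c? i w) *ℚ μ̂ i)))) ⟩
    Q.∑ words (λ w → Q.∑ F (λ i → Q.ind (c? i w) *ℚ μ̂ i *ℚ Φ w))
      ≡⟨ Q.∑-swap words F (λ w i → Q.ind (c? i w) *ℚ μ̂ i *ℚ Φ w) ⟩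
    Q.∑ F (λ i → Q.∑ words (λ w → Q.ind (c? i w) *ℚ μ̂ i *ℚ Φ w))
      ≡⟨ Q.∑-cong F (λ i → trans (Q.∑-cong words (rearrange i)) (trans (Q.∑-*ˡ words (Q.ind (suc (toℕ i) ∣? m)) _)
           (Q.ind-cong (suc (toℕ i) ∣? m) (λ d∣m → trans (Q.∑-*ˡ words (μ̂ i) _) (cong (μ̂ i *ℚ_)
             (periodic-sum (m / suc (toℕ i)) (suc (toℕ i)) {{ℕ.>-nonZero (DM.m≥n⇒m/n>0 (∣ₚ.∣⇒≤ d∣m))}} (sym (trans (ℕₚ.*-comm (suc (toℕ i)) _) (DM.m/n*n≡m d∣m))) φ)))))) ⟩
    Q.∑ F (λ i → Q.ind (suc (toℕ i) ∣? m) *ℚ (μ̂ i *ℚ Q.∑ (vecsOver (allFin q) (m / suc (toℕ i))) (λ u → φ (suc (toℕ i) ⋆ content (lookup u))))) ∎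
    where
    open ≡-Reasoning
    F = allFin m
    Φ : Word → ℚ
    Φ w = φ (wordContent w)
    μ̂ : Fin m → ℚ
    μ̂ i = μ (suc (toℕ i))
    c? : ∀ i w → Dec (suc (toℕ i) ∣ m × rotⁿ (m / suc (toℕ i)) w ≡ w)
    c? i w = (suc (toℕ i) ∣? m) ×-dec (rotⁿ (m / suc (toℕ i)) w ≟ʷ w)
    rearrange : ∀ i w → Q.ind (c? i w) *ℚ μ̂ i *ℚ Φ w ≡ Q.ind (suc (toℕ i) ∣? m) *ℚ (μ̂ i *ℚ (Q.ind (rotⁿ (m / suc (toℕ i)) w ≟ʷ w) *ℚ Φ w))
    rearrange i w = trans (cong (λ x → x *ℚ μ̂ i *ℚ Φ w) (Q.ind-× (suc (toℕ i) ∣? m) (rotⁿ (m / suc (toℕ i)) w ≟ʷ w)))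
      (solve 4 (λ a b c f → a :* b :* c :* f := a :* (c :* (b :* f))) refl (Q.ind (suc (toℕ i) ∣? m)) (Q.ind (rotⁿ (m / suc (toℕ i)) w ≟ʷ w)) (μ̂ i) (Φ w))

-- Finite sums of rationals and formal power series

Σ-cong : ∀ n {f g : ℕ → ℚ} → (∀ i → i ≤ n → f i ≡ g i) → Σℚ≤ n f ≡ Σℚ≤ n g
Σ-cong zero e = e 0 z≤n
Σ-cong (suc n) e = cong₂ _+ℚ_ (Σ-cong n (λ i le → e i (ℕₚ.m≤n⇒m≤1+n le))) (e (suc n) ℕₚ.≤-refl)

Σ-zero : ∀ n {f : ℕ → ℚ} → (∀ i → i ≤ n → f i ≡ 0ℚ) → Σℚ≤ n f ≡ 0ℚ
Σ-zero zero e = e 0 z≤n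
Σ-zero (suc n) e = trans (cong₂ _+ℚ_ (Σ-zero n (λ i le → e i (ℕₚ.m≤n⇒m≤1+n le))) (e (suc n) ℕₚ.≤-refl)) (ℚₚ.+-identityʳ 0ℚ)

Σ-+ : ∀ n (f g : ℕ → ℚ) → Σℚ≤ n (λ i → f i +ℚ g i) ≡ Σℚ≤ n f +ℚ Σℚ≤ n g
Σ-+ zero f g = refl
Σ-+ (suc n) f g = trans (cong (_+ℚ (f (suc n) +ℚ g (suc n))) (Σ-+ n f g))
  (solve 4 (λ a b c d → (a :+ b) :+ (c :+ d) := (a :+ c) :+ (b :+ d)) refl (Σℚ≤ n f) (Σℚ≤ n g) (f (suc n)) (g (suc n)))

Σ-*ˡ : ∀ n c (f : ℕ → ℚ) → Σℚ≤ n (λ i → c *ℚ f i) ≡ c *ℚ Σℚ≤ n f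
Σ-*ˡ zero c f = refl
Σ-*ˡ (suc n) c f = trans (cong (_+ℚ c *ℚ f (suc n)) (Σ-*ˡ n c f)) (sym (ℚₚ.*-distribˡ-+ c (Σℚ≤ n f) (f (suc n))))

Σ-front : ∀ n (f : ℕ → ℚ) → Σℚ≤ (suc n) f ≡ f 0 +ℚ Σℚ≤ n (f ∘ suc)
Σ-front zero f = refl
Σ-front (suc n) f = trans (cong (_+ℚ f (suc (suc n))) (Σ-front n f)) (ℚₚ.+-assoc (f 0) (Σℚ≤ n (f ∘ suc)) (f (suc (suc n))))

Σ-swap : ∀ n k (F : ℕ → ℕ → ℚ) → Σℚ≤ n (λ i → Σℚ≤ k (F i)) ≡ Σℚ≤ k (λ j → Σℚ≤ n (λ i → F i j))
Σ-swap zero k F = refl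
Σ-swap (suc n) k F = trans (cong (_+ℚ Σℚ≤ k (F (suc n))) (Σ-swap n k F)) (sym (Σ-+ k (λ j → Σℚ≤ n (λ i → F i j)) (F (suc n))))

Σ-extend : ∀ n t (f : ℕ → ℚ) → (∀ i → n < i → f i ≡ 0ℚ) → Σℚ≤ (t + n) f ≡ Σℚ≤ n f
Σ-extend n zero f e = refl
Σ-extend n (suc t) f e = trans (cong₂ _+ℚ_ (Σ-extend n t f e) (e (suc (t + n)) (s≤s (ℕₚ.m≤n+m n t)))) (ℚₚ.+-identityʳ (Σℚ≤ n f))

-- Both sides run over the pairs with `i + j ≤ n`.
Σ-triangle : ∀ n (F : ℕ → ℕ → ℚ) →
  Σℚ≤ n (λ i → Σℚ≤ (n ∸ i) (F i)) ≡ Σℚ≤ n (λ j → Σℚ≤ (n ∸ j) (λ i → F i j))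
Σ-triangle zero F = refl
Σ-triangle (suc n) F = begin
  Σℚ≤ (suc n) (λ i → Σℚ≤ (suc n ∸ i) (F i))
    ≡⟨ Σ-front n (λ i → Σℚ≤ (suc n ∸ i) (F i)) ⟩
  Σℚ≤ (suc n) (F 0) +ℚ Σℚ≤ n (λ i → Σℚ≤ (n ∸ i) (F (suc i)))
    ≡⟨ cong (Σℚ≤ (suc n) (F 0) +ℚ_) (Σ-triangle n (F ∘ suc)) ⟩
  Σℚ≤ n (F 0) +ℚ F 0 (suc n) +ℚ rest
    ≡⟨ solve 3 (λ a b c → a :+ b :+ c := a :+ c :+ b) refl (Σℚ≤ n (F 0)) (F 0 (suc n)) rest ⟩
  Σℚ≤ n (F 0) +ℚ rest +ℚ F 0 (suc n)
    ≡⟨ cong₂ _+ℚ_ (trans (sym (Σ-+ n (F 0) _)) (Σ-cong n column)) (cong (λ k → Σℚ≤ k (λ i → F i (suc n))) (sym (ℕₚ.n∸n≡0 n))) ⟩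
  Σℚ≤ (suc n) (λ j → Σℚ≤ (suc n ∸ j) (λ i → F i j)) ∎
  where
  open ≡-Reasoning
  rest = Σℚ≤ n (λ j → Σℚ≤ (n ∸ j) (λ i → F (suc i) j))
  column : ∀ j → j ≤ n → F 0 j +ℚ Σℚ≤ (n ∸ j) (λ i → F (suc i) j) ≡ Σℚ≤ (suc n ∸ j) (λ i → F i j)
  column j j≤n = trans (sym (Σ-front (n ∸ j) (λ i → F i j))) (cong (λ k → Σℚ≤ k (λ i → F i j)) (sym (ℕₚ.+-∸-assoc 1 j≤n)))

·q-cong : ∀ {f f′ g g′ : QSeries} → (∀ i → f i ≡ f′ i) → (∀ i → g i ≡ g′ i) → ∀ n → (f ·q g) n ≡ (f′ ·q g′) n
·q-cong e e′ n = Σ-cong n (λ i _ → cong₂ _*ℚ_ (e i) (e′ (n ∸ i)))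

-- This one exchange law, together with the unit `δ₀`, yields both commutativity and associativity
-- of the product.
·q-leftComm : ∀ (f g h : QSeries) n → (f ·q (g ·q h)) n ≡ (g ·q (f ·q h)) n
·q-leftComm f g h n = begin
  Σℚ≤ n (λ i → f i *ℚ Σℚ≤ (n ∸ i) (λ j → g j *ℚ h (n ∸ i ∸ j)))
    ≡⟨ Σ-cong n (λ i _ → sym (Σ-*ˡ (n ∸ i) (f i) _)) ⟩
  Σℚ≤ n (λ i → Σℚ≤ (n ∸ i) (λ j → f i *ℚ (g j *ℚ h (n ∸ i ∸ j))))
    ≡⟨ Σ-triangle n (λ i j → f i *ℚ (g j *ℚ h (n ∸ i ∸ j))) ⟩
  Σℚ≤ n (λ j → Σℚ≤ (n ∸ j) (λ i → f i *ℚ (g j *ℚ h (n ∸ i ∸ j))))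
    ≡⟨ Σ-cong n (λ j _ → trans (Σ-cong (n ∸ j) (λ i _ → trans
         (cong (λ k → f i *ℚ (g j *ℚ h k)) (trans (ℕₚ.∸-+-assoc n i j) (trans (cong (n ∸_) (ℕₚ.+-comm i j)) (sym (ℕₚ.∸-+-assoc n j i)))))
         (solve 3 (λ a b c → a :* (b :* c) := b :* (a :* c)) refl (f i) (g j) (h (n ∸ j ∸ i)))))
         (Σ-*ˡ (n ∸ j) (g j) _)) ⟩
  Σℚ≤ n (λ j → g j *ℚ Σℚ≤ (n ∸ j) (λ i → f i *ℚ h (n ∸ j ∸ i))) ∎
  where open ≡-Reasoning

δ₀ : QSeries
δ₀ zero = 1ℚ
δ₀ (suc n) = 0ℚ

·q-identityʳ : ∀ (f : QSeries) n → (f ·q δ₀) n ≡ f n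
·q-identityʳ f zero = ℚₚ.*-identityʳ (f 0)
·q-identityʳ f (suc n) = trans (cong₂ _+ℚ_ (Σ-zero n (λ i le → trans (cong (λ k → f i *ℚ δ₀ k) (ℕₚ.+-∸-assoc 1 le)) (ℚₚ.*-zeroʳ (f i))))
  (trans (cong (λ k → f (suc n) *ℚ δ₀ k) (ℕₚ.n∸n≡0 n)) (ℚₚ.*-identityʳ (f (suc n))))) (ℚₚ.+-identityˡ (f (suc n)))

·q-comm : ∀ (f g : QSeries) n → (f ·q g) n ≡ (g ·q f) n
·q-comm f g n = trans (·q-cong {f} {f} (λ _ → refl) (λ i → sym (·q-identityʳ g i)) n)
  (trans (·q-leftComm f g δ₀ n) (·q-cong {g} {g} (λ _ → refl) (·q-identityʳ f) n))

·q-assoc : ∀ (f g h : QSeries) n → ((f ·q g) ·q h) n ≡ (f ·q (g ·q h)) n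
·q-assoc f g h n = trans (·q-comm (f ·q g) h n) (trans (·q-leftComm h f g n)
  (·q-cong {f} {f} (λ _ → refl) (·q-comm h g) n))

·q-*ˡ : ∀ c (f g : QSeries) n → ((λ i → c *ℚ f i) ·q g) n ≡ c *ℚ (f ·q g) n
·q-*ˡ c f g n = trans (Σ-cong n (λ i _ → ℚₚ.*-assoc c (f i) (g (n ∸ i)))) (Σ-*ˡ n c _)

·q-*ʳ : ∀ c (f g : QSeries) n → (f ·q (λ i → c *ℚ g i)) n ≡ c *ℚ (f ·q g) n
·q-*ʳ c f g n = trans (Σ-cong n (λ i _ → solve 3 (λ a b c → a :* (b :* c) := b :* (a :* c)) refl (f i) c (g (n ∸ i)))) (Σ-*ˡ n c _)

·q-front : ∀ (f g : QSeries) n → (f ·q g) (suc n) ≡ f 0 *ℚ g (suc n) +ℚ ((f ∘ suc) ·q g) n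
·q-front f g n = Σ-front n (λ i → f i *ℚ g (suc n ∸ i))

∂ : QSeries → QSeries
∂ f n = ℕtoℚ (suc n) *ℚ f (suc n)

leibniz : ∀ (f g : QSeries) n → ∂ (f ·q g) n ≡ (∂ f ·q g) n +ℚ (f ·q ∂ g) n
leibniz f g n = begin
  ℕtoℚ (suc n) *ℚ Σℚ≤ (suc n) (λ i → f i *ℚ g (suc n ∸ i))
    ≡⟨ Σ-*ˡ (suc n) (ℕtoℚ (suc n)) _ ⟨
  Σℚ≤ (suc n) (λ i → ℕtoℚ (suc n) *ℚ (f i *ℚ g (suc n ∸ i)))
    ≡⟨ Σ-cong (suc n) (λ i le → trans (cong (λ k → ℕtoℚ k *ℚ (f i *ℚ g (suc n ∸ i))) (sym (ℕₚ.m+[n∸m]≡n le)))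
         (trans (cong (_*ℚ (f i *ℚ g (suc n ∸ i))) (ℕtoℚ-+ i (suc n ∸ i)))
         (solve 4 (λ a b x y → (a :+ b) :* (x :* y) := (a :* x) :* y :+ x :* (b :* y)) refl (ℕtoℚ i) (ℕtoℚ (suc n ∸ i)) (f i) (g (suc n ∸ i))))) ⟩
  Σℚ≤ (suc n) (λ i → (ℕtoℚ i *ℚ f i) *ℚ g (suc n ∸ i) +ℚ f i *ℚ (ℕtoℚ (suc n ∸ i) *ℚ g (suc n ∸ i)))
    ≡⟨ Σ-+ (suc n) _ _ ⟩
  Σℚ≤ (suc n) (λ i → (ℕtoℚ i *ℚ f i) *ℚ g (suc n ∸ i)) +ℚ (Σℚ≤ n R +ℚ f (suc n) *ℚ (ℕtoℚ (n ∸ n) *ℚ g (n ∸ n)))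
    ≡⟨ cong₂ _+ℚ_ first second ⟩
  (∂ f ·q g) n +ℚ (f ·q ∂ g) n ∎
  where
  open ≡-Reasoning
  R : ℕ → ℚ
  R i = f i *ℚ (ℕtoℚ (suc n ∸ i) *ℚ g (suc n ∸ i))
  first : Σℚ≤ (suc n) (λ i → (ℕtoℚ i *ℚ f i) *ℚ g (suc n ∸ i)) ≡ (∂ f ·q g) n
  first = trans (Σ-front n _) (trans (cong (_+ℚ (∂ f ·q g) n)
    (trans (cong (_*ℚ g (suc n)) (ℚₚ.*-zeroˡ (f 0))) (ℚₚ.*-zeroˡ (g (suc n))))) (ℚₚ.+-identityˡ _))
  second : Σℚ≤ n R +ℚ f (suc n) *ℚ (ℕtoℚ (n ∸ n) *ℚ g (n ∸ n)) ≡ (f ·q ∂ g) n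
  second = trans (cong₂ _+ℚ_ (Σ-cong n (λ i le → cong (λ k → f i *ℚ (ℕtoℚ k *ℚ g k)) (ℕₚ.+-∸-assoc 1 le)))
    (trans (cong (λ k → f (suc n) *ℚ (ℕtoℚ k *ℚ g k)) (ℕₚ.n∸n≡0 n))
      (trans (cong (f (suc n) *ℚ_) (ℚₚ.*-zeroˡ (g 0))) (ℚₚ.*-zeroʳ (f (suc n)))))) (ℚₚ.+-identityʳ _)

*-invFact : ∀ k → ℕtoℚ (k !) *ℚ invFact k ≡ 1ℚ
*-invFact k = *-inverse-ℕ (k !) {{k !≢0}}

invFact-suc : ∀ k → ℕtoℚ (suc k) *ℚ invFact (suc k) ≡ invFact k
invFact-suc k = *-cancel-ℕ (k !) {{k !≢0}} (begin
  ℕtoℚ (k !) *ℚ (ℕtoℚ (suc k) *ℚ invFact (suc k))   ≡⟨ ℚₚ.*-assoc (ℕtoℚ (k !)) (ℕtoℚ (suc k)) (invFact (suc k)) ⟨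
  ℕtoℚ (k !) *ℚ ℕtoℚ (suc k) *ℚ invFact (suc k)     ≡⟨ cong (_*ℚ invFact (suc k)) (trans (ℚₚ.*-comm (ℕtoℚ (k !)) (ℕtoℚ (suc k))) (sym (ℕtoℚ-* (suc k) (k !)))) ⟩
  ℕtoℚ (suc k !) *ℚ invFact (suc k)                 ≡⟨ *-invFact (suc k) ⟩
  1ℚ                                                ≡⟨ *-invFact k ⟨
  ℕtoℚ (k !) *ℚ invFact k                           ∎)
  where open ≡-Reasoning

-- The signs θ n = (-1)^⌊n/2⌋ and the exponential coefficients of cos and sin

θ : ℕ → ℚ
θ n = negOnePow (n / 2)

θ-2+ : ∀ n → θ (suc (suc n)) ≡ -ℚ θ n
θ-2+ n = cong negOnePow (DM.m/n≡1+[m∸n]/n {suc (suc n)} {2} (s≤s (s≤s z≤n)))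

θ-suc : ∀ n → θ (suc n) ≡ (if isEven n then θ n else -ℚ θ n)
θ-suc zero = refl
θ-suc (suc zero) = refl
θ-suc (suc (suc n)) = trans (θ-2+ (suc n)) (trans (cong -ℚ_ (θ-suc n)) (go (isEven n)))
  where
  go : ∀ b → -ℚ (if b then θ n else -ℚ θ n) ≡ (if b then θ (suc (suc n)) else -ℚ θ (suc (suc n)))
  go true = sym (θ-2+ n)
  go false = cong -ℚ_ (sym (θ-2+ n))

C S : ℕ → ℚ
C n = if isEven n then θ n else 0ℚ
S n = if isEven n then 0ℚ else θ n

C-even : ∀ n → isEven n ≡ true → C n ≡ θ n
C-even n e rewrite e = refl

C-odd : ∀ n → isEven n ≡ false → C n ≡ 0ℚ
C-odd n e rewrite e = refl

S-even : ∀ n → isEven n ≡ true → S n ≡ 0ℚ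
S-even n e rewrite e = refl

S-odd : ∀ n → isEven n ≡ false → S n ≡ θ n
S-odd n e rewrite e = refl

C-suc : ∀ n → C (suc n) ≡ -ℚ S n
C-suc n rewrite not-isEven n | θ-suc n with isEven n
... | true = refl
... | false = refl

S-suc : ∀ n → S (suc n) ≡ C n
S-suc n rewrite not-isEven n | θ-suc n with isEven n
... | true = refl
... | false = refl

cosS≡ : ∀ n → cosS n ≡ C n *ℚ invFact n
cosS≡ n with isEven n
... | true = refl
... | false = sym (ℚₚ.*-zeroˡ (invFact n))

sinS≡ : ∀ n → sinS n ≡ S n *ℚ invFact n
sinS≡ n with isEven n
... | true = sym (ℚₚ.*-zeroˡ (invFact n))
... | false = refl

∂-expCoeff : ∀ (u : ℕ → ℚ) n → ∂ (λ k → u k *ℚ invFact k) n ≡ u (suc n) *ℚ invFact n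
∂-expCoeff u n = trans (solve 3 (λ a b c → a :* (b :* c) := b :* (a :* c)) refl (ℕtoℚ (suc n)) (u (suc n)) (invFact (suc n)))
  (cong (u (suc n) *ℚ_) (invFact-suc n))

∂-cos : ∀ n → ∂ cosS n ≡ -ℚ 1ℚ *ℚ sinS n
∂-cos n = trans (cong (ℕtoℚ (suc n) *ℚ_) (cosS≡ (suc n))) (trans (∂-expCoeff C n)
  (trans (cong (_*ℚ invFact n) (C-suc n)) (trans (solve 2 (λ s i → (:- s) :* i := con (-ℚ 1ℚ) :* (s :* i)) refl (S n) (invFact n)) (cong (-ℚ 1ℚ *ℚ_) (sym (sinS≡ n))))))

∂-sin : ∀ n → ∂ sinS n ≡ cosS n
∂-sin n = trans (cong (ℕtoℚ (suc n) *ℚ_) (sinS≡ (suc n))) (trans (∂-expCoeff S n)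
  (trans (cong (_*ℚ invFact n) (S-suc n)) (sym (cosS≡ n))))

-- K₀ and K₁ are multiplication by cos and sin on exponential generating functions.
K₀ K₁ : (ℕ → ℚ) → ℕ → ℚ
K₀ u zero = u 0
K₀ u (suc o) = K₀ (u ∘ suc) o -ℚ K₁ u o
K₁ u zero = 0ℚ
K₁ u (suc o) = K₁ (u ∘ suc) o +ℚ K₀ u o

K₀-cong : ∀ {u v : ℕ → ℚ} → (∀ k → u k ≡ v k) → ∀ o → K₀ u o ≡ K₀ v o
K₁-cong : ∀ {u v : ℕ → ℚ} → (∀ k → u k ≡ v k) → ∀ o → K₁ u o ≡ K₁ v o
K₀-cong e zero = e 0
K₀-cong e (suc o) = cong₂ _-ℚ_ (K₀-cong (e ∘ suc) o) (K₁-cong e o)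
K₁-cong e zero = refl
K₁-cong e (suc o) = cong₂ _+ℚ_ (K₁-cong (e ∘ suc) o) (K₀-cong e o)

K₀-+ : ∀ (u v : ℕ → ℚ) o → K₀ (λ k → u k +ℚ v k) o ≡ K₀ u o +ℚ K₀ v o
K₁-+ : ∀ (u v : ℕ → ℚ) o → K₁ (λ k → u k +ℚ v k) o ≡ K₁ u o +ℚ K₁ v o
K₀-+ u v zero = refl
K₀-+ u v (suc o) = trans (cong₂ _-ℚ_ (K₀-+ (u ∘ suc) (v ∘ suc) o) (K₁-+ u v o))
  (solve 4 (λ a b c d → (a :+ b) :- (c :+ d) := (a :- c) :+ (b :- d)) refl (K₀ (u ∘ suc) o) (K₀ (v ∘ suc) o) (K₁ u o) (K₁ v o))
K₁-+ u v zero = refl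
K₁-+ u v (suc o) = trans (cong₂ _+ℚ_ (K₁-+ (u ∘ suc) (v ∘ suc) o) (K₀-+ u v o))
  (solve 4 (λ a b c d → (a :+ b) :+ (c :+ d) := (a :+ c) :+ (b :+ d)) refl (K₁ (u ∘ suc) o) (K₁ (v ∘ suc) o) (K₀ u o) (K₀ v o))

K₀-neg : ∀ (u v : ℕ → ℚ) o → K₀ (λ k → u k -ℚ v k) o ≡ K₀ u o -ℚ K₀ v o
K₁-neg : ∀ (u v : ℕ → ℚ) o → K₁ (λ k → u k -ℚ v k) o ≡ K₁ u o -ℚ K₁ v o
K₀-neg u v zero = refl
K₀-neg u v (suc o) = trans (cong₂ _-ℚ_ (K₀-neg (u ∘ suc) (v ∘ suc) o) (K₁-neg u v o))
  (solve 4 (λ a b c d → (a :- b) :- (c :- d) := (a :- c) :- (b :- d)) refl (K₀ (u ∘ suc) o) (K₀ (v ∘ suc) o) (K₁ u o) (K₁ v o))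
K₁-neg u v zero = refl
K₁-neg u v (suc o) = trans (cong₂ _+ℚ_ (K₁-neg (u ∘ suc) (v ∘ suc) o) (K₀-neg u v o))
  (solve 4 (λ a b c d → (a :- b) :+ (c :- d) := (a :+ c) :- (b :+ d)) refl (K₁ (u ∘ suc) o) (K₁ (v ∘ suc) o) (K₀ u o) (K₀ v o))

K₀K₁-comm : ∀ (u : ℕ → ℚ) o → K₀ (K₁ u) o ≡ K₁ (K₀ u) o
K₀K₁-comm u zero = refl
K₀K₁-comm u (suc o) = trans (cong (_-ℚ K₁ (K₁ u) o) (K₀-+ (K₁ (u ∘ suc)) (K₀ u) o))
  (trans (cong (λ x → x +ℚ K₀ (K₀ u) o -ℚ K₁ (K₁ u) o) (K₀K₁-comm (u ∘ suc) o))
  (trans (solve 3 (λ a b c → a :+ b :- c := (a :- c) :+ b) refl (K₁ (K₀ (u ∘ suc)) o) (K₀ (K₀ u) o) (K₁ (K₁ u) o))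
         (cong (_+ℚ K₀ (K₀ u) o) (sym (K₁-neg (K₀ (u ∘ suc)) (K₁ u) o)))))

-- This is cos² + sin² = 1 for the operators; applied to sec it gives sin tan = sec - cos.
K₀²+K₁² : ∀ (u : ℕ → ℚ) o → K₀ (K₀ u) o +ℚ K₁ (K₁ u) o ≡ u o
K₀²+K₁² u zero = ℚₚ.+-identityʳ (u 0)
K₀²+K₁² u (suc o) = begin
  (K₀ (K₀ u ∘ suc) o -ℚ K₁ (K₀ u) o) +ℚ (K₁ (K₁ u ∘ suc) o +ℚ K₀ (K₁ u) o)
    ≡⟨ cong₂ (λ x y → (x -ℚ K₁ (K₀ u) o) +ℚ (y +ℚ K₀ (K₁ u) o)) (K₀-neg (K₀ (u ∘ suc)) (K₁ u) o) (K₁-+ (K₁ (u ∘ suc)) (K₀ u) o) ⟩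
  (K₀ (K₀ (u ∘ suc)) o -ℚ K₀ (K₁ u) o -ℚ K₁ (K₀ u) o) +ℚ ((K₁ (K₁ (u ∘ suc)) o +ℚ K₁ (K₀ u) o) +ℚ K₀ (K₁ u) o)
    ≡⟨ solve 4 (λ a b c d → (a :- b :- c) :+ ((d :+ c) :+ b) := a :+ d) refl (K₀ (K₀ (u ∘ suc)) o) (K₀ (K₁ u) o) (K₁ (K₀ u) o) (K₁ (K₁ (u ∘ suc)) o) ⟩
  K₀ (K₀ (u ∘ suc)) o +ℚ K₁ (K₁ (u ∘ suc)) o
    ≡⟨ K₀²+K₁² (u ∘ suc) o ⟩
  u (suc o) ∎
  where open ≡-Reasoning

egf : QSeries → ℕ → ℚ
egf v k = ℕtoℚ (k !) *ℚ v k

egf-suc : ∀ v k → egf v (suc k) ≡ egf (∂ v) k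
egf-suc v k = trans (cong (_*ℚ v (suc k)) (trans (ℕtoℚ-* (suc k) (k !)) (ℚₚ.*-comm (ℕtoℚ (suc k)) (ℕtoℚ (k !))))) (ℚₚ.*-assoc (ℕtoℚ (k !)) (ℕtoℚ (suc k)) (v (suc k)))

-- The recursion defining `K₀` and `K₁` is Leibniz' rule combined with cos′ = -sin and sin′ = cos;
-- in this form binomial coefficients never appear.
egf-cos : ∀ v o → egf (cosS ·q v) o ≡ K₀ (egf v) o
egf-sin : ∀ v o → egf (sinS ·q v) o ≡ K₁ (egf v) o
egf-cos v zero = cong (1ℚ *ℚ_) (ℚₚ.*-identityˡ (v 0))
egf-cos v (suc o) = begin
  egf (cosS ·q v) (suc o)                                  ≡⟨ egf-suc (cosS ·q v) o ⟩
  o! *ℚ ∂ (cosS ·q v) o                                    ≡⟨ cong (o! *ℚ_) (leibniz cosS v o) ⟩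
  o! *ℚ ((∂ cosS ·q v) o +ℚ (cosS ·q ∂ v) o)               ≡⟨ cong (λ x → o! *ℚ (x +ℚ (cosS ·q ∂ v) o)) (trans (·q-cong {g = v} ∂-cos (λ _ → refl) o) (·q-*ˡ (-ℚ 1ℚ) sinS v o)) ⟩
  o! *ℚ (-ℚ 1ℚ *ℚ (sinS ·q v) o +ℚ (cosS ·q ∂ v) o)        ≡⟨ solve 3 (λ f s c → f :* (con (-ℚ 1ℚ) :* s :+ c) := f :* c :- f :* s) refl o! ((sinS ·q v) o) ((cosS ·q ∂ v) o) ⟩
  egf (cosS ·q ∂ v) o -ℚ egf (sinS ·q v) o                 ≡⟨ cong₂ _-ℚ_ (egf-cos (∂ v) o) (egf-sin v o) ⟩
  K₀ (egf (∂ v)) o -ℚ K₁ (egf v) o                         ≡⟨ cong (_-ℚ K₁ (egf v) o) (K₀-cong (λ k → sym (egf-suc v k)) o) ⟩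
  K₀ (egf v) (suc o)                                       ∎
  where
  open ≡-Reasoning
  o! = ℕtoℚ (o !)
egf-sin v zero = cong (1ℚ *ℚ_) (ℚₚ.*-zeroˡ (v 0))
egf-sin v (suc o) = begin
  egf (sinS ·q v) (suc o)                                  ≡⟨ egf-suc (sinS ·q v) o ⟩
  o! *ℚ ∂ (sinS ·q v) o                                    ≡⟨ cong (o! *ℚ_) (leibniz sinS v o) ⟩
  o! *ℚ ((∂ sinS ·q v) o +ℚ (sinS ·q ∂ v) o)               ≡⟨ cong (λ x → o! *ℚ (x +ℚ (sinS ·q ∂ v) o)) (·q-cong {g = v} ∂-sin (λ _ → refl) o) ⟩
  o! *ℚ ((cosS ·q v) o +ℚ (sinS ·q ∂ v) o)                 ≡⟨ solve 3 (λ f s c → f :* (s :+ c) := f :* c :+ f :* s) refl o! ((cosS ·q v) o) ((sinS ·q ∂ v) o) ⟩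
  egf (sinS ·q ∂ v) o +ℚ egf (cosS ·q v) o                 ≡⟨ cong₂ _+ℚ_ (egf-sin (∂ v) o) (egf-cos v o) ⟩
  K₁ (egf (∂ v)) o +ℚ K₀ (egf v) o                         ≡⟨ cong (_+ℚ K₀ (egf v) o) (K₁-cong (λ k → sym (egf-suc v k)) o) ⟩
  K₁ (egf v) (suc o)                                       ∎
  where
  open ≡-Reasoning
  o! = ℕtoℚ (o !)

length-secList : ∀ n → length (secList n) ≡ suc n
length-secList zero = refl
length-secList (suc n) = trans (Listₚ.length-++ (secList n)) (trans (cong (_+ 1) (length-secList n)) (ℕₚ.+-comm (suc n) 1))

nth-++ˡ : ∀ xs ys i → i < length xs → nth (xs ++ ys) i ≡ nth xs i
nth-++ˡ (x ∷ xs) ys zero lt = refl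
nth-++ˡ (x ∷ xs) ys (suc i) (s≤s lt) = nth-++ˡ xs ys i lt

nth-++-length : ∀ xs y → nth (xs ++ y ∷ []) (length xs) ≡ y
nth-++-length [] y = refl
nth-++-length (x ∷ xs) y = nth-++-length xs y

-- Each list extends its predecessor, so a coefficient never changes once it has been computed.
nth-secList : ∀ t i → nth (secList (t + i)) i ≡ secS i
nth-secList zero i = refl
nth-secList (suc t) i = trans (nth-++ˡ (secList (t + i)) _ i
  (subst (i <_) (sym (length-secList (t + i))) (s≤s (ℕₚ.m≤n+m i t)))) (nth-secList t i)

secS-suc : ∀ n → secS (suc n) ≡ -ℚ Σℚ≤ n (λ j → cosS (suc j) *ℚ secS (n ∸ j))
secS-suc n = trans (cong (nth (secList (suc n))) (sym (length-secList n))) (trans (nth-++-length (secList n) _)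
  (cong -ℚ_ (Σ-cong n (λ j le → cong (cosS (suc j) *ℚ_)
    (trans (cong (λ k → nth (secList k) (n ∸ j)) (sym (ℕₚ.m+[n∸m]≡n le))) (nth-secList j (n ∸ j)))))))

cos·sec : ∀ n → (cosS ·q secS) n ≡ δ₀ n
cos·sec zero = refl
cos·sec (suc n) = trans (·q-front cosS secS n) (trans (cong (λ x → 1ℚ *ℚ x +ℚ ((cosS ∘ suc) ·q secS) n) (secS-suc n))
  (solve 1 (λ a → con 1ℚ :* (:- a) :+ a := con 0ℚ) refl (((cosS ∘ suc) ·q secS) n)))

K₀-δ₀ : ∀ o → K₀ δ₀ o ≡ C o
K₁-δ₀ : ∀ o → K₁ δ₀ o ≡ S o
K-zero : ∀ o → K₀ (λ _ → 0ℚ) o ≡ 0ℚ × K₁ (λ _ → 0ℚ) o ≡ 0ℚ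
K-zero zero = refl , refl
K-zero (suc o) = cong₂ _-ℚ_ (proj₁ (K-zero o)) (proj₂ (K-zero o)) , cong₂ _+ℚ_ (proj₂ (K-zero o)) (proj₁ (K-zero o))
K₀-δ₀ zero = refl
K₀-δ₀ (suc o) = trans (cong₂ _-ℚ_ (proj₁ (K-zero o)) (K₁-δ₀ o)) (trans (ℚₚ.+-identityˡ (-ℚ S o)) (sym (C-suc o)))
K₁-δ₀ zero = refl
K₁-δ₀ (suc o) = trans (cong₂ _+ℚ_ (proj₂ (K-zero o)) (K₀-δ₀ o)) (trans (ℚₚ.+-identityˡ (C o)) (sym (S-suc o)))

egf-δ₀ : ∀ k → egf δ₀ k ≡ δ₀ k
egf-δ₀ zero = refl
egf-δ₀ (suc k) = ℚₚ.*-zeroʳ (ℕtoℚ (suc k !))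

K₀-sec : ∀ o → K₀ (egf secS) o ≡ δ₀ o
K₀-sec o = trans (sym (egf-cos secS o)) (trans (cong (ℕtoℚ (o !) *ℚ_) (cos·sec o)) (egf-δ₀ o))

euler≡ : ∀ o → euler o ≡ egf secS o +ℚ K₁ (egf secS) o
euler≡ o = trans (ℚₚ.*-distribˡ-+ (ℕtoℚ (o !)) (secS o) (tanS o)) (cong (egf secS o +ℚ_) (egf-sin secS o))

-- (1 + sin) = cos (sec + tan)
K₀-euler : ∀ o → K₀ euler o ≡ δ₀ o +ℚ S o
K₀-euler o = trans (K₀-cong euler≡ o) (trans (K₀-+ (egf secS) (K₁ (egf secS)) o) (cong₂ _+ℚ_ (K₀-sec o)
  (trans (K₀K₁-comm (egf secS) o) (trans (K₁-cong K₀-sec o) (K₁-δ₀ o)))))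

-- sin (sec + tan) = sec + tan - cos
K₁-euler : ∀ o → K₁ euler o ≡ euler o -ℚ C o
K₁-euler o = trans (K₁-cong euler≡ o) (trans (K₁-+ s (K₁ s) o)
  (trans (cong (K₁ s o +ℚ_) (trans (solve 2 (λ a b → b := (a :+ b) :- a) refl (K₀ (K₀ s) o) (K₁ (K₁ s) o))
    (cong₂ _-ℚ_ (K₀²+K₁² s o) (trans (K₀-cong K₀-sec o) (K₀-δ₀ o)))))
  (trans (solve 3 (λ a b c → a :+ (b :- c) := (b :+ a) :- c) refl (K₁ s o) (s o) (C o)) (cong (_-ℚ C o) (sym (euler≡ o))))))
  where s = egf secS

-- Summation over all placements of parts on q letters

bump : ∀ {q} → Fin q → ℕ → Vec ℕ q → Vec ℕ q
bump zero ℓ (x ∷ α) = ℓ + x ∷ α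
bump (suc a) ℓ (x ∷ α) = x ∷ bump a ℓ α

zeros : ∀ q → Vec ℕ q
zeros q = Vec.replicate q 0

-- In terms of symmetric functions: `χ` is a linear functional on monomials in `q` variables, and it
-- is applied to the power sum `p_λ`.
letterSum : ∀ q → List ℕ → (Vec ℕ q → ℚ) → ℚ
letterSum q [] χ = χ (zeros q)
letterSum q (ℓ ∷ λs) χ = Q.∑ (allFin q) (λ a → letterSum q λs (χ ∘ bump a ℓ))

letterSum-cong : ∀ q λs {χ χ′ : Vec ℕ q → ℚ} → (∀ α → χ α ≡ χ′ α) → letterSum q λs χ ≡ letterSum q λs χ′
letterSum-cong q [] e = e (zeros q)
letterSum-cong q (ℓ ∷ λs) e = Q.∑-cong (allFin q) (λ a → letterSum-cong q λs (e ∘ bump a ℓ))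

letterSum-zero : ∀ q λs → letterSum q λs (λ _ → 0ℚ) ≡ 0ℚ
letterSum-zero q [] = refl
letterSum-zero q (ℓ ∷ λs) = Q.∑-zero (allFin q) (λ a → letterSum-zero q λs)

letterSum-*ˡ : ∀ q λs c (χ : Vec ℕ q → ℚ) → letterSum q λs (λ α → c *ℚ χ α) ≡ c *ℚ letterSum q λs χ
letterSum-*ˡ q [] c χ = refl
letterSum-*ˡ q (ℓ ∷ λs) c χ = trans (Q.∑-cong (allFin q) (λ a → letterSum-*ˡ q λs c (χ ∘ bump a ℓ))) (Q.∑-*ˡ (allFin q) c (λ a → letterSum q λs (χ ∘ bump a ℓ)))

bump-⊞ : ∀ {q} (a : Fin q) ℓ γ β → bump a ℓ (γ ⊞ β) ≡ bump a ℓ γ ⊞ β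
bump-⊞ zero ℓ (x ∷ γ) (y ∷ β) = cong (_∷ γ ⊞ β) (sym (ℕₚ.+-assoc ℓ x y))
bump-⊞ (suc a) ℓ (x ∷ γ) (y ∷ β) = cong (x + y ∷_) (bump-⊞ a ℓ γ β)

zeros-⊞ : ∀ {q} (β : Vec ℕ q) → zeros q ⊞ β ≡ β
zeros-⊞ [] = refl
zeros-⊞ (x ∷ β) = cong (x ∷_) (zeros-⊞ β)

letterSum-++ : ∀ q λs λs′ (χ : Vec ℕ q → ℚ) →
  letterSum q (λs ++ λs′) χ ≡ letterSum q λs (λ γ → letterSum q λs′ (λ β → χ (γ ⊞ β)))
letterSum-++ q [] λs′ χ = letterSum-cong q λs′ (λ β → cong χ (sym (zeros-⊞ β)))
letterSum-++ q (ℓ ∷ λs) λs′ χ = Q.∑-cong (allFin q) (λ a → trans (letterSum-++ q λs λs′ (χ ∘ bump a ℓ))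
  (letterSum-cong q λs (λ γ → letterSum-cong q λs′ (λ β → cong χ (bump-⊞ a ℓ γ β)))))

⋆-content-∷ : ∀ {q s} k x (v : Vec (Fin q) s) → k ⋆ content (lookup (x ∷ v)) ≡ bump x k (k ⋆ content (lookup v))
⋆-content-∷ {q} {s} k x v = vec-ext (λ a → trans (Vecₚ.lookup-map a (k *_) (content (lookup (x ∷ v))))
  (trans (cong (k *_) (trans (Vecₚ.lookup∘tabulate _ a) (N.∑-allFin-suc s (λ t → N.ind (lookup (x ∷ v) t ≟ᶠ a)))))
  (trans (step a) (sym (lookup-bump x (k ⋆ content (lookup v)) a)))))
  where
  lookup-bump : ∀ {q} (x : Fin q) α a → lookup (bump x k α) a ≡ N.ind (x ≟ᶠ a) * k + lookup α a
  lookup-bump zero (y ∷ α) zero = cong (_+ y) (sym (ℕₚ.+-identityʳ k))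
  lookup-bump zero (y ∷ α) (suc a) = refl
  lookup-bump (suc x) (y ∷ α) zero = refl
  lookup-bump (suc x) (y ∷ α) (suc a) = trans (lookup-bump x α a)
    (cong (λ i → i * k + lookup α a) (N.ind-⇔ (x ≟ᶠ a) (suc x ≟ᶠ suc a) (cong suc) Finₚ.suc-injective))
  c = λ a → count (λ t → lookup v t ≟ᶠ a)
  step : ∀ a → k * (N.ind (x ≟ᶠ a) + c a) ≡ N.ind (x ≟ᶠ a) * k + lookup (k ⋆ content (lookup v)) a
  step a = trans (ℕₚ.*-distribˡ-+ k (N.ind (x ≟ᶠ a)) (c a)) (cong₂ _+_ (ℕₚ.*-comm k (N.ind (x ≟ᶠ a)))
    (sym (trans (Vecₚ.lookup-map a (k *_) (content (lookup v))) (cong (k *_) (Vecₚ.lookup∘tabulate _ a)))))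

-- A word of length `s` with each letter counted `k` times is a placement of `s` parts of size `k`,
-- one for each position.
letterSum-replicate : ∀ q s k (φ : Vec ℕ q → ℚ) →
  Q.∑ (vecsOver (allFin q) s) (λ u → φ (k ⋆ content (lookup u))) ≡ letterSum q (replicate s k) φ
letterSum-replicate q zero k φ = trans (ℚₚ.+-identityʳ _) (cong φ (vec-ext (λ a → trans (Vecₚ.lookup-map a (k *_) (content {q} (lookup [])))
  (trans (cong (k *_) (Vecₚ.lookup∘tabulate _ a)) (trans (ℕₚ.*-zeroʳ k) (sym (Vecₚ.lookup-replicate a 0)))))))
letterSum-replicate q (suc s) k φ = begin
  Q.∑ (vecsOver (allFin q) (suc s)) (λ u → φ (k ⋆ content (lookup u)))
    ≡⟨ Q.∑-vecsOver-suc (allFin q) s _ ⟩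
  Q.∑ (vecsOver (allFin q) s) (λ v → Q.∑ (allFin q) (λ x → φ (k ⋆ content (lookup (x ∷ v)))))
    ≡⟨ Q.∑-swap (vecsOver (allFin q) s) (allFin q) (λ v x → φ (k ⋆ content (lookup (x ∷ v)))) ⟩
  Q.∑ (allFin q) (λ x → Q.∑ (vecsOver (allFin q) s) (λ v → φ (k ⋆ content (lookup (x ∷ v)))))
    ≡⟨ Q.∑-cong (allFin q) (λ x → trans (Q.∑-cong (vecsOver (allFin q) s) (λ v → cong φ (⋆-content-∷ k x v)))
         (letterSum-replicate q s k (φ ∘ bump x k))) ⟩
  letterSum q (replicate (suc s) k) φ ∎
  where open ≡-Reasoning

-- Summation over all splittings of a list of parts into two sublists, the
-- first of which only enters through its sum.
splitSum : List ℕ → (ℕ → List ℕ → ℚ) → ℚ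
splitSum [] φ = φ 0 []
splitSum (ℓ ∷ λs) φ = splitSum λs (λ x Y → φ (ℓ + x) Y) +ℚ splitSum λs (λ x Y → φ x (ℓ ∷ Y))

-- Records which pairs occur in `splitSum`, so that a summand can be rewritten with facts such as
-- `x + sum Y ≡ sum λs`.
data Split : List ℕ → ℕ → List ℕ → Set where
  nil : Split [] 0 []
  take : ∀ {ℓ λs x Y} → Split λs x Y → Split (ℓ ∷ λs) (ℓ + x) Y
  leave : ∀ {ℓ λs x Y} → Split λs x Y → Split (ℓ ∷ λs) x (ℓ ∷ Y)

splitSum-cong : ∀ λs {φ φ′} → (∀ x Y → Split λs x Y → φ x Y ≡ φ′ x Y) → splitSum λs φ ≡ splitSum λs φ′
splitSum-cong [] e = e 0 [] nil
splitSum-cong (ℓ ∷ λs) e = cong₂ _+ℚ_ (splitSum-cong λs (λ x Y s → e _ _ (take s))) (splitSum-cong λs (λ x Y s → e _ _ (leave s)))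

splitSum-zero : ∀ λs {φ} → (∀ x Y → Split λs x Y → φ x Y ≡ 0ℚ) → splitSum λs φ ≡ 0ℚ
splitSum-zero [] e = e 0 [] nil
splitSum-zero (ℓ ∷ λs) e = trans (cong₂ _+ℚ_ (splitSum-zero λs (λ x Y s → e _ _ (take s))) (splitSum-zero λs (λ x Y s → e _ _ (leave s)))) (ℚₚ.+-identityʳ 0ℚ)

splitSum-+ : ∀ λs φ φ′ → splitSum λs (λ x Y → φ x Y +ℚ φ′ x Y) ≡ splitSum λs φ +ℚ splitSum λs φ′
splitSum-+ [] φ φ′ = refl
splitSum-+ (ℓ ∷ λs) φ φ′ = trans (cong₂ _+ℚ_ (splitSum-+ λs _ _) (splitSum-+ λs _ _))
  (solve 4 (λ a b c d → (a :+ b) :+ (c :+ d) := (a :+ c) :+ (b :+ d)) refl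
    (splitSum λs (λ x Y → φ (ℓ + x) Y)) (splitSum λs (λ x Y → φ′ (ℓ + x) Y)) (splitSum λs (λ x Y → φ x (ℓ ∷ Y))) (splitSum λs (λ x Y → φ′ x (ℓ ∷ Y))))

splitSum-*ˡ : ∀ λs c φ → splitSum λs (λ x Y → c *ℚ φ x Y) ≡ c *ℚ splitSum λs φ
splitSum-*ˡ [] c φ = refl
splitSum-*ˡ (ℓ ∷ λs) c φ = trans (cong₂ _+ℚ_ (splitSum-*ˡ λs c _) (splitSum-*ˡ λs c _))
  (sym (ℚₚ.*-distribˡ-+ c (splitSum λs (λ x Y → φ (ℓ + x) Y)) (splitSum λs (λ x Y → φ x (ℓ ∷ Y)))))

splitSum-∑ : {A : Set} (xs : List A) → ∀ λs (φ : A → ℕ → List ℕ → ℚ) →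
  Q.∑ xs (λ a → splitSum λs (φ a)) ≡ splitSum λs (λ x Y → Q.∑ xs (λ a → φ a x Y))
splitSum-∑ xs [] φ = refl
splitSum-∑ xs (ℓ ∷ λs) φ = trans (Q.∑-+ xs (λ a → splitSum λs (λ x Y → φ a (ℓ + x) Y)) (λ a → splitSum λs (λ x Y → φ a x (ℓ ∷ Y))))
  (cong₂ _+ℚ_ (splitSum-∑ xs λs _) (splitSum-∑ xs λs _))

-- The first letter takes a sublist of the parts and keeps only its sum, and the other parts go to
-- the remaining letters. This is the step of the induction on the number of letters.
letterSum-suc : ∀ q λs (χ : Vec ℕ (suc q) → ℚ) →
  letterSum (suc q) λs χ ≡ splitSum λs (λ x Y → letterSum q Y (λ α → χ (x ∷ α)))
letterSum-suc q [] χ = refl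
letterSum-suc q (ℓ ∷ λs) χ = trans (Q.∑-allFin-suc q (λ a → letterSum (suc q) λs (χ ∘ bump a ℓ)))
  (cong₂ _+ℚ_ (letterSum-suc q λs (χ ∘ bump zero ℓ))
    (trans (Q.∑-cong (allFin q) (λ a → letterSum-suc q λs (χ ∘ bump (suc a) ℓ)))
           (splitSum-∑ (allFin q) λs (λ a x Y → letterSum q Y (λ α → χ (x ∷ bump a ℓ α))))))

Positive : List ℕ → Set
Positive = All (0 <_)

nil? : (Y : List ℕ) → Dec (Y ≡ [])
nil? [] = yes refl
nil? (_ ∷ _) = no (λ ())

splitSum-all : ∀ λs (f : ℕ → ℚ) → splitSum λs (λ x Y → f x *ℚ Q.ind (nil? Y)) ≡ f (sum λs)
splitSum-all [] f = ℚₚ.*-identityʳ (f 0)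
splitSum-all (ℓ ∷ λs) f = trans (cong₂ _+ℚ_ (splitSum-all λs (λ x → f (ℓ + x))) (splitSum-zero λs (λ x Y _ → ℚₚ.*-zeroʳ (f x)))) (ℚₚ.+-identityʳ _)

split-sum : ∀ {λs x Y} → Split λs x Y → x + sum Y ≡ sum λs
split-sum nil = refl
split-sum {ℓ ∷ λs} (take {x = x} {Y} s) = trans (ℕₚ.+-assoc ℓ x (sum Y)) (cong (ℓ +_) (split-sum s))
split-sum {ℓ ∷ λs} (leave {x = x} {Y} s) = trans (trans (sym (ℕₚ.+-assoc x ℓ (sum Y))) (trans (cong (_+ sum Y) (ℕₚ.+-comm x ℓ)) (ℕₚ.+-assoc ℓ x (sum Y)))) (cong (ℓ +_) (split-sum s))

split-positive : ∀ {λs x Y} → Split λs x Y → Positive λs → Positive Y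
split-positive nil pos = pos
split-positive (take s) (_ Allₚ.∷ pos) = split-positive s pos
split-positive (leave s) (p Allₚ.∷ pos) = p Allₚ.∷ split-positive s pos

split-length : ∀ {λs x Y} → Split λs x Y → length Y ≤ length λs
split-length nil = z≤n
split-length (take s) = ℕₚ.m≤n⇒m≤1+n (split-length s)
split-length (leave s) = s≤s (split-length s)

split-length-< : ∀ {λs x Y} → Split λs x Y → 0 < x → length Y < length λs
split-length-< (take s) 0<x = s≤s (split-length s)
split-length-< (leave s) 0<x = s≤s (split-length-< s 0<x)

-- Among positive parts only the empty sublist has sum zero.
splitSum-trivial : ∀ λs φ → Positive λs → (∀ x Y → Split λs x Y → 0 < x → φ x Y ≡ 0ℚ) → splitSum λs φ ≡ φ 0 λs
splitSum-trivial [] φ pos e = refl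
splitSum-trivial (ℓ ∷ λs) φ (p Allₚ.∷ pos) e = trans (cong₂ _+ℚ_
  (splitSum-zero λs (λ x Y s → e _ _ (take s) (ℕₚ.<-≤-trans p (ℕₚ.m≤m+n ℓ x))))
  (splitSum-trivial λs (λ x Y → φ x (ℓ ∷ Y)) pos (λ x Y s → e _ _ (leave s)))) (ℚₚ.+-identityˡ _)

-- closed κ u λ = κ^e (∏ θ(λᵢ)) u(o), where e and o count the even and the odd parts of λ.
closed : ℚ → (ℕ → ℚ) → List ℕ → ℚ
closed κ u [] = u 0
closed κ u (ℓ ∷ λs) = if isEven ℓ then κ *ℚ (θ ℓ *ℚ closed κ u λs) else θ ℓ *ℚ closed κ (u ∘ suc) λs

closed-cong : ∀ κ {u v : ℕ → ℚ} λs → (∀ k → u k ≡ v k) → closed κ u λs ≡ closed κ v λs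
closed-cong κ [] e = e 0
closed-cong κ (ℓ ∷ λs) e with isEven ℓ
... | true = cong (λ x → κ *ℚ (θ ℓ *ℚ x)) (closed-cong κ λs e)
... | false = cong (θ ℓ *ℚ_) (closed-cong κ λs (e ∘ suc))

closed-linear : ∀ κ (a b : ℚ) (u v : ℕ → ℚ) λs →
  closed κ (λ k → a *ℚ u k +ℚ b *ℚ v k) λs ≡ a *ℚ closed κ u λs +ℚ b *ℚ closed κ v λs
closed-linear κ a b u v [] = refl
closed-linear κ a b u v (ℓ ∷ λs) with isEven ℓ
... | true = trans (cong (λ x → κ *ℚ (θ ℓ *ℚ x)) (closed-linear κ a b u v λs))
      (solve 6 (λ k t a b x y → k :* (t :* (a :* x :+ b :* y)) := a :* (k :* (t :* x)) :+ b :* (k :* (t :* y))) refl κ (θ ℓ) a b (closed κ u λs) (closed κ v λs))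
... | false = trans (cong (θ ℓ *ℚ_) (closed-linear κ a b (u ∘ suc) (v ∘ suc) λs))
      (solve 5 (λ t a b x y → t :* (a :* x :+ b :* y) := a :* (t :* x) :+ b :* (t :* y)) refl (θ ℓ) a b (closed κ (u ∘ suc) λs) (closed κ (v ∘ suc) λs))

isEven-+ : ∀ a b → isEven a ≡ true → isEven (a + b) ≡ isEven b
isEven-+ zero b h = refl
isEven-+ (suc (suc a)) b h = isEven-+ a b h

isOdd-+ : ∀ a b → isEven a ≡ false → isEven (a + b) ≡ not (isEven b)
isOdd-+ (suc zero) b h = not-isEven b
isOdd-+ (suc (suc a)) b h = isOdd-+ a b h

-- `closed` reads `u` at a single index, the number of odd parts, whose parity is that of the sum.
closed-parity : ∀ κ (u : ℕ → ℚ) λs → (∀ k → isEven k ≡ isEven (sum λs) → u k ≡ 0ℚ) → closed κ u λs ≡ 0ℚ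
closed-parity κ u [] e = e 0 refl
closed-parity κ u (ℓ ∷ λs) e with isEven ℓ in even
... | true = trans (cong (λ x → κ *ℚ (θ ℓ *ℚ x)) (closed-parity κ u λs (λ k h → e k (trans h (sym (isEven-+ ℓ (sum λs) even))))))
      (trans (cong (κ *ℚ_) (ℚₚ.*-zeroʳ (θ ℓ))) (ℚₚ.*-zeroʳ κ))
... | false = trans (cong (θ ℓ *ℚ_) (closed-parity κ (u ∘ suc) λs (λ k h → e (suc k)
        (trans (not-isEven k) (trans (cong not h) (sym (isOdd-+ ℓ (sum λs) even))))))) (ℚₚ.*-zeroʳ (θ ℓ))

C-2+ : ∀ n → C (suc (suc n)) ≡ -ℚ C n
C-2+ n = trans (C-suc (suc n)) (cong -ℚ_ (S-suc n))

S-2+ : ∀ n → S (suc (suc n)) ≡ -ℚ S n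
S-2+ n = trans (S-suc (suc n)) (C-suc n)

neg-θ : ∀ ℓ x → -ℚ (θ ℓ *ℚ x) ≡ θ (suc (suc ℓ)) *ℚ x
neg-θ ℓ x = trans (ℚₚ.neg-distribˡ-* (θ ℓ) x) (cong (_*ℚ x) (sym (θ-2+ ℓ)))

C-even+ : ∀ ℓ x → isEven ℓ ≡ true → C (ℓ + x) ≡ θ ℓ *ℚ C x
C-even+ zero x e = sym (ℚₚ.*-identityˡ (C x))
C-even+ (suc (suc ℓ)) x e = trans (C-2+ (ℓ + x)) (trans (cong -ℚ_ (C-even+ ℓ x e)) (neg-θ ℓ (C x)))

S-even+ : ∀ ℓ x → isEven ℓ ≡ true → S (ℓ + x) ≡ θ ℓ *ℚ S x
S-even+ zero x e = sym (ℚₚ.*-identityˡ (S x))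
S-even+ (suc (suc ℓ)) x e = trans (S-2+ (ℓ + x)) (trans (cong -ℚ_ (S-even+ ℓ x e)) (neg-θ ℓ (S x)))

C-odd+ : ∀ ℓ x → isEven ℓ ≡ false → C (ℓ + x) ≡ θ ℓ *ℚ -ℚ S x
C-odd+ (suc zero) x e = trans (C-suc x) (sym (ℚₚ.*-identityˡ (-ℚ S x)))
C-odd+ (suc (suc ℓ)) x e = trans (C-2+ (ℓ + x)) (trans (cong -ℚ_ (C-odd+ ℓ x e)) (neg-θ ℓ (-ℚ S x)))

S-odd+ : ∀ ℓ x → isEven ℓ ≡ false → S (ℓ + x) ≡ θ ℓ *ℚ C x
S-odd+ (suc zero) x e = trans (S-suc x) (sym (ℚₚ.*-identityˡ (C x)))
S-odd+ (suc (suc ℓ)) x e = trans (S-2+ (ℓ + x)) (trans (cong -ℚ_ (S-odd+ ℓ x e)) (neg-θ ℓ (C x)))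

closed-even : ∀ κ u ℓ λs → isEven ℓ ≡ true → closed κ u (ℓ ∷ λs) ≡ κ *ℚ (θ ℓ *ℚ closed κ u λs)
closed-even κ u ℓ λs e rewrite e = refl

closed-odd : ∀ κ u ℓ λs → isEven ℓ ≡ false → closed κ u (ℓ ∷ λs) ≡ θ ℓ *ℚ closed κ (u ∘ suc) λs
closed-odd κ u ℓ λs e rewrite e = refl

-- Splitting off a sublist of even (odd) sum multiplies by e^x cos y (by e^x sin y) in the
-- generating function where x marks even and y odd parts.
splitSum-C : ∀ κ u λs → splitSum λs (λ x Y → C x *ℚ closed κ u Y) ≡ closed (1ℚ +ℚ κ) (K₀ u) λs
splitSum-S : ∀ κ u λs → splitSum λs (λ x Y → S x *ℚ closed κ u Y) ≡ closed (1ℚ +ℚ κ) (K₁ u) λs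
splitSum-C κ u [] = ℚₚ.*-identityˡ (u 0)
splitSum-C κ u (ℓ ∷ λs) with isEven ℓ in e
... | true = begin
  splitSum λs (λ x Y → C (ℓ + x) *ℚ closed κ u Y) +ℚ splitSum λs (λ x Y → C x *ℚ (κ *ℚ (θ ℓ *ℚ closed κ u Y)))
    ≡⟨ cong₂ _+ℚ_
         (trans (splitSum-cong λs (λ x Y _ → trans (cong (_*ℚ closed κ u Y) (C-even+ ℓ x e)) (ℚₚ.*-assoc (θ ℓ) (C x) (closed κ u Y)))) (splitSum-*ˡ λs (θ ℓ) _))
         (trans (splitSum-cong λs (λ x Y _ → solve 4 (λ c k t y → c :* (k :* (t :* y)) := k :* t :* (c :* y)) refl (C x) κ (θ ℓ) (closed κ u Y))) (splitSum-*ˡ λs (κ *ℚ θ ℓ) _)) ⟩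
  θ ℓ *ℚ Z +ℚ κ *ℚ θ ℓ *ℚ Z
    ≡⟨ solve 3 (λ t k z → t :* z :+ k :* t :* z := (con 1ℚ :+ k) :* (t :* z)) refl (θ ℓ) κ Z ⟩
  (1ℚ +ℚ κ) *ℚ (θ ℓ *ℚ Z)
    ≡⟨ cong (λ z → (1ℚ +ℚ κ) *ℚ (θ ℓ *ℚ z)) (splitSum-C κ u λs) ⟩
  (1ℚ +ℚ κ) *ℚ (θ ℓ *ℚ closed (1ℚ +ℚ κ) (K₀ u) λs) ∎
  where
  open ≡-Reasoning
  Z = splitSum λs (λ x Y → C x *ℚ closed κ u Y)
... | false = begin
  splitSum λs (λ x Y → C (ℓ + x) *ℚ closed κ u Y) +ℚ splitSum λs (λ x Y → C x *ℚ (θ ℓ *ℚ closed κ (u ∘ suc) Y))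
    ≡⟨ cong₂ _+ℚ_
         (trans (splitSum-cong λs (λ x Y _ → trans (cong (_*ℚ closed κ u Y) (C-odd+ ℓ x e)) (solve 3 (λ t s y → t :* (:- s) :* y := (:- t) :* (s :* y)) refl (θ ℓ) (S x) (closed κ u Y)))) (splitSum-*ˡ λs (-ℚ θ ℓ) _))
         (trans (splitSum-cong λs (λ x Y _ → solve 3 (λ c t y → c :* (t :* y) := t :* (c :* y)) refl (C x) (θ ℓ) (closed κ (u ∘ suc) Y))) (splitSum-*ˡ λs (θ ℓ) _)) ⟩
  -ℚ θ ℓ *ℚ splitSum λs (λ x Y → S x *ℚ closed κ u Y) +ℚ θ ℓ *ℚ splitSum λs (λ x Y → C x *ℚ closed κ (u ∘ suc) Y)
    ≡⟨ cong₂ (λ a b → -ℚ θ ℓ *ℚ a +ℚ θ ℓ *ℚ b) (splitSum-S κ u λs) (splitSum-C κ (u ∘ suc) λs) ⟩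
  -ℚ θ ℓ *ℚ closed κ′ (K₁ u) λs +ℚ θ ℓ *ℚ closed κ′ (K₀ (u ∘ suc)) λs
    ≡⟨ solve 3 (λ t a b → (:- t) :* a :+ t :* b := t :* (con 1ℚ :* b :+ con (-ℚ 1ℚ) :* a)) refl (θ ℓ) (closed κ′ (K₁ u) λs) (closed κ′ (K₀ (u ∘ suc)) λs) ⟩
  θ ℓ *ℚ (1ℚ *ℚ closed κ′ (K₀ (u ∘ suc)) λs +ℚ -ℚ 1ℚ *ℚ closed κ′ (K₁ u) λs)
    ≡⟨ cong (θ ℓ *ℚ_) (trans (sym (closed-linear κ′ 1ℚ (-ℚ 1ℚ) (K₀ (u ∘ suc)) (K₁ u) λs))
         (closed-cong κ′ λs (λ k → solve 2 (λ a b → con 1ℚ :* a :+ con (-ℚ 1ℚ) :* b := a :- b) refl (K₀ (u ∘ suc) k) (K₁ u k)))) ⟩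
  θ ℓ *ℚ closed κ′ (K₀ u ∘ suc) λs ∎
  where
  open ≡-Reasoning
  κ′ = 1ℚ +ℚ κ
splitSum-S κ u [] = ℚₚ.*-zeroˡ (u 0)
splitSum-S κ u (ℓ ∷ λs) with isEven ℓ in e
... | true = begin
  splitSum λs (λ x Y → S (ℓ + x) *ℚ closed κ u Y) +ℚ splitSum λs (λ x Y → S x *ℚ (κ *ℚ (θ ℓ *ℚ closed κ u Y)))
    ≡⟨ cong₂ _+ℚ_
         (trans (splitSum-cong λs (λ x Y _ → trans (cong (_*ℚ closed κ u Y) (S-even+ ℓ x e)) (ℚₚ.*-assoc (θ ℓ) (S x) (closed κ u Y)))) (splitSum-*ˡ λs (θ ℓ) _))
         (trans (splitSum-cong λs (λ x Y _ → solve 4 (λ c k t y → c :* (k :* (t :* y)) := k :* t :* (c :* y)) refl (S x) κ (θ ℓ) (closed κ u Y))) (splitSum-*ˡ λs (κ *ℚ θ ℓ) _)) ⟩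
  θ ℓ *ℚ Z +ℚ κ *ℚ θ ℓ *ℚ Z
    ≡⟨ solve 3 (λ t k z → t :* z :+ k :* t :* z := (con 1ℚ :+ k) :* (t :* z)) refl (θ ℓ) κ Z ⟩
  (1ℚ +ℚ κ) *ℚ (θ ℓ *ℚ Z)
    ≡⟨ cong (λ z → (1ℚ +ℚ κ) *ℚ (θ ℓ *ℚ z)) (splitSum-S κ u λs) ⟩
  (1ℚ +ℚ κ) *ℚ (θ ℓ *ℚ closed (1ℚ +ℚ κ) (K₁ u) λs) ∎
  where
  open ≡-Reasoning
  Z = splitSum λs (λ x Y → S x *ℚ closed κ u Y)
... | false = begin
  splitSum λs (λ x Y → S (ℓ + x) *ℚ closed κ u Y) +ℚ splitSum λs (λ x Y → S x *ℚ (θ ℓ *ℚ closed κ (u ∘ suc) Y))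
    ≡⟨ cong₂ _+ℚ_
         (trans (splitSum-cong λs (λ x Y _ → trans (cong (_*ℚ closed κ u Y) (S-odd+ ℓ x e)) (ℚₚ.*-assoc (θ ℓ) (C x) (closed κ u Y)))) (splitSum-*ˡ λs (θ ℓ) _))
         (trans (splitSum-cong λs (λ x Y _ → solve 3 (λ c t y → c :* (t :* y) := t :* (c :* y)) refl (S x) (θ ℓ) (closed κ (u ∘ suc) Y))) (splitSum-*ˡ λs (θ ℓ) _)) ⟩
  θ ℓ *ℚ splitSum λs (λ x Y → C x *ℚ closed κ u Y) +ℚ θ ℓ *ℚ splitSum λs (λ x Y → S x *ℚ closed κ (u ∘ suc) Y)
    ≡⟨ cong₂ (λ a b → θ ℓ *ℚ a +ℚ θ ℓ *ℚ b) (splitSum-C κ u λs) (splitSum-S κ (u ∘ suc) λs) ⟩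
  θ ℓ *ℚ closed κ′ (K₀ u) λs +ℚ θ ℓ *ℚ closed κ′ (K₁ (u ∘ suc)) λs
    ≡⟨ solve 3 (λ t a b → t :* a :+ t :* b := t :* (con 1ℚ :* b :+ con 1ℚ :* a)) refl (θ ℓ) (closed κ′ (K₀ u) λs) (closed κ′ (K₁ (u ∘ suc)) λs) ⟩
  θ ℓ *ℚ (1ℚ *ℚ closed κ′ (K₁ (u ∘ suc)) λs +ℚ 1ℚ *ℚ closed κ′ (K₀ u) λs)
    ≡⟨ cong (θ ℓ *ℚ_) (trans (sym (closed-linear κ′ 1ℚ 1ℚ (K₁ (u ∘ suc)) (K₀ u) λs))
         (closed-cong κ′ λs (λ k → solve 2 (λ a b → con 1ℚ :* a :+ con 1ℚ :* b := a :+ b) refl (K₁ (u ∘ suc) k) (K₀ u k)))) ⟩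
  θ ℓ *ℚ closed κ′ (K₁ u ∘ suc) λs ∎
  where
  open ≡-Reasoning
  κ′ = 1ℚ +ℚ κ

-- These are the addition theorems of cos and sin: a part acts on `C` and `S` by signs, and an odd
-- part also exchanges the two.
closed-1-C : ∀ λs → closed 1ℚ C λs ≡ C (sum λs)
closed-1-S : ∀ λs → closed 1ℚ S λs ≡ S (sum λs)
closed-1-C [] = refl
closed-1-C (ℓ ∷ λs) with isEven ℓ in e
... | true = trans (ℚₚ.*-identityˡ _) (trans (cong (θ ℓ *ℚ_) (closed-1-C λs)) (sym (C-even+ ℓ (sum λs) e)))
... | false = trans (cong (θ ℓ *ℚ_) (trans (closed-cong 1ℚ λs (λ k → trans (C-suc k) (solve 1 (λ s → :- s := con (-ℚ 1ℚ) :* s :+ con 0ℚ :* s) refl (S k))))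
        (trans (closed-linear 1ℚ (-ℚ 1ℚ) 0ℚ S S λs) (trans (solve 1 (λ s → con (-ℚ 1ℚ) :* s :+ con 0ℚ :* s := :- s) refl (closed 1ℚ S λs)) (cong -ℚ_ (closed-1-S λs))))))
        (sym (C-odd+ ℓ (sum λs) e))
closed-1-S [] = refl
closed-1-S (ℓ ∷ λs) with isEven ℓ in e
... | true = trans (ℚₚ.*-identityˡ _) (trans (cong (θ ℓ *ℚ_) (closed-1-S λs)) (sym (S-even+ ℓ (sum λs) e)))
... | false = trans (cong (θ ℓ *ℚ_) (trans (closed-cong 1ℚ λs S-suc) (closed-1-C λs))) (sym (S-odd+ ℓ (sum λs) e))

-- An even part brings the factor zero, and an odd part shifts `δ₀` to the zero sequence.
closed-0-δ₀ : ∀ λs → closed 0ℚ δ₀ λs ≡ Q.ind (nil? λs)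
closed-0-δ₀ [] = refl
closed-0-δ₀ (ℓ ∷ λs) with isEven ℓ
... | true = ℚₚ.*-zeroˡ (θ ℓ *ℚ closed 0ℚ δ₀ λs)
... | false = trans (cong (θ ℓ *ℚ_) (closed-parity 0ℚ (λ _ → 0ℚ) λs (λ _ _ → refl))) (ℚₚ.*-zeroʳ (θ ℓ))

-- Signed weights of letter contents

-- The flag is membership of the current position in `S`, which alternates along the permutation. A
-- position of `S` left out of `T` has the sign -1 of inclusion-exclusion.
stay : Bool → ℚ
stay true = -ℚ 1ℚ
stay false = 1ℚ

run : Bool → ℕ → ℚ
run σ zero = 1ℚ
run σ (suc a) = stay σ *ℚ run (not σ) a

flip : Bool → ℕ → Bool
flip σ zero = σ
flip σ (suc a) = flip (not σ) a

isZero : ∀ {q} → Vec ℕ q → ℚ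
isZero {q} α = Q.ind (Vecₚ.≡-dec ℕ._≟_ α (zeros q))

-- The signed count of descent sets T ⊆ S whose block sizes are the content α; the flag
-- tells whether the position before the first block belongs to S.
start : ∀ {q} → Bool → Vec ℕ q → ℚ
start σ [] = 1ℚ
start σ (zero ∷ α) = isZero α
start σ (suc a ∷ α) = run (not σ) a *ℚ (if flip (not σ) a then start true α else isZero α)

run-false : ∀ a → run false a ≡ θ a
run-true : ∀ a → run true a ≡ θ (suc a)
run-false zero = refl
run-false (suc a) = trans (ℚₚ.*-identityˡ (run true a)) (run-true a)
run-true zero = refl
run-true (suc a) = trans (cong (-ℚ 1ℚ *ℚ_) (run-false a)) (trans (solve 1 (λ t → con (-ℚ 1ℚ) :* t := :- t) refl (θ a)) (sym (θ-2+ a)))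

flip-true : ∀ a → flip true a ≡ isEven a
flip-false : ∀ a → flip false a ≡ not (isEven a)
flip-true zero = refl
flip-true (suc a) = trans (flip-false a) (sym (not-isEven a))
flip-false zero = refl
flip-false (suc a) = trans (flip-true a) (trans (sym (not-involutive (isEven a))) (cong not (sym (not-isEven a))))

bump-nonzero : ∀ {q} (a : Fin q) ℓ α → 0 < ℓ → bump a ℓ α ≢ zeros q
bump-nonzero zero (suc ℓ) (x ∷ α) 0<ℓ ()
bump-nonzero (suc a) ℓ (x ∷ α) 0<ℓ e = bump-nonzero a ℓ α 0<ℓ (Vecₚ.∷-injectiveʳ e)

letterSum-isZero : ∀ q λs → Positive λs → letterSum q λs isZero ≡ Q.ind (nil? λs)
letterSum-isZero q [] pos = Q.ind-yes (Vecₚ.≡-dec ℕ._≟_ (zeros q) (zeros q)) refl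
letterSum-isZero q (ℓ ∷ λs) (p Allₚ.∷ pos) = Q.∑-zero (allFin q) (λ a → trans
  (letterSum-cong q λs (λ α → Q.ind-no (Vecₚ.≡-dec ℕ._≟_ (bump a ℓ α) (zeros q)) (bump-nonzero a ℓ α p))) (letterSum-zero q λs))

-- The base `κ` of Foulkes' value. In odd size a single even part makes the value zero; in even size
-- each even part contributes a sign, and the choice of this sign distinguishes the two kinds of
-- alternation.
signature : Bool → ℕ → ℚ
signature σ n = if isEven n then (if σ then -ℚ 1ℚ else 1ℚ) else 0ℚ

signature-cong : ∀ σ a b → isEven a ≡ isEven b → signature σ a ≡ signature σ b
signature-cong σ a b e rewrite e = refl

block : ∀ q σ a Y → letterSum q Y (λ α → start σ (suc a ∷ α)) ≡
  run (not σ) a *ℚ (if flip (not σ) a then letterSum q Y (start true) else letterSum q Y isZero)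
block q σ a Y = trans (letterSum-*ˡ q Y (run (not σ) a) _) (cong (run (not σ) a *ℚ_) (go (flip (not σ) a)))
  where
  go : ∀ b → letterSum q Y (λ α → if b then start true α else isZero α) ≡ (if b then letterSum q Y (start true) else letterSum q Y isZero)
  go true = refl
  go false = refl

-- Induction on the number of letters. By hypothesis every splitting that gives something to the
-- first letter contributes `φ′`. The sum of `φ′` over all splittings is known, and its term for the
-- empty sublist is minus the value sought; exchanging that term for the true one, the indicator of
-- the empty list, leaves the value itself.
foulkes-true : ∀ q λs → Positive λs → length λs ≤ q →
  letterSum q λs (start true) ≡ closed (signature true (sum λs)) euler λs
foulkes-true zero [] pos le = refl
foulkes-true (suc q) λs pos le = begin
  letterSum (suc q) λs (start true)
    ≡⟨ letterSum-suc q λs (start true) ⟩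
  splitSum λs φ
    ≡⟨ splitSum-cong λs (λ x Y _ → solve 2 (λ a b → a := b :+ (a :- b)) refl (φ x Y) (φ′ x Y)) ⟩
  splitSum λs (λ x Y → φ′ x Y +ℚ (φ x Y -ℚ φ′ x Y))
    ≡⟨ splitSum-+ λs φ′ (λ x Y → φ x Y -ℚ φ′ x Y) ⟩
  splitSum λs φ′ +ℚ splitSum λs (λ x Y → φ x Y -ℚ φ′ x Y)
    ≡⟨ cong (splitSum λs φ′ +ℚ_) (splitSum-trivial λs _ pos (λ x Y s 0<x → trans (cong (_-ℚ φ′ x Y) (agree x Y s 0<x)) (ℚₚ.+-inverseʳ (φ′ x Y)))) ⟩
  splitSum λs φ′ +ℚ (φ 0 λs -ℚ φ′ 0 λs)
    ≡⟨ cong₂ (λ a b → a +ℚ (b -ℚ φ′ 0 λs)) total (letterSum-isZero q λs pos) ⟩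
  (-ℚ 1ℚ *ℚ closed (1ℚ +ℚ κ) (K₀ euler) λs +ℚ S n) +ℚ (ι -ℚ (-ℚ 1ℚ *ℚ (1ℚ *ℚ X) +ℚ 0ℚ *ℚ ι))
    ≡⟨ cong (λ z → (-ℚ 1ℚ *ℚ z +ℚ S n) +ℚ (ι -ℚ (-ℚ 1ℚ *ℚ (1ℚ *ℚ X) +ℚ 0ℚ *ℚ ι))) (key (isEven n) refl) ⟩
  (-ℚ 1ℚ *ℚ (S n +ℚ ι) +ℚ S n) +ℚ (ι -ℚ (-ℚ 1ℚ *ℚ (1ℚ *ℚ X) +ℚ 0ℚ *ℚ ι))
    ≡⟨ solve 3 (λ s i x → (con (-ℚ 1ℚ) :* (s :+ i) :+ s) :+ (i :- (con (-ℚ 1ℚ) :* (con 1ℚ :* x) :+ con 0ℚ :* i)) := x) refl (S n) ι X ⟩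
  X ∎
  where
  open ≡-Reasoning
  n = sum λs
  κ = signature true n
  ι = Q.ind (nil? λs)
  X = closed κ euler λs
  φ φ′ : ℕ → List ℕ → ℚ
  φ x Y = letterSum q Y (λ α → start true (x ∷ α))
  φ′ x Y = -ℚ 1ℚ *ℚ (C x *ℚ closed κ euler Y) +ℚ S x *ℚ Q.ind (nil? Y)
  agree : ∀ x Y → Split λs x Y → 0 < x → φ x Y ≡ φ′ x Y
  agree (suc a) Y s 0<x = trans (block q true a Y) (trans
    (cong₂ (λ ρ f → ρ *ℚ (if f then letterSum q Y (start true) else letterSum q Y isZero)) (run-false a) (flip-false a))
    (go (isEven a) refl))
    where
    go : ∀ b → isEven a ≡ b → θ a *ℚ (if not (isEven a) then letterSum q Y (start true) else letterSum q Y isZero) ≡ φ′ (suc a) Y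
    -- A first block of odd size ends at a position outside `S`, so no block may follow it.
    go true e rewrite not-isEven a | θ-suc a | e = trans (cong (θ a *ℚ_) (letterSum-isZero q Y (split-positive s pos)))
      (solve 3 (λ t i y → t :* i := con (-ℚ 1ℚ) :* (con 0ℚ :* y) :+ t :* i) refl (θ a) (Q.ind (nil? Y)) (closed κ euler Y))
    go false e rewrite not-isEven a | θ-suc a | e = trans (cong (θ a *ℚ_) (trans
        (foulkes-true q Y (split-positive s pos) (ℕ.s≤s⁻¹ (ℕₚ.<-≤-trans (split-length-< s 0<x) le)))
        (cong (λ k → closed k euler Y) (signature-cong true (sum Y) n (trans (sym (isEven-+ (suc a) (sum Y) (trans (not-isEven a) (cong not e)))) (cong isEven (split-sum s)))))))
      (solve 3 (λ t i y → t :* y := con (-ℚ 1ℚ) :* ((:- t) :* y) :+ con 0ℚ :* i) refl (θ a) (Q.ind (nil? Y)) (closed κ euler Y))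
  total : splitSum λs φ′ ≡ -ℚ 1ℚ *ℚ closed (1ℚ +ℚ κ) (K₀ euler) λs +ℚ S n
  total = trans (splitSum-+ λs _ _) (cong₂ _+ℚ_ (trans (splitSum-*ˡ λs (-ℚ 1ℚ) _) (cong (-ℚ 1ℚ *ℚ_) (splitSum-C κ euler λs))) (splitSum-all λs S))
  expand : ∀ k → closed k (K₀ euler) λs ≡ closed k δ₀ λs +ℚ closed k S λs
  expand k = trans (closed-cong k λs (λ o → trans (K₀-euler o) (cong₂ _+ℚ_ (sym (ℚₚ.*-identityˡ (δ₀ o))) (sym (ℚₚ.*-identityˡ (S o))))))
    (trans (closed-linear k 1ℚ 1ℚ δ₀ S λs) (cong₂ _+ℚ_ (ℚₚ.*-identityˡ (closed k δ₀ λs)) (ℚₚ.*-identityˡ (closed k S λs))))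
  -- In even size `1 + κ` is 0: the term of `δ₀` survives for the empty list only, and that of `S`
  -- vanishes by parity. In odd size `1 + κ` is 1: the term of `δ₀` vanishes by parity, and the
  -- addition theorem gives `S n`.
  key : ∀ b → isEven n ≡ b → closed (1ℚ +ℚ κ) (K₀ euler) λs ≡ S n +ℚ ι
  key true e = trans (cong (λ k → closed (1ℚ +ℚ (if k then -ℚ 1ℚ else 0ℚ)) (K₀ euler) λs) e) (trans (expand 0ℚ)
    (trans (cong₂ _+ℚ_ (closed-0-δ₀ λs) (trans (closed-parity 0ℚ S λs (λ k h → S-even k (trans h e))) (sym (S-even n e)))) (ℚₚ.+-comm ι (S n))))
  key false e = trans (cong (λ k → closed (1ℚ +ℚ (if k then -ℚ 1ℚ else 0ℚ)) (K₀ euler) λs) e) (trans (expand 1ℚ)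
    (trans (cong₂ _+ℚ_ (trans (closed-parity 1ℚ δ₀ λs (λ k h → δ₀-odd k (trans h e))) (sym ι≡0)) (closed-1-S λs)) (ℚₚ.+-comm ι (S n))))
    where
    δ₀-odd : ∀ k → isEven k ≡ false → δ₀ k ≡ 0ℚ
    δ₀-odd (suc k) h = refl
    ι≡0 : ι ≡ 0ℚ
    ι≡0 = Q.ind-no (nil? λs) (λ { refl → case-absurd e })
      where
      case-absurd : true ≡ false → ⊥
      case-absurd ()

-- Every block after the first is preceded by a position of `S`, so the remaining blocks fall under
-- `foulkes-true`. Something can follow only a first block of odd size; the remaining parts then
-- have a sum of the parity of `n + 1`, which explains `κ′`.
foulkes-false : ∀ q λs → Positive λs → length λs ≤ q →
  letterSum q λs (start false) ≡ closed (signature false (sum λs)) euler λs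
foulkes-false zero [] pos le = refl
foulkes-false (suc q) λs pos le = begin
  letterSum (suc q) λs (start false)
    ≡⟨ letterSum-suc q λs (start false) ⟩
  splitSum λs (λ x Y → letterSum q Y (λ α → start false (x ∷ α)))
    ≡⟨ splitSum-cong λs agree ⟩
  splitSum λs (λ x Y → S x *ℚ closed κ′ euler Y +ℚ C x *ℚ Q.ind (nil? Y))
    ≡⟨ trans (splitSum-+ λs _ _) (cong₂ _+ℚ_ (splitSum-S κ′ euler λs) (splitSum-all λs C)) ⟩
  closed (1ℚ +ℚ κ′) (K₁ euler) λs +ℚ C n
    ≡⟨ cong (_+ℚ C n) (trans (closed-cong (1ℚ +ℚ κ′) λs (λ o → trans (K₁-euler o) (solve 2 (λ a b → a :- b := con 1ℚ :* a :+ con (-ℚ 1ℚ) :* b) refl (euler o) (C o))))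
         (closed-linear (1ℚ +ℚ κ′) 1ℚ (-ℚ 1ℚ) euler C λs)) ⟩
  (1ℚ *ℚ closed (1ℚ +ℚ κ′) euler λs +ℚ -ℚ 1ℚ *ℚ closed (1ℚ +ℚ κ′) C λs) +ℚ C n
    ≡⟨ key (isEven n) refl ⟩
  closed (signature false n) euler λs ∎
  where
  open ≡-Reasoning
  n = sum λs
  κ′ = signature true (suc n)
  agree : ∀ x Y → Split λs x Y → letterSum q Y (λ α → start false (x ∷ α)) ≡ S x *ℚ closed κ′ euler Y +ℚ C x *ℚ Q.ind (nil? Y)
  agree zero Y s = trans (letterSum-isZero q Y (split-positive s pos)) (solve 2 (λ i y → i := con 0ℚ :* y :+ con 1ℚ :* i) refl (Q.ind (nil? Y)) (closed κ′ euler Y))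
  agree (suc a) Y s = trans (block q false a Y) (trans
    (cong₂ (λ ρ f → ρ *ℚ (if f then letterSum q Y (start true) else letterSum q Y isZero)) (run-true a) (flip-true a))
    (go (isEven a) refl))
    where
    go : ∀ b → isEven a ≡ b → θ (suc a) *ℚ (if isEven a then letterSum q Y (start true) else letterSum q Y isZero) ≡ S (suc a) *ℚ closed κ′ euler Y +ℚ C (suc a) *ℚ Q.ind (nil? Y)
    go true e rewrite not-isEven a | e = trans (cong (θ (suc a) *ℚ_) (trans
        (foulkes-true q Y (split-positive s pos) (ℕ.s≤s⁻¹ (ℕₚ.<-≤-trans (split-length-< s (s≤s z≤n)) le)))
        (cong (λ k → closed k euler Y) (signature-cong true (sum Y) (suc n) (sym (trans (not-isEven n) (trans (cong not (trans (cong isEven (sym (split-sum s))) (isOdd-+ (suc a) (sum Y) (trans (not-isEven a) (cong not e))))) (not-involutive (isEven (sum Y))))))))))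
      (solve 3 (λ t i y → t :* y := t :* y :+ con 0ℚ :* i) refl (θ (suc a)) (Q.ind (nil? Y)) (closed κ′ euler Y))
    go false e rewrite not-isEven a | e = trans (cong (θ (suc a) *ℚ_) (letterSum-isZero q Y (split-positive s pos)))
      (solve 3 (λ t i y → t :* i := con 0ℚ :* y :+ t :* i) refl (θ (suc a)) (Q.ind (nil? Y)) (closed κ′ euler Y))
  key : ∀ b → isEven n ≡ b → (1ℚ *ℚ closed (1ℚ +ℚ κ′) euler λs +ℚ -ℚ 1ℚ *ℚ closed (1ℚ +ℚ κ′) C λs) +ℚ C n ≡ closed (signature false n) euler λs
  key true e rewrite not-isEven n | e | closed-1-C λs = trans
    (cong (λ c → (1ℚ *ℚ closed 1ℚ euler λs +ℚ -ℚ 1ℚ *ℚ c) +ℚ θ n) (C-even n e))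
    (solve 2 (λ x c → (con 1ℚ :* x :+ con (-ℚ 1ℚ) :* c) :+ c := x) refl (closed 1ℚ euler λs) (θ n))
  key false e rewrite not-isEven n | e = trans
    (cong (λ c → (1ℚ *ℚ closed 0ℚ euler λs +ℚ -ℚ 1ℚ *ℚ c) +ℚ 0ℚ) (closed-parity 0ℚ C λs (λ k h → C-odd k (trans h e))))
    (solve 1 (λ x → (con 1ℚ :* x :+ con (-ℚ 1ℚ) :* con 0ℚ) :+ con 0ℚ := x) refl (closed 0ℚ euler λs))

foulkes : ∀ σ q λs → Positive λs → length λs ≤ q →
  letterSum q λs (start σ) ≡ closed (signature σ (sum λs)) euler λs
foulkes true = foulkes-true
foulkes false = foulkes-false

-- Inclusion-exclusion over descent sets

boolInd : Bool → ℚ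
boolInd true = 1ℚ
boolInd false = 0ℚ

boolInd-∧ : ∀ x y → boolInd (x ∧ y) ≡ boolInd x *ℚ boolInd y
boolInd-∧ true y = sym (ℚₚ.*-identityˡ (boolInd y))
boolInd-∧ false y = sym (ℚₚ.*-zeroˡ (boolInd y))

boolInd≡ind : {P : Set} (x : Bool) (d : Dec P) → (x ≡ true → P) → (P → x ≡ true) → boolInd x ≡ Q.ind d
boolInd≡ind true d f g = sym (Q.ind-yes d (f refl))
boolInd≡ind false d f g = sym (Q.ind-no d (λ p → false≢true (g p)))
  where
  false≢true : false ≢ true
  false≢true ()

brk : Bool → ℚ
brk true = 1ℚ
brk false = 0ℚ

-- Only moves to the same or to the next letter have weight: a skipped letter would be an empty
-- block in front of a nonempty one.
step : Bool → ℕ → ℕ → ℚ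
step σ c d = Q.ind (d ℕ.≟ c) *ℚ stay σ +ℚ Q.ind (d ℕ.≟ suc c) *ℚ brk σ

step-stay : ∀ σ c → step σ c c ≡ stay σ
step-stay σ c = trans (cong₂ (λ x y → x *ℚ stay σ +ℚ y *ℚ brk σ) (Q.ind-yes (c ℕ.≟ c) refl) (Q.ind-no (c ℕ.≟ suc c) (ℕₚ.1+n≢n ∘ sym)))
  (solve 2 (λ a b → con 1ℚ :* a :+ con 0ℚ :* b := a) refl (stay σ) (brk σ))

step-brk : ∀ σ c → step σ c (suc c) ≡ brk σ
step-brk σ c = trans (cong₂ (λ x y → x *ℚ stay σ +ℚ y *ℚ brk σ) (Q.ind-no (suc c ℕ.≟ c) ℕₚ.1+n≢n) (Q.ind-yes (suc c ℕ.≟ suc c) refl))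
  (solve 2 (λ a b → con 0ℚ :* a :+ con 1ℚ :* b := b) refl (stay σ) (brk σ))

step-none : ∀ σ c d → d ≢ c → d ≢ suc c → step σ c d ≡ 0ℚ
step-none σ c d n₁ n₂ = trans (cong₂ (λ x y → x *ℚ stay σ +ℚ y *ℚ brk σ) (Q.ind-no (d ℕ.≟ c) n₁) (Q.ind-no (d ℕ.≟ suc c) n₂))
  (solve 2 (λ a b → con 0ℚ :* a :+ con 0ℚ :* b := con 0ℚ) refl (stay σ) (brk σ))

scan : ∀ {q k} → Bool → ℕ → Vec (Fin q) k → ℚ
scan σ c [] = 1ℚ
scan σ c (d ∷ f) = step σ c (toℕ d) *ℚ scan (not σ) (toℕ d) f

cnt : ∀ {q k} → ℕ → Vec (Fin q) k → ℕ
cnt c [] = 0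
cnt c (d ∷ f) = N.ind (toℕ d ℕ.≟ c) + cnt c f

cnts : ∀ {q k} → ℕ → (t : ℕ) → Vec (Fin q) k → Vec ℕ t
cnts c zero f = []
cnts c (suc t) f = cnt c f ∷ cnts (suc c) t f

Rising : ∀ {q k} → ℕ → Vec (Fin q) k → Set
Rising c [] = ⊤
Rising c (d ∷ f) = c ≤ toℕ d × Rising (toℕ d) f

cnt-below : ∀ {q k} c e (f : Vec (Fin q) k) → Rising e f → c < e → cnt c f ≡ 0
cnt-below c e [] r lt = refl
cnt-below c e (d ∷ f) (e≤d , r) lt = cong₂ _+_ (N.ind-no (toℕ d ℕ.≟ c) (λ { refl → ℕₚ.<⇒≱ lt e≤d }))
  (cnt-below c (toℕ d) f r (ℕₚ.<-≤-trans lt e≤d))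

cnts-skip : ∀ {q k} c t (d : Fin q) (f : Vec (Fin q) k) → toℕ d < c → cnts c t (d ∷ f) ≡ cnts c t f
cnts-skip c zero d f lt = refl
cnts-skip c (suc t) d f lt = cong₂ _∷_ (cong (_+ cnt c f) (N.ind-no (toℕ d ℕ.≟ c) (ℕₚ.<⇒≢ lt))) (cnts-skip (suc c) t d f (ℕₚ.m≤n⇒m≤1+n lt))

cnts-nil : ∀ {q} c t → cnts {q} c t [] ≡ zeros t
cnts-nil c zero = refl
cnts-nil c (suc t) = cong (0 ∷_) (cnts-nil (suc c) t)

isZero-zeros : ∀ t → isZero (zeros t) ≡ 1ℚ
isZero-zeros t = Q.ind-yes (Vecₚ.≡-dec ℕ._≟_ (zeros t) (zeros t)) refl

start-zeros : ∀ σ t → start σ (zeros t) ≡ 1ℚ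
start-zeros σ zero = refl
start-zeros σ (suc t) = isZero-zeros t

isZero-cnts : ∀ {q k} c t (d : Fin q) (f : Vec (Fin q) k) → c ≤ toℕ d → toℕ d < c + t → isZero (cnts c t (d ∷ f)) ≡ 0ℚ
isZero-cnts c t d f c≤d d< = Q.ind-no (Vecₚ.≡-dec ℕ._≟_ (cnts c t (d ∷ f)) (zeros t)) (nonzero c t c≤d d<)
  where
  nonzero : ∀ c t → c ≤ toℕ d → toℕ d < c + t → cnts c t (d ∷ f) ≢ zeros t
  nonzero c zero c≤d d< e = ℕₚ.<⇒≱ d< (ℕₚ.≤-trans (ℕₚ.≤-reflexive (ℕₚ.+-identityʳ c)) c≤d)
  nonzero c (suc t) c≤d d< e with ℕₚ.m≤n⇒m<n∨m≡n c≤d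
  ... | inj₁ c<d = nonzero (suc c) t c<d (ℕₚ.<-≤-trans d< (ℕₚ.≤-reflexive (ℕₚ.+-suc c t))) (Vecₚ.∷-injectiveʳ e)
  ... | inj₂ refl = ℕₚ.1+n≢0 (trans (cong (_+ cnt c f) (sym (N.ind-yes (toℕ d ℕ.≟ toℕ d) refl))) (Vecₚ.∷-injectiveˡ e))

inBlock : ∀ {t} → Bool → Vec ℕ (suc t) → ℚ
inBlock σ (a ∷ α) = run σ a *ℚ (if flip σ a then start true α else isZero α)

-- The weight is read position by position on the left and from the letter multiplicities on the
-- right. The bound on `q` makes the multiplicities from `c` onwards cover all remaining letters; a
-- skipped letter, or a break outside `S`, makes both sides zero.
scan≡inBlock : ∀ {q k} σ c t (f : Vec (Fin q) k) → Rising c f → q ≤ c + suc t → scan σ c f ≡ inBlock σ (cnts c (suc t) f)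
scan≡inBlock σ c t [] r q≤ = sym (trans (cong (λ α → 1ℚ *ℚ (if σ then start true α else isZero α)) (cnts-nil (suc c) t)) (go σ))
  where
  go : ∀ σ → 1ℚ *ℚ (if σ then start true (zeros t) else isZero (zeros t)) ≡ 1ℚ
  go true = cong (1ℚ *ℚ_) (start-zeros true t)
  go false = cong (1ℚ *ℚ_) (isZero-zeros t)
scan≡inBlock {q} σ c t (d ∷ f) (c≤d , r) q≤ with ℕₚ.m≤n⇒m<n∨m≡n c≤d
... | inj₂ refl = begin
  step σ c c *ℚ scan (not σ) c f
    ≡⟨ cong₂ _*ℚ_ (step-stay σ c) (scan≡inBlock (not σ) c t f r q≤) ⟩
  stay σ *ℚ (run (not σ) a *ℚ z)
    ≡⟨ ℚₚ.*-assoc (stay σ) (run (not σ) a) z ⟨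
  inBlock σ (suc a ∷ cnts (suc c) t f)
    ≡⟨ cong (inBlock σ) (cong₂ _∷_ (cong (_+ a) (sym (N.ind-yes (c ℕ.≟ c) refl))) (sym (cnts-skip (suc c) t d f ℕₚ.≤-refl))) ⟩
  inBlock σ (cnts c (suc t) (d ∷ f)) ∎
  where
  open ≡-Reasoning
  a = cnt c f
  z = if flip (not σ) a then start true (cnts (suc c) t f) else isZero (cnts (suc c) t f)
... | inj₁ c<d = trans (jump σ t q≤) (cong (λ a → inBlock σ (a ∷ cnts (suc c) t (d ∷ f))) (sym (cnt-below c (toℕ d) (d ∷ f) (ℕₚ.≤-refl , r) c<d)))
  where
  vanish : ∀ σ x → toℕ d ≢ suc c → step σ c (toℕ d) *ℚ x ≡ 0ℚ
  vanish σ x d≢ = trans (cong (_*ℚ x) (step-none σ c (toℕ d) (ℕₚ.<⇒≢ c<d ∘ sym) d≢)) (ℚₚ.*-zeroˡ x)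
  jump : ∀ σ t → q ≤ c + suc t → scan σ c (d ∷ f) ≡ inBlock σ (0 ∷ cnts (suc c) t (d ∷ f))
  jump false t q≤ = trans (none (toℕ d ℕ.≟ suc c)) (sym (trans (ℚₚ.*-identityˡ _) (isZero-cnts (suc c) t d f c<d
      (ℕₚ.<-≤-trans (Finₚ.toℕ<n d) (ℕₚ.≤-trans q≤ (ℕₚ.≤-reflexive (ℕₚ.+-suc c t)))))))
    where
    none : Dec (toℕ d ≡ suc c) → scan false c (d ∷ f) ≡ 0ℚ
    none (no d≢) = vanish false _ d≢
    none (yes e) = trans (cong (λ x → step false c x *ℚ scan true (toℕ d) f) e) (trans (cong (_*ℚ scan true (toℕ d) f) (step-brk false c)) (ℚₚ.*-zeroˡ (scan true (toℕ d) f)))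
  jump true zero q≤ = ⊥-elim (ℕₚ.<⇒≱ c<d (ℕ.s≤s⁻¹ (ℕₚ.<-≤-trans (Finₚ.toℕ<n d) (ℕₚ.≤-trans q≤ (ℕₚ.≤-reflexive (ℕₚ.+-comm c 1))))))
  jump true (suc t) q≤ = trans (next (toℕ d ℕ.≟ suc c)) (sym (ℚₚ.*-identityˡ _))
    where
    q≤′ : q ≤ suc c + suc t
    q≤′ = ℕₚ.≤-trans q≤ (ℕₚ.≤-reflexive (ℕₚ.+-suc c (suc t)))
    next : Dec (toℕ d ≡ suc c) → scan true c (d ∷ f) ≡ start true (cnts (suc c) (suc t) (d ∷ f))
    next (no d≢) = trans (vanish true _ d≢) (sym (trans
      (cong (λ a → start true (a ∷ cnts (suc (suc c)) t (d ∷ f))) (cnt-below (suc c) (toℕ d) (d ∷ f) (ℕₚ.≤-refl , r) c+1<d))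
      (isZero-cnts (suc (suc c)) t d f c+1<d (ℕₚ.<-≤-trans (Finₚ.toℕ<n d) (ℕₚ.≤-trans q≤′ (ℕₚ.≤-reflexive (cong suc (ℕₚ.+-suc c t))))))))
      where
      c+1<d : suc c < toℕ d
      c+1<d = ℕₚ.≤∧≢⇒< c<d (d≢ ∘ sym)
    next (yes e) = trans (cong (_*ℚ scan false (toℕ d) f) (trans (cong (step true c) e) (step-brk true c))) (trans (ℚₚ.*-identityˡ _)
      (trans (cong (λ x → scan false x f) e) (trans (scan≡inBlock false (suc c) t f (subst (λ x → Rising x f) e r) q≤′)
      (cong (start true) (cong₂ _∷_ (cong (_+ cnt (suc c) f) (sym (N.ind-yes (toℕ d ℕ.≟ suc c) e)))
        (sym (cnts-skip (suc (suc c)) t d f (ℕₚ.≤-reflexive (cong suc e)))))))))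

start-scan : ∀ {t k} σ (d : Fin (suc t)) (f : Vec (Fin (suc t)) k) → Rising (toℕ d) f →
  start σ (cnts 0 (suc t) (d ∷ f)) ≡ Q.ind (d ≟ᶠ zero) *ℚ scan (not σ) (toℕ d) f
start-scan {t} σ zero f r = trans (cong (λ α → inBlock (not σ) (cnt 0 f ∷ α)) (cnts-skip 1 t zero f ℕₚ.≤-refl))
  (trans (sym (scan≡inBlock (not σ) 0 t f r ℕₚ.≤-refl)) (sym (ℚₚ.*-identityˡ _)))
start-scan {t} σ (suc d) f r = trans (cong (λ a → start σ (a ∷ cnts 1 t (suc d ∷ f))) (cnt-below 0 (suc (toℕ d)) f r (s≤s z≤n)))
  (trans (isZero-cnts 1 t (suc d) f (s≤s z≤n) (s≤s (Finₚ.toℕ<n d))) (sym (ℚₚ.*-zeroˡ (scan (not σ) (suc (toℕ d)) f))))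

content≡cnts : ∀ {q k} (f : Vec (Fin q) k) → content (lookup f) ≡ cnts 0 q f
content≡cnts {q} f = vec-ext (λ a → trans (Vecₚ.lookup∘tabulate _ a) (trans (count≡cnt f a) (sym (lookup-cnts 0 q a))))
  where
  count≡cnt : ∀ {k} (f : Vec (Fin q) k) a → count (λ i → lookup f i ≟ᶠ a) ≡ cnt (toℕ a) f
  count≡cnt [] a = refl
  count≡cnt {suc k} (d ∷ f) a = trans (N.∑-allFin-suc k (λ i → N.ind (lookup (d ∷ f) i ≟ᶠ a))) (cong₂ _+_
    (N.ind-⇔ (d ≟ᶠ a) (toℕ d ℕ.≟ toℕ a) (cong toℕ) Finₚ.toℕ-injective) (count≡cnt f a))
  lookup-cnts : ∀ c t (a : Fin t) → lookup (cnts c t f) a ≡ cnt (c + toℕ a) f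
  lookup-cnts c (suc t) zero = cong (λ x → cnt x f) (sym (ℕₚ.+-identityʳ c))
  lookup-cnts c (suc t) (suc a) = trans (lookup-cnts (suc c) t a) (cong (λ x → cnt x f) (sym (ℕₚ.+-suc c (toℕ a))))

Link : ∀ {q} → Fin q → ℕ → Fin q → ℕ → Set
Link c x d y = toℕ c < toℕ d ⊎ (c ≡ d × x < y)

link? : ∀ {q} (c : Fin q) x d y → Dec (Link c x d y)
link? c x d y = (toℕ c ℕ.<? toℕ d) ⊎-dec ((c ≟ᶠ d) ×-dec (x ℕ.<? y))

Linked : ∀ {q k} → Fin q → ℕ → Vec (Fin q) k → Vec ℕ k → Set
Linked c x [] [] = ⊤
Linked c x (d ∷ f) (y ∷ v) = Link c x d y × Linked d y f v

linked? : ∀ {q k} (c : Fin q) x (f : Vec (Fin q) k) v → Dec (Linked c x f v)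
linked? c x [] [] = yes tt
linked? c x (d ∷ f) (y ∷ v) = link? c x d y ×-dec linked? d y f v

linked⇒rising : ∀ {q k} (c : Fin q) x (f : Vec (Fin q) k) v → Linked c x f v → Rising (toℕ c) f
linked⇒rising c x [] [] h = tt
linked⇒rising c x (d ∷ f) (y ∷ v) (inj₁ lt , h) = ℕₚ.<⇒≤ lt , linked⇒rising d y f v h
linked⇒rising c x (d ∷ f) (y ∷ v) (inj₂ (refl , _) , h) = ℕₚ.≤-refl , linked⇒rising d y f v h

AdjacentDistinct : ∀ {k} → ℕ → Vec ℕ k → Set
AdjacentDistinct x [] = ⊤
AdjacentDistinct x (y ∷ v) = x ≢ y × AdjacentDistinct y v

-- At each position, staying in the block requires a rise and weighs `stay`, while opening the next
-- block is always possible and weighs `brk`; together they form the indicator of the prescribed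
-- comparison. The bound on `c` keeps a next letter available.
∑-scan : ∀ {q} k σ (c : Fin q) x (v : Vec ℕ k) → toℕ c + k < q → AdjacentDistinct x v →
  Q.∑ (vecsOver (allFin q) k) (λ f → Q.ind (linked? c x f v) *ℚ scan σ (toℕ c) f) ≡ boolInd (altFrom σ (x ∷ Vec.toList v))
∑-scan zero σ c x [] lt adj = refl
∑-scan {q} (suc k) σ c x (y ∷ v) lt (x≢y , adj) = begin
  Q.∑ (vecsOver A (suc k)) (λ f → Q.ind (linked? c x f (y ∷ v)) *ℚ scan σ (toℕ c) f)
    ≡⟨ Q.∑-vecsOver-suc A k _ ⟩
  Q.∑ V (λ f → Q.∑ A (λ d → Q.ind (linked? c x (d ∷ f) (y ∷ v)) *ℚ (step σ (toℕ c) (toℕ d) *ℚ scan (not σ) (toℕ d) f)))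
    ≡⟨ Q.∑-swap V A _ ⟩
  Q.∑ A (λ d → Q.∑ V (λ f → Q.ind (linked? c x (d ∷ f) (y ∷ v)) *ℚ (step σ (toℕ c) (toℕ d) *ℚ scan (not σ) (toℕ d) f)))
    ≡⟨ Q.∑-cong A (λ d → trans (Q.∑-cong V (λ f → trans (cong (_*ℚ (step σ (toℕ c) (toℕ d) *ℚ scan (not σ) (toℕ d) f)) (Q.ind-× (link? c x d y) (linked? d y f v)))
         (solve 4 (λ a b s t → a :* b :* (s :* t) := a :* s :* (b :* t)) refl (Q.ind (link? c x d y)) (Q.ind (linked? d y f v)) (step σ (toℕ c) (toℕ d)) (scan (not σ) (toℕ d) f))))
         (trans (Q.∑-*ˡ V (Q.ind (link? c x d y) *ℚ step σ (toℕ c) (toℕ d)) _) (cong (_*ℚ R d) (transition d)))) ⟩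
  Q.∑ A (λ d → (Q.ind (d ≟ᶠ c) *ℚ (up *ℚ stay σ) +ℚ Q.ind (toℕ d ℕ.≟ suc (toℕ c)) *ℚ brk σ) *ℚ R d)
    ≡⟨ trans (Q.∑-cong A (λ d → solve 5 (λ a u b w r → (a :* u :+ b :* w) :* r := a :* (u :* r) :+ b :* (w :* r)) refl (Q.ind (d ≟ᶠ c)) (up *ℚ stay σ) (Q.ind (toℕ d ℕ.≟ suc (toℕ c))) (brk σ) (R d)))
         (Q.∑-+ A _ _) ⟩
  Q.∑ A (λ d → Q.ind (d ≟ᶠ c) *ℚ (up *ℚ stay σ *ℚ R d)) +ℚ Q.∑ A (λ d → Q.ind (toℕ d ℕ.≟ suc (toℕ c)) *ℚ (brk σ *ℚ R d))
    ≡⟨ cong₂ _+ℚ_ (Q.Enumeration.∑-dirac (Q.finEnum q) c (λ d → up *ℚ stay σ *ℚ R d))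
         (Q.Enumeration.∑-unique (Q.finEnum q) (λ d → toℕ d ℕ.≟ suc (toℕ c)) (λ d → brk σ *ℚ R d) c⁺ toℕ-c⁺ (λ d e → Finₚ.toℕ-injective (trans e (sym toℕ-c⁺)))) ⟩
  up *ℚ stay σ *ℚ R c +ℚ brk σ *ℚ R c⁺
    ≡⟨ cong₂ (λ a b → up *ℚ stay σ *ℚ a +ℚ brk σ *ℚ b)
         (∑-scan k (not σ) c y v (ℕₚ.<-trans (ℕₚ.+-monoʳ-< (toℕ c) (ℕₚ.n<1+n k)) lt) adj)
         (∑-scan k (not σ) c⁺ y v (subst (_< q) (trans (ℕₚ.+-suc (toℕ c) k) (cong (_+ k) (sym toℕ-c⁺))) lt) adj) ⟩
  up *ℚ stay σ *ℚ rest +ℚ brk σ *ℚ rest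
    ≡⟨ ℚₚ.*-distribʳ-+ rest (up *ℚ stay σ) (brk σ) ⟨
  (up *ℚ stay σ +ℚ brk σ) *ℚ rest
    ≡⟨ trans (cong (_*ℚ rest) (turn σ)) (sym (boolInd-∧ (if σ then y ℕ.<ᵇ x else x ℕ.<ᵇ y) _)) ⟩
  boolInd (altFrom σ (x ∷ y ∷ Vec.toList v)) ∎
  where
  open ≡-Reasoning
  A = allFin q
  V = vecsOver A k
  up = Q.ind (x ℕ.<? y)
  rest = boolInd (altFrom (not σ) (y ∷ Vec.toList v))
  R : Fin q → ℚ
  R d = Q.∑ V (λ f → Q.ind (linked? d y f v) *ℚ scan (not σ) (toℕ d) f)
  c⁺< : suc (toℕ c) < q
  c⁺< = ℕₚ.≤-<-trans (ℕₚ.≤-trans (ℕₚ.≤-reflexive (sym (ℕₚ.+-comm (toℕ c) 1))) (ℕₚ.+-monoʳ-≤ (toℕ c) (s≤s z≤n))) lt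
  c⁺ = Fin.fromℕ< c⁺<
  toℕ-c⁺ : toℕ c⁺ ≡ suc (toℕ c)
  toℕ-c⁺ = Finₚ.toℕ-fromℕ< c⁺<
  transition : ∀ d → Q.ind (link? c x d y) *ℚ step σ (toℕ c) (toℕ d) ≡ Q.ind (d ≟ᶠ c) *ℚ (up *ℚ stay σ) +ℚ Q.ind (toℕ d ℕ.≟ suc (toℕ c)) *ℚ brk σ
  transition d = go (d ≟ᶠ c) (toℕ d ℕ.≟ suc (toℕ c))
    where
    go : (e₁ : Dec (d ≡ c)) (e₂ : Dec (toℕ d ≡ suc (toℕ c))) → Q.ind (link? c x d y) *ℚ step σ (toℕ c) (toℕ d) ≡ Q.ind e₁ *ℚ (up *ℚ stay σ) +ℚ Q.ind e₂ *ℚ brk σ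
    go (yes refl) (yes e) = ⊥-elim (ℕₚ.1+n≢n (sym e))
    go (yes refl) (no _) = trans (cong₂ _*ℚ_ (Q.ind-⇔ (link? c x c y) (x ℕ.<? y) [ (λ lt → ⊥-elim (ℕₚ.<-irrefl refl lt)) , proj₂ ]′ (λ lt → inj₂ (refl , lt))) (step-stay σ (toℕ c)))
      (solve 2 (λ u b → u := con 1ℚ :* u :+ con 0ℚ :* b) refl (up *ℚ stay σ) (brk σ))
    go (no d≢) (yes e) = trans (cong₂ _*ℚ_ (Q.ind-yes (link? c x d y) (inj₁ (ℕₚ.≤-reflexive (sym e)))) (trans (cong (step σ (toℕ c)) e) (step-brk σ (toℕ c))))
      (solve 2 (λ u b → con 1ℚ :* b := con 0ℚ :* u :+ con 1ℚ :* b) refl (up *ℚ stay σ) (brk σ))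
    go (no d≢) (no e) = trans (cong (Q.ind (link? c x d y) *ℚ_) (step-none σ (toℕ c) (toℕ d) (d≢ ∘ Finₚ.toℕ-injective) e))
      (solve 3 (λ i u b → i :* con 0ℚ := con 0ℚ :* u :+ con 0ℚ :* b) refl (Q.ind (link? c x d y)) (up *ℚ stay σ) (brk σ))
  T⇒≡ : ∀ {b} → T b → b ≡ true
  T⇒≡ {true} _ = refl
  turn : ∀ σ → up *ℚ stay σ +ℚ brk σ ≡ boolInd (if σ then y ℕ.<ᵇ x else x ℕ.<ᵇ y)
  turn false = trans (solve 1 (λ u → u :* con 1ℚ :+ con 0ℚ := u) refl up)
    (sym (boolInd≡ind (x ℕ.<ᵇ y) (x ℕ.<? y) (λ e → ℕₚ.<ᵇ⇒< x y (subst T (sym e) tt)) (λ lt → T⇒≡ (ℕₚ.<⇒<ᵇ lt))))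
  -- At a position of `S` the weight is one minus the indicator of a rise, which is the indicator of
  -- a descent because the two values differ.
  turn true = trans (flipped (ℕₚ.<-cmp x y)) (sym (boolInd≡ind (y ℕ.<ᵇ x) (y ℕ.<? x) (λ e → ℕₚ.<ᵇ⇒< y x (subst T (sym e) tt)) (λ lt → T⇒≡ (ℕₚ.<⇒<ᵇ lt))))
    where
    flipped : _ → up *ℚ -ℚ 1ℚ +ℚ 1ℚ ≡ Q.ind (y ℕ.<? x)
    flipped (tri< a ¬b ¬c) = trans (cong (λ u → u *ℚ -ℚ 1ℚ +ℚ 1ℚ) (Q.ind-yes (x ℕ.<? y) a)) (sym (Q.ind-no (y ℕ.<? x) ¬c))
    flipped (tri≈ ¬a b ¬c) = ⊥-elim (x≢y b)
    flipped (tri> ¬a ¬b c) = trans (cong (λ u → u *ℚ -ℚ 1ℚ +ℚ 1ℚ) (Q.ind-no (x ℕ.<? y) ¬a)) (sym (Q.ind-yes (y ℕ.<? x) c))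

CompatibleV : ∀ {q k} → Vec ℕ k → Vec (Fin q) k → Set
CompatibleV v f = ∀ i j → toℕ i < toℕ j → toℕ (lookup f i) ≤ toℕ (lookup f j) × (lookup f i ≡ lookup f j → lookup v i < lookup v j)

compatible⇒linked : ∀ {q k} x (v : Vec ℕ k) (c : Fin q) f → CompatibleV (x ∷ v) (c ∷ f) → Linked c x f v
compatible⇒linked x [] c [] h = tt
compatible⇒linked x (y ∷ v) c (d ∷ f) h = link , compatible⇒linked y v d f (λ i j lt → h (suc i) (suc j) (s≤s lt))
  where
  link : Link c x d y
  link with ℕₚ.m≤n⇒m<n∨m≡n (proj₁ (h zero (suc zero) (s≤s z≤n)))
  ... | inj₁ lt = inj₁ lt
  ... | inj₂ e = inj₂ (Finₚ.toℕ-injective e , proj₂ (h zero (suc zero) (s≤s z≤n)) (Finₚ.toℕ-injective e))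

-- Links between neighbours compose: a strict rise of letters persists, and inside a block the
-- inequalities between values chain.
linked⇒compatible : ∀ {q k} x (v : Vec ℕ k) (c : Fin q) f → Linked c x f v → CompatibleV (x ∷ v) (c ∷ f)
linked⇒compatible x v c f h zero zero ()
linked⇒compatible x v c f h (suc i) zero ()
linked⇒compatible x (y ∷ v) c (d ∷ f) (l , h) (suc i) (suc j) (s≤s lt) = linked⇒compatible y v d f h i j lt
linked⇒compatible x (y ∷ v) c (d ∷ f) (l , h) zero (suc zero) lt = first l
  where
  first : Link c x d y → toℕ c ≤ toℕ d × (c ≡ d → x < y)
  first (inj₁ c<d) = ℕₚ.<⇒≤ c<d , λ { refl → ⊥-elim (ℕₚ.<-irrefl refl c<d) }
  first (inj₂ (refl , x<y)) = ℕₚ.≤-refl , λ _ → x<y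
linked⇒compatible x (y ∷ v) c (d ∷ f) (l , h) zero (suc (suc j)) lt = compose l (linked⇒compatible y v d f h zero (suc j) (s≤s z≤n))
  where
  compose : Link c x d y → toℕ d ≤ toℕ (lookup f j) × (d ≡ lookup f j → y < lookup v j) →
            toℕ c ≤ toℕ (lookup f j) × (c ≡ lookup f j → x < lookup v j)
  compose (inj₁ c<d) (d≤ , _) = ℕₚ.≤-trans (ℕₚ.<⇒≤ c<d) d≤ , λ e → ⊥-elim (ℕₚ.<⇒≱ c<d (ℕₚ.≤-trans d≤ (ℕₚ.≤-reflexive (cong toℕ (sym e)))))
  compose (inj₂ (refl , x<y)) (d≤ , st) = d≤ , λ e → ℕₚ.<-trans x<y (st e)

adjacentDistinct : ∀ {k} x (v : Vec ℕ k) → (∀ i j → lookup (x ∷ v) i ≡ lookup (x ∷ v) j → i ≡ j) → AdjacentDistinct x v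
adjacentDistinct x [] inj = tt
adjacentDistinct x (y ∷ v) inj = (λ e → 0≢1 (inj zero (suc zero) e)) , adjacentDistinct y v (λ i j e → Finₚ.suc-injective (inj (suc i) (suc j) e))
  where
  0≢1 : ∀ {n} → Fin.zero {suc n} ≢ suc zero
  0≢1 ()

-- A nonempty content whose first block is empty has weight zero, so `f` starts with the letter 0
-- and `∑-scan` takes over. The direction is `not σ` because `σ` describes the position before the
-- first entry.
inclusion-exclusion : ∀ σ {n} (π : Vec (Fin n) n) → IsInjective π →
  Q.∑ (vecsOver (allFin n) n) (λ f → Q.ind (compatible? π f) *ℚ start σ (content (lookup f))) ≡ boolInd (altFrom (not σ) (valuesOf π))
inclusion-exclusion σ {zero} [] inj = trans (ℚₚ.+-identityʳ _) (ℚₚ.*-identityʳ _)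
inclusion-exclusion σ {suc n} (p ∷ π) inj = begin
  Q.∑ (vecsOver A (suc n)) (λ f → Q.ind (compatible? (p ∷ π) f) *ℚ start σ (content (lookup f)))
    ≡⟨ Q.∑-vecsOver-suc A n _ ⟩
  Q.∑ V (λ f → Q.∑ A (λ d → Q.ind (compatible? (p ∷ π) (d ∷ f)) *ℚ start σ (content (lookup (d ∷ f)))))
    ≡⟨ Q.∑-cong V (λ f → trans (Q.∑-cong A (λ d → term d f)) (Q.Enumeration.∑-dirac (Q.finEnum (suc n)) zero (λ d → Q.ind (linked? d (toℕ p) f v) *ℚ scan (not σ) (toℕ d) f))) ⟩
  Q.∑ V (λ f → Q.ind (linked? zero (toℕ p) f v) *ℚ scan (not σ) 0 f)
    ≡⟨ ∑-scan n (not σ) zero (toℕ p) v (ℕₚ.n<1+n n) (adjacentDistinct (toℕ p) v (λ i j e → inj i j (Finₚ.toℕ-injective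
         (trans (sym (Vecₚ.lookup-map i toℕ (p ∷ π))) (trans e (Vecₚ.lookup-map j toℕ (p ∷ π))))))) ⟩
  boolInd (altFrom (not σ) (toℕ p ∷ Vec.toList v))
    ≡⟨ cong (λ xs → boolInd (altFrom (not σ) (toℕ p ∷ xs))) (Vecₚ.toList-map toℕ π) ⟩
  boolInd (altFrom (not σ) (valuesOf (p ∷ π))) ∎
  where
  open ≡-Reasoning
  A = allFin (suc n)
  V = vecsOver A n
  v = Vec.map toℕ π
  compat⇒ : ∀ d f → Compatible (p ∷ π) (d ∷ f) → CompatibleV (toℕ p ∷ v) (d ∷ f)
  compat⇒ d f h i j lt = proj₁ (h i j lt) , λ e → subst₂ _<_ (sym (Vecₚ.lookup-map i toℕ (p ∷ π))) (sym (Vecₚ.lookup-map j toℕ (p ∷ π))) (proj₂ (h i j lt) e)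
  compat⇐ : ∀ d f → CompatibleV (toℕ p ∷ v) (d ∷ f) → Compatible (p ∷ π) (d ∷ f)
  compat⇐ d f h i j lt = proj₁ (h i j lt) , λ e → subst₂ _<_ (Vecₚ.lookup-map i toℕ (p ∷ π)) (Vecₚ.lookup-map j toℕ (p ∷ π)) (proj₂ (h i j lt) e)
  term : ∀ d f → Q.ind (compatible? (p ∷ π) (d ∷ f)) *ℚ start σ (content (lookup (d ∷ f))) ≡
                 Q.ind (d ≟ᶠ zero) *ℚ (Q.ind (linked? d (toℕ p) f v) *ℚ scan (not σ) (toℕ d) f)
  term d f = trans (cong (_*ℚ start σ (content (lookup (d ∷ f)))) (Q.ind-⇔ (compatible? (p ∷ π) (d ∷ f)) (linked? d (toℕ p) f v)
      (λ h → compatible⇒linked (toℕ p) v d f (compat⇒ d f h)) (λ h → compat⇐ d f (linked⇒compatible (toℕ p) v d f h))))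
    (trans (Q.ind-cong (linked? d (toℕ p) f v) (λ h → trans (cong (start σ) (content≡cnts (d ∷ f))) (start-scan σ d f (linked⇒rising d (toℕ p) f v h))))
    (solve 3 (λ a b c → a :* (b :* c) := b :* (a :* c)) refl (Q.ind (linked? d (toℕ p) f v)) (Q.ind (d ≟ᶠ zero)) (scan (not σ) (toℕ d) f)))

-- Alternating permutations as necklace multisets

∧-true : ∀ {x y} → x ∧ y ≡ true → x ≡ true × y ≡ true
∧-true {true} {true} e = refl , refl

∧-intro : ∀ {x y} → x ≡ true → y ≡ true → x ∧ y ≡ true
∧-intro refl refl = refl

does-true : {P : Set} (d : Dec P) → does d ≡ true → P
does-true (yes p) e = p

true-does : {P : Set} (d : Dec P) → P → does d ≡ true
true-does (yes _) p = refl
true-does (no ¬p) p = ⊥-elim (¬p p)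

not-does : {P : Set} (d : Dec P) → not (does d) ≡ true → ¬ P
not-does (no ¬p) e = ¬p

does-not : {P : Set} (d : Dec P) → ¬ P → not (does d) ≡ true
does-not (no _) ¬p = refl
does-not (yes p) ¬p = ⊥-elim (¬p p)

notIn-sound : ∀ {k n} (x : Fin k) (v : Vec (Fin k) n) → notIn x v ≡ true → ∀ i → x ≢ lookup v i
notIn-sound x (y ∷ v) e zero = not-does (x ≟ᶠ y) (proj₁ (∧-true e))
notIn-sound x (y ∷ v) e (suc i) = notIn-sound x v (proj₂ (∧-true {not (does (x ≟ᶠ y))} e)) i

notIn-complete : ∀ {k n} (x : Fin k) (v : Vec (Fin k) n) → (∀ i → x ≢ lookup v i) → notIn x v ≡ true
notIn-complete x [] h = refl
notIn-complete x (y ∷ v) h = ∧-intro (does-not (x ≟ᶠ y) (h zero)) (notIn-complete x v (h ∘ suc))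

distinct-sound : ∀ {k n} (v : Vec (Fin k) n) → distinct v ≡ true → ∀ i j → lookup v i ≡ lookup v j → i ≡ j
distinct-sound (x ∷ v) e zero zero h = refl
distinct-sound (x ∷ v) e zero (suc j) h = ⊥-elim (notIn-sound x v (proj₁ (∧-true e)) j h)
distinct-sound (x ∷ v) e (suc i) zero h = ⊥-elim (notIn-sound x v (proj₁ (∧-true e)) i (sym h))
distinct-sound (x ∷ v) e (suc i) (suc j) h = cong suc (distinct-sound v (proj₂ (∧-true {notIn x v} e)) i j h)

distinct-complete : ∀ {k n} (v : Vec (Fin k) n) → (∀ i j → lookup v i ≡ lookup v j → i ≡ j) → distinct v ≡ true
distinct-complete [] inj = refl
distinct-complete (x ∷ v) inj = ∧-intro (notIn-complete x v (λ i e → Finₚ.0≢1+n (inj zero (suc i) e)))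
  (distinct-complete v (λ i j e → Finₚ.suc-injective (inj (suc i) (suc j) e)))

-- The local function of cycleLenIs has no name outside Defs; unification finds it.
cycleLenIs-unfold : ∀ {n} (π : Vec (Fin n) n) m i → ∃ λ (noEarly : ℕ → Bool) →
  noEarly 0 ≡ true × (∀ k → noEarly (suc k) ≡ not (does (iter π (suc k) i ≟ᶠ i)) ∧ noEarly k) ×
  cycleLenIs π m i ≡ does (iter π m i ≟ᶠ i) ∧ noEarly (m ∸ 1)
cycleLenIs-unfold {n} π m i = noEarly , refl , (λ _ → refl) , unfold
  where
  noEarly : ℕ → Bool
  noEarly = _
  unfold : cycleLenIs π m i ≡ does (iter π m i ≟ᶠ i) ∧ noEarly (m ∸ 1)
  unfold with m ∸ 1
  ... | k = refl

cycleLenIs-sound : ∀ {n} (π : Vec (Fin n) n) m i → cycleLenIs π m i ≡ true →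
  iter π m i ≡ i × (∀ k → 0 < k → k ≤ m ∸ 1 → iter π k i ≢ i)
cycleLenIs-sound π m i e = does-true (iter π m i ≟ᶠ i) (proj₁ split) , early (m ∸ 1) (proj₂ split)
  where
  ne = proj₁ (cycleLenIs-unfold π m i)
  ne-suc = proj₁ (proj₂ (proj₂ (cycleLenIs-unfold π m i)))
  split = ∧-true {does (iter π m i ≟ᶠ i)} (trans (sym (proj₂ (proj₂ (proj₂ (cycleLenIs-unfold π m i))))) e)
  early : ∀ K → ne K ≡ true → ∀ k → 0 < k → k ≤ K → iter π k i ≢ i
  early zero h (suc k) 0<k ()
  early (suc K) h k 0<k k≤ = pick (∧-true (trans (sym (ne-suc K)) h)) (ℕₚ.m≤n⇒m<n∨m≡n k≤)
    where
    pick : not (does (iter π (suc K) i ≟ᶠ i)) ≡ true × ne K ≡ true → k < suc K ⊎ k ≡ suc K → iter π k i ≢ i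
    pick (h₁ , h₂) (inj₁ (s≤s k≤K)) = early K h₂ k 0<k k≤K
    pick (h₁ , h₂) (inj₂ refl) = not-does (iter π (suc K) i ≟ᶠ i) h₁

cycleLenIs-complete : ∀ {n} (π : Vec (Fin n) n) m i →
  iter π m i ≡ i → (∀ k → 0 < k → k ≤ m ∸ 1 → iter π k i ≢ i) → cycleLenIs π m i ≡ true
cycleLenIs-complete π m i per min = trans (proj₂ (proj₂ (proj₂ (cycleLenIs-unfold π m i))))
  (∧-intro (true-does (iter π m i ≟ᶠ i) per) (late (m ∸ 1) min))
  where
  ne = proj₁ (cycleLenIs-unfold π m i)
  late : ∀ K → (∀ k → 0 < k → k ≤ K → iter π k i ≢ i) → ne K ≡ true
  late zero h = proj₁ (proj₂ (cycleLenIs-unfold π m i))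
  late (suc K) h = trans (proj₁ (proj₂ (proj₂ (cycleLenIs-unfold π m i))) K)
    (∧-intro (does-not (iter π (suc K) i ≟ᶠ i) (h (suc K) (s≤s z≤n) ℕₚ.≤-refl)) (late K (λ k 0<k k≤ → h k 0<k (ℕₚ.m≤n⇒m≤1+n k≤))))

foldr-∧-sound : ∀ {A : Set} n (g : Fin n → A) (p : A → Bool) → foldr _∧_ true (map p (tabulate g)) ≡ true → ∀ i → p (g i) ≡ true
foldr-∧-sound (suc n) g p e zero = proj₁ (∧-true e)
foldr-∧-sound (suc n) g p e (suc i) = foldr-∧-sound n (g ∘ suc) p (proj₂ (∧-true {p (g zero)} e)) i

foldr-∧-complete : ∀ {A : Set} n (g : Fin n → A) (p : A → Bool) → (∀ i → p (g i) ≡ true) → foldr _∧_ true (map p (tabulate g)) ≡ true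
foldr-∧-complete zero g p h = refl
foldr-∧-complete (suc n) g p h = ∧-intro (h zero) (foldr-∧-complete n (g ∘ suc) p (h ∘ suc))

allCyclesLength-ind : ∀ {n} m₀ (π : Vec (Fin n) n) → boolInd (allCyclesLength (suc m₀) π) ≡ Q.ind (allCycles? (suc m₀) π)
allCyclesLength-ind {n} m₀ π = boolInd≡ind (allCyclesLength (suc m₀) π) (allCycles? (suc m₀) π)
  (λ e i → let (per , min) = cycleLenIs-sound π (suc m₀) i (foldr-∧-sound n id (cycleLenIs π (suc m₀)) e i) in
    per , λ d 0<d → min (toℕ d) 0<d (ℕ.s≤s⁻¹ (Finₚ.toℕ<n d)))
  (λ h → foldr-∧-complete n id (cycleLenIs π (suc m₀)) (λ i → cycleLenIs-complete π (suc m₀) i (proj₁ (h i))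
    (λ k 0<k k≤ → subst (λ k → iter π k i ≢ i) (Finₚ.toℕ-fromℕ< (s≤s k≤))
      (proj₂ (h i) (Fin.fromℕ< (s≤s k≤)) (subst (0 <_) (sym (Finₚ.toℕ-fromℕ< (s≤s k≤))) 0<k)))))

countBy-filter : {A : Set} (s p : A → Bool) (xs : List A) →
  ℕtoℚ (countBy p (filter (T? ∘ s) xs)) ≡ Q.∑ xs (λ x → boolInd (s x) *ℚ boolInd (p x))
countBy-filter s p [] = refl
countBy-filter s p (x ∷ xs) with s x
... | false = trans (countBy-filter s p xs) (sym (trans (cong (_+ℚ Q.∑ xs (λ x → boolInd (s x) *ℚ boolInd (p x))) (ℚₚ.*-zeroˡ (boolInd (p x)))) (ℚₚ.+-identityˡ _)))
... | true with p x
... | true = trans (ℕtoℚ-+ 1 (countBy p (filter (T? ∘ s) xs))) (cong (1ℚ +ℚ_) (countBy-filter s p xs))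
... | false = trans (countBy-filter s p xs) (sym (ℚₚ.+-identityˡ _))

-- The alphabet has one letter per position, enough for every decomposition into blocks. The sum
-- over `f` comes from inclusion-exclusion; for fixed `f` the correspondence trades permutations for
-- word lists, and then summation over `f` leaves only the vector of heads.
count-as-necklaceSum : ∀ σ m₀ r → let n = suc m₀ * r in
  ℕtoℚ (countBy (λ π → altFrom (not σ) (valuesOf π) ∧ allCyclesLength (suc m₀) π) (perms n)) ≡ Recurrence.necklaceSum n m₀ r (start σ)
count-as-necklaceSum σ m₀ r = begin
  ℕtoℚ (countBy p (perms n))
    ≡⟨ countBy-filter distinct p (allVecs n n) ⟩
  Q.∑ (allVecs n n) (λ π → boolInd (distinct π) *ℚ boolInd (p π))
    ≡⟨ cong (λ xs → Q.∑ xs (λ π → boolInd (distinct π) *ℚ boolInd (p π))) (allVecs≡vecsOver n n) ⟩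
  Q.∑ V (λ π → boolInd (distinct π) *ℚ boolInd (p π))
    ≡⟨ Q.∑-cong V expand ⟩
  Q.∑ V (λ π → Q.∑ V (λ f → Q.ind (goodPerm? f π) *ℚ χ f))
    ≡⟨ Q.∑-swap V V (λ π f → Q.ind (goodPerm? f π) *ℚ χ f) ⟩
  Q.∑ V (λ f → Q.∑ V (λ π → Q.ind (goodPerm? f π) *ℚ χ f))
    ≡⟨ Q.∑-cong V (λ f → trans (Q.∑-*ʳ V (χ f) (λ π → Q.ind (goodPerm? f π))) (trans (cong (_*ℚ χ f) (gessel-reutenauer f)) (sym (Q.∑-*ʳ WV (χ f) (λ W → Q.ind (goodWords? f W)))))) ⟩
  Q.∑ V (λ f → Q.∑ WV (λ W → Q.ind (goodWords? f W) *ℚ χ f))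
    ≡⟨ Q.∑-swap V WV (λ f W → Q.ind (goodWords? f W) *ℚ χ f) ⟩
  Q.∑ WV (λ W → Q.∑ V (λ f → Q.ind (goodWords? f W) *ℚ χ f))
    ≡⟨ Q.∑-cong WV collapse ⟩
  necklaceSum r (start σ) ∎
  where
  open ≡-Reasoning
  n = suc m₀ * r
  open Recurrence n m₀
  V = vecsOver (allFin n) n
  WV = vecsOver words n
  p : Vec (Fin n) n → Bool
  p π = altFrom (not σ) (valuesOf π) ∧ allCyclesLength (suc m₀) π
  χ : Vec (Fin n) n → ℚ
  χ f = start σ (content (lookup f))
  expand : ∀ π → boolInd (distinct π) *ℚ boolInd (p π) ≡ Q.∑ V (λ f → Q.ind (goodPerm? f π) *ℚ χ f)
  expand π = trans (cong₂ _*ℚ_ (boolInd≡ind (distinct π) (isInjective? π) (distinct-sound π) (distinct-complete π))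
      (trans (boolInd-∧ (altFrom (not σ) (valuesOf π)) _) (cong (boolInd (altFrom (not σ) (valuesOf π)) *ℚ_) (allCyclesLength-ind m₀ π))))
    (trans (Q.ind-cong (isInjective? π) (λ inj → cong (_*ℚ cyc) (sym (inclusion-exclusion σ π inj))))
    (trans (solve 3 (λ i s c → i :* (s :* c) := i :* c :* s) refl (Q.ind (isInjective? π)) (Q.∑ V (λ f → Q.ind (compatible? π f) *ℚ χ f)) cyc)
    (trans (sym (Q.∑-*ˡ V (Q.ind (isInjective? π) *ℚ cyc) (λ f → Q.ind (compatible? π f) *ℚ χ f)))
    (Q.∑-cong V (λ f → trans (solve 4 (λ i c k x → i :* c :* (k :* x) := i :* (c :* k) :* x) refl (Q.ind (isInjective? π)) cyc (Q.ind (compatible? π f)) (χ f))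
      (cong (_*ℚ χ f) (sym (trans (Q.ind-× (isInjective? π) (allCycles? (suc m₀) π ×-dec compatible? π f))
        (cong (Q.ind (isInjective? π) *ℚ_) (Q.ind-× (allCycles? (suc m₀) π) (compatible? π f)))))))))))
    where cyc = Q.ind (allCycles? (suc m₀) π)
  collapse : ∀ W → Q.∑ V (λ f → Q.ind (goodWords? f W) *ℚ χ f) ≡ Q.ind (admissible? W) *ℚ start σ (headContent W)
  collapse W = trans (Q.∑-cong V (λ f → trans (cong (_*ℚ χ f) (Q.ind-× (admissible? W) (heads W ≟ᵛ f))) (ℚₚ.*-assoc (Q.ind (admissible? W)) (Q.ind (heads W ≟ᵛ f)) (χ f))))
    (trans (Q.∑-*ˡ V (Q.ind (admissible? W)) (λ f → Q.ind (heads W ≟ᵛ f) *ℚ χ f)) (cong (Q.ind (admissible? W) *ℚ_)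
      (trans (Q.Enumeration.∑-unique (Q.vecEnum (Q.finEnum n) n) (heads W ≟ᵛ_) χ (heads W) refl (λ f e → sym e))
        (cong (start σ) (vec-ext {xs = content (lookup (heads W))} {ys = headContent W} (λ a → trans (Vecₚ.lookup∘tabulate (λ a → count (λ k → lookup (heads W) k ≟ᶠ a)) a)
          (trans (N.∑-cong (allFin n) (λ k → cong (λ x → N.ind (x ≟ᶠ a)) (Vecₚ.lookup-map k (λ w → get w 0) W)))
            (sym (Vecₚ.lookup∘tabulate (λ a → count (λ k → get (lookup W k) 0 ≟ᶠ a)) a)))))))))
    where
    _≟ᵛ_ : (f g : Vec (Fin n) n) → Dec (f ≡ g)
    _≟ᵛ_ = Vecₚ.≡-dec _≟ᶠ_

-- Evaluation of polynomials in the umbral indeterminate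

ev : (ℕ → ℚ) → Poly → ℚ
ev u [] = 0ℚ
ev u (a ∷ p) = a *ℚ u 0 +ℚ ev (u ∘ suc) p

ev-cong : ∀ p {u v : ℕ → ℚ} → (∀ i → u i ≡ v i) → ev u p ≡ ev v p
ev-cong [] e = refl
ev-cong (a ∷ p) e = cong₂ (λ x y → a *ℚ x +ℚ y) (e 0) (ev-cong p (e ∘ suc))

umbralFrom≡ev : ∀ k p → umbralFrom k p ≡ ev (λ i → euler (k + i)) p
umbralFrom≡ev k [] = refl
umbralFrom≡ev k (a ∷ p) = cong₂ _+ℚ_ (cong (λ i → a *ℚ euler i) (sym (ℕₚ.+-identityʳ k)))
  (trans (umbralFrom≡ev (suc k) p) (ev-cong p (λ i → cong euler (sym (ℕₚ.+-suc k i)))))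

ev-*ˡ : ∀ c u p → ev (λ i → c *ℚ u i) p ≡ c *ℚ ev u p
ev-*ˡ c u [] = sym (ℚₚ.*-zeroʳ c)
ev-*ˡ c u (a ∷ p) = trans (cong (a *ℚ (c *ℚ u 0) +ℚ_) (ev-*ˡ c (u ∘ suc) p))
  (solve 4 (λ a c x y → a :* (c :* x) :+ c :* y := c :* (a :* x :+ y)) refl a c (u 0) (ev (u ∘ suc) p))

ev-+ : ∀ u v p → ev (λ i → u i +ℚ v i) p ≡ ev u p +ℚ ev v p
ev-+ u v [] = refl
ev-+ u v (a ∷ p) = trans (cong (a *ℚ (u 0 +ℚ v 0) +ℚ_) (ev-+ (u ∘ suc) (v ∘ suc) p))
  (solve 5 (λ a x y s t → a :* (x :+ y) :+ (s :+ t) := (a :* x :+ s) :+ (a :* y :+ t)) refl a (u 0) (v 0) (ev (u ∘ suc) p) (ev (v ∘ suc) p))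

ev-padd : ∀ u p p′ → ev u (padd p p′) ≡ ev u p +ℚ ev u p′
ev-padd u [] p′ = sym (ℚₚ.+-identityˡ (ev u p′))
ev-padd u (a ∷ p) [] = sym (ℚₚ.+-identityʳ (ev u (a ∷ p)))
ev-padd u (a ∷ p) (b ∷ p′) = trans (cong ((a +ℚ b) *ℚ u 0 +ℚ_) (ev-padd (u ∘ suc) p p′))
  (solve 5 (λ a b x s t → (a :+ b) :* x :+ (s :+ t) := (a :* x :+ s) :+ (b :* x :+ t)) refl a b (u 0) (ev (u ∘ suc) p) (ev (u ∘ suc) p′))

ev-pscale : ∀ u c p → ev u (pscale c p) ≡ c *ℚ ev u p
ev-pscale u c [] = sym (ℚₚ.*-zeroʳ c)
ev-pscale u c (a ∷ p) = trans (cong (c *ℚ a *ℚ u 0 +ℚ_) (ev-pscale (u ∘ suc) c p))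
  (solve 4 (λ a c x y → c :* a :* x :+ c :* y := c :* (a :* x :+ y)) refl a c (u 0) (ev (u ∘ suc) p))

ev-pmul : ∀ u p p′ → ev u (pmul p p′) ≡ ev (λ i → ev (λ j → u (i + j)) p′) p
ev-pmul u [] p′ = refl
ev-pmul u (a ∷ p) p′ = trans (ev-padd u (pscale a p′) (0ℚ ∷ pmul p p′)) (cong₂ _+ℚ_ (ev-pscale u a p′)
  (trans (cong₂ _+ℚ_ (ℚₚ.*-zeroˡ (u 0)) (ev-pmul (u ∘ suc) p p′)) (ℚₚ.+-identityˡ _)))

ev-Epow : ∀ u k → ev u (Epow k) ≡ u k
ev-Epow u zero = trans (ℚₚ.+-identityʳ _) (ℚₚ.*-identityˡ (u 0))
ev-Epow u (suc k) = trans (cong (_+ℚ ev (u ∘ suc) (Epow k)) (ℚₚ.*-zeroˡ (u 0))) (trans (ℚₚ.+-identityˡ _) (ev-Epow (u ∘ suc) k))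

ev-Σpoly : ∀ u n f → ev u (Σpoly≤ n f) ≡ Σℚ≤ n (λ i → ev u (f i))
ev-Σpoly u zero f = refl
ev-Σpoly u (suc n) f = trans (ev-padd u (Σpoly≤ n f) (f (suc n))) (cong (_+ℚ ev u (f (suc n))) (ev-Σpoly u n f))

ev-const* : ∀ u x p → ev u (pmul (x ∷ []) p) ≡ x *ℚ ev u p
ev-const* u x p = trans (ev-pmul u (x ∷ []) p) (ℚₚ.+-identityʳ _)

-- Multiplication by `c` transposed to sequences: if `u o` is the value assigned to `E^o`, the
-- result lists the values of `E^o c`.
mulBy : Poly → (ℕ → ℚ) → ℕ → ℚ
mulBy c u o = ev (λ j → u (o + j)) c

mulBy-cong : ∀ c {u v : ℕ → ℚ} → (∀ i → u i ≡ v i) → ∀ o → mulBy c u o ≡ mulBy c v o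
mulBy-cong c e o = ev-cong c (λ j → e (o + j))

powerSeq : Poly → ℕ → (ℕ → ℚ) → ℕ → ℚ
powerSeq c zero u = u
powerSeq c (suc k) u = mulBy c (powerSeq c k u)

powerSeq-comm : ∀ c k u o → powerSeq c (suc k) u o ≡ powerSeq c k (mulBy c u) o
powerSeq-comm c zero u o = refl
powerSeq-comm c (suc k) u o = mulBy-cong c (powerSeq-comm c k u) o

powerSeq-shift : ∀ c k u a o → powerSeq c k (λ i → u (a + i)) o ≡ powerSeq c k u (a + o)
powerSeq-shift c zero u a o = refl
powerSeq-shift c (suc k) u a o = ev-cong c (λ j → trans (powerSeq-shift c k u a (o + j)) (cong (powerSeq c k u) (sym (ℕₚ.+-assoc a o j))))

powQ : QSeries → ℕ → QSeries
powQ f zero = δ₀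
powQ f (suc k) = f ·q powQ f k

-- The base is a scalar series times one fixed polynomial, so the coefficient in `t` and the power
-- of `c` separate. The quantifier over `u` matters: the induction evaluates at shifted sequences.
ev-powPS : ∀ c f k n u → ev u (powPS (scalePS c (liftQ f)) k n) ≡ powQ f k n *ℚ powerSeq c k u 0
ev-powPS c f zero zero u = ℚₚ.+-identityʳ _
ev-powPS c f zero (suc n) u = sym (ℚₚ.*-zeroˡ (u 0))
ev-powPS c f (suc k) n u = begin
  ev u (Σpoly≤ n (λ i → pmul (pmul c (f i ∷ [])) (P (n ∸ i))))
    ≡⟨ ev-Σpoly u n _ ⟩
  Σℚ≤ n (λ i → ev u (pmul (pmul c (f i ∷ [])) (P (n ∸ i))))
    ≡⟨ Σ-cong n (λ i _ → factor i) ⟩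
  Σℚ≤ n (λ i → L *ℚ (f i *ℚ powQ f k (n ∸ i)))
    ≡⟨ Σ-*ˡ n L _ ⟩
  L *ℚ powQ f (suc k) n
    ≡⟨ ℚₚ.*-comm L (powQ f (suc k) n) ⟩
  powQ f (suc k) n *ℚ L ∎
  where
  open ≡-Reasoning
  P = powPS (scalePS c (liftQ f)) k
  L = powerSeq c (suc k) u 0
  factor : ∀ i → ev u (pmul (pmul c (f i ∷ [])) (P (n ∸ i))) ≡ L *ℚ (f i *ℚ powQ f k (n ∸ i))
  factor i = begin
    ev u (pmul (pmul c (f i ∷ [])) (P (n ∸ i)))
      ≡⟨ trans (ev-pmul u (pmul c (f i ∷ [])) (P (n ∸ i))) (ev-cong (pmul c (f i ∷ [])) (λ a → trans (ev-powPS c f k (n ∸ i) (λ j → u (a + j)))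
           (cong (powQ f k (n ∸ i) *ℚ_) (trans (powerSeq-shift c k u a 0) (cong (powerSeq c k u) (ℕₚ.+-identityʳ a)))))) ⟩
    ev (λ a → powQ f k (n ∸ i) *ℚ powerSeq c k u a) (pmul c (f i ∷ []))
      ≡⟨ trans (ev-*ˡ (powQ f k (n ∸ i)) (powerSeq c k u) (pmul c (f i ∷ []))) (cong (powQ f k (n ∸ i) *ℚ_) (ev-pmul (powerSeq c k u) c (f i ∷ []))) ⟩
    powQ f k (n ∸ i) *ℚ ev (λ a → f i *ℚ powerSeq c k u (a + 0) +ℚ 0ℚ) c
      ≡⟨ cong (powQ f k (n ∸ i) *ℚ_) (trans (ev-cong c (λ a → trans (ℚₚ.+-identityʳ _) (cong (λ x → f i *ℚ powerSeq c k u x) (ℕₚ.+-identityʳ a)))) (ev-*ˡ (f i) (powerSeq c k u) c)) ⟩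
    powQ f k (n ∸ i) *ℚ (f i *ℚ L)
      ≡⟨ solve 3 (λ p f l → p :* (f :* l) := l :* (f :* p)) refl (powQ f k (n ∸ i)) (f i) L ⟩
    L *ℚ (f i *ℚ powQ f k (n ∸ i)) ∎

-- The coefficients of Σ w_k (c f)^k, evaluated at u
wCoeff : (ℕ → ℚ) → Poly → QSeries → ℕ → (ℕ → ℚ) → ℚ
wCoeff w c f n u = Σℚ≤ n (λ k → w k *ℚ (powQ f k n *ℚ powerSeq c k u 0))

ev-wSum : ∀ w c f n u → ev u (wSum w (scalePS c (liftQ f)) n) ≡ wCoeff w c f n u
ev-wSum w c f n u = trans (ev-Σpoly u n _) (Σ-cong n (λ k _ → trans (ev-pscale u (w k) (powPS (scalePS c (liftQ f)) k n)) (cong (w k *ℚ_) (ev-powPS c f k n u))))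

∂-δ₀ : ∀ n → ∂ δ₀ n ≡ 0ℚ
∂-δ₀ n = ℚₚ.*-zeroʳ (ℕtoℚ (suc n))

∂-powQ : ∀ f k n → ∂ (powQ f (suc k)) n ≡ ℕtoℚ (suc k) *ℚ (∂ f ·q powQ f k) n
∂-powQ f zero n = trans (leibniz f δ₀ n) (trans (cong ((∂ f ·q δ₀) n +ℚ_)
    (Σ-zero n (λ i _ → trans (cong (f i *ℚ_) (∂-δ₀ (n ∸ i))) (ℚₚ.*-zeroʳ (f i)))))
  (solve 1 (λ x → x :+ con 0ℚ := con 1ℚ :* x) refl ((∂ f ·q δ₀) n)))
∂-powQ f (suc k) n = begin
  ∂ (f ·q powQ f (suc k)) n
    ≡⟨ leibniz f (powQ f (suc k)) n ⟩
  x +ℚ (f ·q ∂ (powQ f (suc k))) n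
    ≡⟨ cong (x +ℚ_) (trans (·q-cong {f} {f} (λ _ → refl) (∂-powQ f k) n)
         (trans (·q-*ʳ (ℕtoℚ (suc k)) f (∂ f ·q powQ f k) n) (cong (ℕtoℚ (suc k) *ℚ_) (·q-leftComm f (∂ f) (powQ f k) n)))) ⟩
  x +ℚ ℕtoℚ (suc k) *ℚ x
    ≡⟨ solve 2 (λ x k → x :+ k :* x := (con 1ℚ :+ k) :* x) refl x (ℕtoℚ (suc k)) ⟩
  (1ℚ +ℚ ℕtoℚ (suc k)) *ℚ x
    ≡⟨ cong (_*ℚ x) (ℕtoℚ-+ 1 (suc k)) ⟨
  ℕtoℚ (suc (suc k)) *ℚ x ∎
  where
  open ≡-Reasoning
  x = (∂ f ·q powQ f (suc k)) n

powQ-vanish : ∀ f → f 0 ≡ 0ℚ → ∀ k n → n < k → powQ f k n ≡ 0ℚ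
powQ-vanish f f₀ (suc k) n (s≤s n≤k) = Σ-zero n term
  where
  term : ∀ i → i ≤ n → f i *ℚ powQ f k (n ∸ i) ≡ 0ℚ
  term zero _ = trans (cong (_*ℚ powQ f k n) f₀) (ℚₚ.*-zeroˡ (powQ f k n))
  term (suc i) i≤n = trans (cong (f (suc i) *ℚ_) (powQ-vanish f f₀ k (n ∸ suc i)
    (ℕₚ.<-≤-trans (ℕₚ.∸-monoʳ-< (s≤s z≤n) i≤n) n≤k))) (ℚₚ.*-zeroʳ (f (suc i)))

∸-parity : ∀ i n → i ≤ n → isEven i ≡ false → isEven (n ∸ i) ≡ not (isEven n)
∸-parity i n le odd = trans (sym (not-involutive (isEven (n ∸ i)))) (cong not (trans (sym (isOdd-+ i (n ∸ i) odd)) (cong isEven (ℕₚ.m+[n∸m]≡n le))))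

∸-parity-even : ∀ i n → i ≤ n → isEven i ≡ true → isEven (n ∸ i) ≡ isEven n
∸-parity-even i n le even = trans (sym (isEven-+ i (n ∸ i) even)) (cong isEven (ℕₚ.m+[n∸m]≡n le))

powQ-parity : ∀ f → (∀ i → isEven i ≡ true → f i ≡ 0ℚ) → ∀ k n → isEven n ≡ not (isEven k) → powQ f k n ≡ 0ℚ
powQ-parity f odd zero (suc n) e = refl
powQ-parity f odd (suc k) n e = Σ-zero n (λ i le → term i le (isEven i) refl)
  where
  term : ∀ i → i ≤ n → ∀ b → isEven i ≡ b → f i *ℚ powQ f k (n ∸ i) ≡ 0ℚ
  term i le true h = trans (cong (_*ℚ powQ f k (n ∸ i)) (odd i h)) (ℚₚ.*-zeroˡ (powQ f k (n ∸ i)))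
  term i le false h = trans (cong (f i *ℚ_) (powQ-parity f odd k (n ∸ i) (trans (∸-parity i n le h) (trans (cong not e)
    (trans (not-involutive (isEven (suc k))) (not-isEven k)))))) (ℚₚ.*-zeroʳ (f i))

module _ (c : Poly) (f : QSeries) (f₀ : f 0 ≡ 0ℚ) where

  expCoeff : ℕ → (ℕ → ℚ) → ℚ
  expCoeff = wCoeff invFact c f

  expCoeff-extend : ∀ t n u → Σℚ≤ (t + n) (λ k → invFact k *ℚ (powQ f k n *ℚ powerSeq c k u 0)) ≡ expCoeff n u
  expCoeff-extend t n u = Σ-extend n t _ (λ k n<k → trans (cong (λ x → invFact k *ℚ (x *ℚ powerSeq c k u 0)) (powQ-vanish f f₀ k n n<k))
    (trans (cong (invFact k *ℚ_) (ℚₚ.*-zeroˡ (powerSeq c k u 0))) (ℚₚ.*-zeroʳ (invFact k))))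

  -- X = exp(c f) satisfies X′ = c f′ X.
  expCoeff-suc : ∀ n u → ℕtoℚ (suc n) *ℚ expCoeff (suc n) u ≡ Σℚ≤ n (λ i → ∂ f i *ℚ expCoeff (n ∸ i) (mulBy c u))
  expCoeff-suc n u = begin
    ℕtoℚ (suc n) *ℚ expCoeff (suc n) u
      ≡⟨ Σ-*ˡ (suc n) (ℕtoℚ (suc n)) _ ⟨
    Σℚ≤ (suc n) (λ k → ℕtoℚ (suc n) *ℚ (invFact k *ℚ (powQ f k (suc n) *ℚ A k)))
      ≡⟨ Σ-cong (suc n) (λ k _ → solve 4 (λ n i a x → n :* (i :* (a :* x)) := i :* (n :* a :* x)) refl (ℕtoℚ (suc n)) (invFact k) (powQ f k (suc n)) (A k)) ⟩
    Σℚ≤ (suc n) (λ k → invFact k *ℚ (∂ (powQ f k) n *ℚ A k))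
      ≡⟨ Σ-front n _ ⟩
    invFact 0 *ℚ (∂ δ₀ n *ℚ A 0) +ℚ Σℚ≤ n (λ k → invFact (suc k) *ℚ (∂ (powQ f (suc k)) n *ℚ A (suc k)))
      ≡⟨ cong₂ _+ℚ_ (trans (cong (λ x → invFact 0 *ℚ (x *ℚ A 0)) (∂-δ₀ n)) (solve 2 (λ i a → i :* (con 0ℚ :* a) := con 0ℚ) refl (invFact 0) (A 0)))
           (Σ-cong n (λ k _ → trans (cong₂ (λ x y → invFact (suc k) *ℚ (x *ℚ y)) (∂-powQ f k n) (powerSeq-comm c k u 0))
             (trans (solve 4 (λ i s d a → i :* (s :* d :* a) := (s :* i) :* (d :* a)) refl (invFact (suc k)) (ℕtoℚ (suc k)) ((∂ f ·q powQ f k) n) (B k))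
                    (cong (_*ℚ ((∂ f ·q powQ f k) n *ℚ B k)) (invFact-suc k))))) ⟩
    0ℚ +ℚ Σℚ≤ n (λ k → invFact k *ℚ ((∂ f ·q powQ f k) n *ℚ B k))
      ≡⟨ ℚₚ.+-identityˡ _ ⟩
    Σℚ≤ n (λ k → invFact k *ℚ ((∂ f ·q powQ f k) n *ℚ B k))
      ≡⟨ Σ-cong n (λ k _ → trans (solve 3 (λ i d a → i :* (d :* a) := (i :* a) :* d) refl (invFact k) ((∂ f ·q powQ f k) n) (B k))
           (trans (sym (Σ-*ˡ n (invFact k *ℚ B k) _)) (Σ-cong n (λ i _ → solve 4 (λ v b d p → (v :* b) :* (d :* p) := d :* (v :* (p :* b))) refl (invFact k) (B k) (∂ f i) (powQ f k (n ∸ i)))))) ⟩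
    Σℚ≤ n (λ k → Σℚ≤ n (λ i → ∂ f i *ℚ (invFact k *ℚ (powQ f k (n ∸ i) *ℚ B k))))
      ≡⟨ Σ-swap n n _ ⟩
    Σℚ≤ n (λ i → Σℚ≤ n (λ k → ∂ f i *ℚ (invFact k *ℚ (powQ f k (n ∸ i) *ℚ B k))))
      ≡⟨ Σ-cong n (λ i le → trans (Σ-*ˡ n (∂ f i) _) (cong (∂ f i *ℚ_)
           (trans (cong (λ t → Σℚ≤ t (λ k → invFact k *ℚ (powQ f k (n ∸ i) *ℚ B k))) (sym (ℕₚ.m+[n∸m]≡n le))) (expCoeff-extend i (n ∸ i) (mulBy c u))))) ⟩
    Σℚ≤ n (λ i → ∂ f i *ℚ expCoeff (n ∸ i) (mulBy c u)) ∎
    where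
    open ≡-Reasoning
    A B : ℕ → ℚ
    A k = powerSeq c k u 0
    B k = powerSeq c k (mulBy c u) 0

-- The sequence `S (suc i)` is 1, 0, -1, 0, ..., the coefficients of 1/(1 + t²).
∂-atan : ∀ i → ∂ atanS i ≡ S (suc i)
∂-atan i rewrite not-isEven i | θ-suc i with isEven i
... | true = trans (solve 3 (λ a t b → a :* (t :* b) := t :* (a :* b)) refl (ℕtoℚ (suc i)) (θ i) (ℤ.+ 1 ℚ./ suc i))
      (trans (cong (θ i *ℚ_) (*-inverse-ℕ (suc i))) (ℚₚ.*-identityʳ (θ i)))
... | false = ℚₚ.*-zeroʳ (ℕtoℚ (suc i))

atan-odd : ∀ i → isEven i ≡ true → atanS i ≡ 0ℚ
atan-odd zero e = refl
atan-odd (suc k) e rewrite e = refl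

-- The binomial series

onePlusTSqPow-odd : ∀ α n → isEven n ≡ false → onePlusTSqPow α n ≡ 0ℚ
onePlusTSqPow-odd α n e rewrite e = refl

binomℚ-suc : ∀ α j → ℕtoℚ (suc j) *ℚ binomℚ α (suc j) ≡ (α -ℚ ℕtoℚ j) *ℚ binomℚ α j
binomℚ-suc α j = trans (solve 4 (λ n f a i → n :* (f :* a :* i) := a :* (f :* (n :* i))) refl (ℕtoℚ (suc j)) (fallingℚ α j) (α -ℚ ℕtoℚ j) (invFact (suc j)))
  (cong (λ x → (α -ℚ ℕtoℚ j) *ℚ (fallingℚ α j *ℚ x)) (invFact-suc j))

half-2+ : ∀ n → suc (suc n) / 2 ≡ suc (n / 2)
half-2+ n = DM.m/n≡1+[m∸n]/n {suc (suc n)} {2} (s≤s (s≤s z≤n))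

even-half : ∀ n → isEven n ≡ true → n ≡ 2 * (n / 2)
even-half zero e = refl
even-half (suc (suc n)) e = trans (cong (2 +_) (even-half n e))
  (trans (sym (ℕₚ.*-suc 2 (n / 2))) (cong (2 *_) (sym (half-2+ n))))

-- (1 + t²) P′ = 2 α t P for P = (1 + t²)^α
onePlusTSqPow-rec : ∀ α n → ∂ (onePlusTSqPow α) (suc n) ≡ (ℕtoℚ 2 *ℚ α -ℚ ℕtoℚ n) *ℚ onePlusTSqPow α n
onePlusTSqPow-rec α n with isEven n in e
... | false = trans (ℚₚ.*-zeroʳ (ℕtoℚ (suc (suc n)))) (sym (ℚₚ.*-zeroʳ (ℕtoℚ 2 *ℚ α -ℚ ℕtoℚ n)))
... | true = begin
  ℕtoℚ (suc (suc n)) *ℚ binomℚ α (suc (suc n) / 2)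
    ≡⟨ cong₂ (λ x y → ℕtoℚ x *ℚ binomℚ α y) (trans (cong (2 +_) (even-half n e)) (sym (ℕₚ.*-suc 2 k))) (half-2+ n) ⟩
  ℕtoℚ (2 * suc k) *ℚ binomℚ α (suc k)
    ≡⟨ trans (cong (_*ℚ binomℚ α (suc k)) (ℕtoℚ-* 2 (suc k))) (ℚₚ.*-assoc (ℕtoℚ 2) (ℕtoℚ (suc k)) (binomℚ α (suc k))) ⟩
  ℕtoℚ 2 *ℚ (ℕtoℚ (suc k) *ℚ binomℚ α (suc k))
    ≡⟨ cong (ℕtoℚ 2 *ℚ_) (binomℚ-suc α k) ⟩
  ℕtoℚ 2 *ℚ ((α -ℚ ℕtoℚ k) *ℚ binomℚ α k)
    ≡⟨ solve 4 (λ t a k b → t :* ((a :- k) :* b) := (t :* a :- t :* k) :* b) refl (ℕtoℚ 2) α (ℕtoℚ k) (binomℚ α k) ⟩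
  (ℕtoℚ 2 *ℚ α -ℚ ℕtoℚ 2 *ℚ ℕtoℚ k) *ℚ binomℚ α k
    ≡⟨ cong (λ x → (ℕtoℚ 2 *ℚ α -ℚ x) *ℚ binomℚ α k) (trans (sym (ℕtoℚ-* 2 k)) (cong ℕtoℚ (sym (even-half n e)))) ⟩
  (ℕtoℚ 2 *ℚ α -ℚ ℕtoℚ n) *ℚ binomℚ α k ∎
  where
  open ≡-Reasoning
  k = n / 2

-- The sequence `C (suc i)` lists the coefficients of -t/(1 + t²), so this is the equation P′ =
-- (2αt/(1 + t²)) P. The division by 1 + t² is carried out by an induction in steps of two.
∂-onePlusTSqPow : ∀ α n → ∂ (onePlusTSqPow α) n ≡ -ℚ (ℕtoℚ 2 *ℚ α) *ℚ ((C ∘ suc) ·q onePlusTSqPow α) n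
∂-onePlusTSqPow α zero = trans (ℚₚ.*-zeroʳ (ℕtoℚ 1)) (solve 2 (λ a p → con 0ℚ := (:- a) :* (con 0ℚ :* p)) refl (ℕtoℚ 2 *ℚ α) (onePlusTSqPow α 0))
∂-onePlusTSqPow α (suc zero) = trans (onePlusTSqPow-rec α 0)
  (solve 3 (λ a p r → (a :- con 0ℚ) :* p := (:- a) :* (con 0ℚ :* r :+ con (-ℚ 1ℚ) :* p)) refl (ℕtoℚ 2 *ℚ α) (onePlusTSqPow α 0) (onePlusTSqPow α 1))
∂-onePlusTSqPow α (suc (suc n)) = begin
  ∂ P (suc (suc n))
    ≡⟨ onePlusTSqPow-rec α (suc n) ⟩
  (κ -ℚ ℕtoℚ (suc n)) *ℚ P (suc n)
    ≡⟨ solve 3 (λ k n p → (k :- n) :* p := k :* p :- n :* p) refl κ (ℕtoℚ (suc n)) (P (suc n)) ⟩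
  κ *ℚ P (suc n) -ℚ ∂ P n
    ≡⟨ cong (λ z → κ *ℚ P (suc n) -ℚ z) (∂-onePlusTSqPow α n) ⟩
  κ *ℚ P (suc n) -ℚ (-ℚ κ *ℚ Z)
    ≡⟨ solve 4 (λ k p z r → k :* p :- ((:- k) :* z) := (:- k) :* (con 0ℚ :* r :+ (con (-ℚ 1ℚ) :* p :+ con (-ℚ 1ℚ) :* z))) refl κ (P (suc n)) Z (P (suc (suc n))) ⟩
  -ℚ κ *ℚ (0ℚ *ℚ P (suc (suc n)) +ℚ (-ℚ 1ℚ *ℚ P (suc n) +ℚ -ℚ 1ℚ *ℚ Z))
    ≡⟨ cong (-ℚ κ *ℚ_) (trans (·q-front (C ∘ suc) P (suc n)) (cong (0ℚ *ℚ P (suc (suc n)) +ℚ_) (trans (·q-front (λ i → C (suc (suc i))) P n)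
         (cong (-ℚ 1ℚ *ℚ P (suc n) +ℚ_) (trans (·q-cong {g = P} (λ i → trans (C-2+ (suc i)) (solve 1 (λ x → :- x := con (-ℚ 1ℚ) :* x) refl (C (suc i)))) (λ _ → refl) n) (·q-*ˡ (-ℚ 1ℚ) (C ∘ suc) P n)))))) ⟨
  -ℚ κ *ℚ ((C ∘ suc) ·q P) (suc (suc n)) ∎
  where
  open ≡-Reasoning
  P = onePlusTSqPow α
  κ = ℕtoℚ 2 *ℚ α
  Z = ((C ∘ suc) ·q P) n

-- The recurrence satisfied by the signed sums over necklaces

θ-even+ : ∀ ℓ x → isEven ℓ ≡ true → θ (ℓ + x) ≡ θ ℓ *ℚ θ x
θ-even+ zero x e = sym (ℚₚ.*-identityˡ (θ x))
θ-even+ (suc (suc ℓ)) x e = trans (θ-2+ (ℓ + x)) (trans (cong -ℚ_ (θ-even+ ℓ x e)) (neg-θ ℓ (θ x)))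

θ-odd+ : ∀ ℓ x → isEven ℓ ≡ false → θ (ℓ + x) ≡ θ ℓ *ℚ (if isEven x then θ x else -ℚ θ x)
θ-odd+ (suc zero) x e = trans (θ-suc x) (sym (ℚₚ.*-identityˡ _))
θ-odd+ (suc (suc ℓ)) x e = trans (θ-2+ (ℓ + x)) (trans (cong -ℚ_ (θ-odd+ ℓ x e)) (neg-θ ℓ (if isEven x then θ x else -ℚ θ x)))

θ-square : ∀ n → θ n *ℚ θ n ≡ 1ℚ
θ-square n = go (n / 2)
  where
  go : ∀ k → negOnePow k *ℚ negOnePow k ≡ 1ℚ
  go zero = refl
  go (suc k) = trans (solve 1 (λ x → (:- x) :* (:- x) := x :* x) refl (negOnePow k)) (go k)

isEven-double+ : ∀ a b → isEven (a + (a + b)) ≡ isEven b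
isEven-double+ zero b = refl
isEven-double+ (suc a) b = trans (cong (isEven ∘ suc) (ℕₚ.+-suc a (a + b))) (isEven-double+ a b)

*-2+ : ∀ J d → J * suc (suc d) ≡ J + (J + J * d)
*-2+ J d = trans (ℕₚ.*-suc J (suc d)) (cong (J +_) (ℕₚ.*-suc J d))

isEven-*-odd : ∀ J d → isEven d ≡ false → isEven (J * d) ≡ isEven J
isEven-*-odd J (suc zero) e = cong isEven (ℕₚ.*-identityʳ J)
isEven-*-odd J (suc (suc d)) e = trans (cong isEven (*-2+ J d)) (trans (isEven-double+ J (J * d)) (isEven-*-odd J d e))

isEven-*-even : ∀ J d → isEven d ≡ true → isEven (J * d) ≡ true
isEven-*-even J zero e = cong isEven (ℕₚ.*-zeroʳ J)
isEven-*-even J (suc (suc d)) e = trans (cong isEven (*-2+ J d)) (trans (isEven-double+ J (J * d)) (isEven-*-even J d e))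

-- Half of `J * d` is `J / 2` times an odd number, so its parity is that of `J / 2`.
θ-*-even : ∀ J d → isEven J ≡ true → isEven d ≡ false → θ (J * d) ≡ θ J
θ-*-even J (suc zero) eJ e = cong θ (ℕₚ.*-identityʳ J)
θ-*-even J (suc (suc d)) eJ e = begin
  θ (J * suc (suc d))             ≡⟨ cong θ (*-2+ J d) ⟩
  θ (J + (J + J * d))             ≡⟨ trans (θ-even+ J (J + J * d) eJ) (cong (θ J *ℚ_) (θ-even+ J (J * d) eJ)) ⟩
  θ J *ℚ (θ J *ℚ θ (J * d))       ≡⟨ ℚₚ.*-assoc (θ J) (θ J) (θ (J * d)) ⟨
  θ J *ℚ θ J *ℚ θ (J * d)         ≡⟨ cong₂ _*ℚ_ (θ-square J) (θ-*-even J d eJ e) ⟩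
  1ℚ *ℚ θ J                       ≡⟨ ℚₚ.*-identityˡ (θ J) ⟩
  θ J                             ∎
  where open ≡-Reasoning

-- On odd numbers `θ` is the nontrivial character modulo 4.
θ-*-odd : ∀ J d → isEven J ≡ false → isEven d ≡ false → θ (J * d) ≡ θ J *ℚ θ d
θ-*-odd J (suc zero) eJ e = trans (cong θ (ℕₚ.*-identityʳ J)) (sym (ℚₚ.*-identityʳ (θ J)))
θ-*-odd J (suc (suc d)) eJ e = begin
  θ (J * suc (suc d))                        ≡⟨ cong θ (*-2+ J d) ⟩
  θ (J + (J + J * d))                        ≡⟨ trans (θ-odd+ J (J + J * d) eJ) (cong (λ b → θ J *ℚ (if b then θ (J + J * d) else -ℚ θ (J + J * d))) even) ⟩
  θ J *ℚ θ (J + J * d)                       ≡⟨ cong (θ J *ℚ_) (trans (θ-odd+ J (J * d) eJ) (cong (λ b → θ J *ℚ (if b then θ (J * d) else -ℚ θ (J * d))) odd)) ⟩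
  θ J *ℚ (θ J *ℚ -ℚ θ (J * d))               ≡⟨ cong (λ x → θ J *ℚ (θ J *ℚ -ℚ x)) (θ-*-odd J d eJ e) ⟩
  θ J *ℚ (θ J *ℚ -ℚ (θ J *ℚ θ d))            ≡⟨ solve 2 (λ j d → j :* (j :* (:- (j :* d))) := (j :* j) :* (j :* (:- d))) refl (θ J) (θ d) ⟩
  θ J *ℚ θ J *ℚ (θ J *ℚ -ℚ θ d)              ≡⟨ cong₂ (λ x y → x *ℚ (θ J *ℚ y)) (θ-square J) (sym (θ-2+ d)) ⟩
  1ℚ *ℚ (θ J *ℚ θ (suc (suc d)))             ≡⟨ ℚₚ.*-identityˡ _ ⟩
  θ J *ℚ θ (suc (suc d))                     ∎
  where
  open ≡-Reasoning
  odd : isEven (J * d) ≡ false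
  odd = trans (isEven-*-odd J d e) eJ
  even : isEven (J + J * d) ≡ true
  even = trans (isOdd-+ J (J * d) eJ) (cong not odd)

power : ℚ → ℕ → ℚ
power x zero = 1ℚ
power x (suc s) = x *ℚ power x s

power-odd : ∀ x s → x *ℚ (x *ℚ x) ≡ x → isEven s ≡ false → power x s ≡ x
power-odd x (suc zero) cube e = ℚₚ.*-identityʳ x
power-odd x (suc (suc s)) cube e = trans (cong (λ y → x *ℚ (x *ℚ y)) (power-odd x s cube e)) cube

closed-replicate-odd : ∀ κ u k s λs → isEven k ≡ false →
  closed κ u (replicate s k ++ λs) ≡ power (θ k) s *ℚ closed κ (λ i → u (s + i)) λs
closed-replicate-odd κ u k zero λs e = sym (ℚₚ.*-identityˡ _)
closed-replicate-odd κ u k (suc s) λs e = trans (closed-odd κ u k (replicate s k ++ λs) e)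
  (trans (cong (θ k *ℚ_) (closed-replicate-odd κ (u ∘ suc) k s λs e)) (sym (ℚₚ.*-assoc (θ k) (power (θ k) s) _)))

closed-replicate-even : ∀ κ u k s λs → isEven k ≡ true →
  closed κ u (replicate s k ++ λs) ≡ power (κ *ℚ θ k) s *ℚ closed κ u λs
closed-replicate-even κ u k zero λs e = sym (ℚₚ.*-identityˡ _)
closed-replicate-even κ u k (suc s) λs e = trans (closed-even κ u k (replicate s k ++ λs) e)
  (trans (cong (λ x → κ *ℚ (θ k *ℚ x)) (closed-replicate-even κ u k s λs e))
    (solve 4 (λ κ t p c → κ :* (t :* (p :* c)) := κ :* t :* p :* c) refl κ (θ k) (power (κ *ℚ θ k) s) (closed κ u λs)))

closed-∑ : {A : Set} (xs : List A) → ∀ κ (v : A → ℕ → ℚ) λs →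
  closed κ (λ o → Q.∑ xs (λ x → v x o)) λs ≡ Q.∑ xs (λ x → closed κ (v x) λs)
closed-∑ [] κ v λs = closed-parity κ (λ _ → 0ℚ) λs (λ _ _ → refl)
closed-∑ (x ∷ xs) κ v λs = trans (closed-cong κ λs (λ o → cong₂ _+ℚ_ (sym (ℚₚ.*-identityˡ (v x o))) (sym (ℚₚ.*-identityˡ (Q.∑ xs (λ x → v x o))))))
  (trans (closed-linear κ 1ℚ 1ℚ (v x) (λ o → Q.∑ xs (λ x → v x o)) λs)
    (cong₂ _+ℚ_ (ℚₚ.*-identityˡ (closed κ (v x) λs)) (trans (ℚₚ.*-identityˡ _) (closed-∑ xs κ v λs))))

closed-*ˡ : ∀ κ a v λs → closed κ (λ o → a *ℚ v o) λs ≡ a *ℚ closed κ v λs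
closed-*ˡ κ a v λs = trans (closed-cong κ λs (λ o → solve 2 (λ a x → a :* x := a :* x :+ con 0ℚ :* x) refl a (v o)))
  (trans (closed-linear κ a 0ℚ v v λs) (solve 2 (λ a x → a :* x :+ con 0ℚ :* x := a :* x) refl a (closed κ v λs)))

⊞-assoc : ∀ {q} (α β γ : Vec ℕ q) → (α ⊞ β) ⊞ γ ≡ α ⊞ (β ⊞ γ)
⊞-assoc [] [] [] = refl
⊞-assoc (x ∷ α) (y ∷ β) (z ∷ γ) = cong₂ _∷_ (ℕₚ.+-assoc x y z) (⊞-assoc α β γ)

⋆-⋆ : ∀ {q} j d (α : Vec ℕ q) → j ⋆ (d ⋆ α) ≡ (j * d) ⋆ α
⋆-⋆ j d [] = refl
⋆-⋆ j d (x ∷ α) = cong₂ _∷_ (sym (ℕₚ.*-assoc j d x)) (⋆-⋆ j d α)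

length≤sum : ∀ λs → Positive λs → length λs ≤ sum λs
length≤sum [] pos = z≤n
length≤sum (ℓ ∷ λs) (p Allₚ.∷ pos) = ℕₚ.+-mono-≤ p (length≤sum λs pos)

sum-replicate-++ : ∀ s k λs → sum (replicate s k ++ λs) ≡ s * k + sum λs
sum-replicate-++ zero k λs = refl
sum-replicate-++ (suc s) k λs = trans (cong (k +_) (sum-replicate-++ s k λs)) (sym (ℕₚ.+-assoc k (s * k) (sum λs)))

positive-replicate-++ : ∀ s k λs → 0 < k → Positive λs → Positive (replicate s k ++ λs)
positive-replicate-++ zero k λs p pos = pos
positive-replicate-++ (suc s) k λs p pos = p Allₚ.∷ positive-replicate-++ s k λs p pos

module NecklaceFunctional (q m₀ : ℕ) (σ : Bool) (m-odd : isEven (suc m₀) ≡ false) where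

  open PrimitiveWords q m₀ public

  necklaceSum-cong : ∀ r {ψ ψ′ : Vec ℕ q → ℚ} → (∀ α → ψ α ≡ ψ′ α) → necklaceSum r ψ ≡ necklaceSum r ψ′
  necklaceSum-cong r e = Q.∑-cong (vecsOver words (m * r)) (λ W → cong (Q.ind (admissible? W) *ℚ_) (e (headContent W)))

  necklaceSum-∑ : {A : Set} (xs : List A) → ∀ r (ψ : A → Vec ℕ q → ℚ) →
    Q.∑ xs (λ x → necklaceSum r (ψ x)) ≡ necklaceSum r (λ α → Q.∑ xs (λ x → ψ x α))
  necklaceSum-∑ xs r ψ = trans (Q.∑-swap xs (vecsOver words (m * r)) (λ x W → Q.ind (admissible? W) *ℚ ψ x (headContent W)))
    (Q.∑-cong (vecsOver words (m * r)) (λ W → Q.∑-*ˡ xs (Q.ind (admissible? W)) (λ x → ψ x (headContent W))))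

  -- In symmetric functions this is the product of the generating function of the necklace multisets
  -- with the power sum `p_λ`, paired with a zigzag ribbon.
  G : ℕ → List ℕ → ℚ
  G r λs = necklaceSum r (λ α → letterSum q λs (λ β → start σ (α ⊞ β)))

  G-zero : ∀ λs → G 0 λs ≡ letterSum q λs (start σ)
  G-zero λs = trans (empty (m * 0) (ℕₚ.*-zeroʳ m) (λ α → letterSum q λs (λ β → start σ (α ⊞ β))))
    (letterSum-cong q λs (λ β → cong (start σ) (zeros-⊞ β)))
    where
    empty : ∀ n → n ≡ 0 → (ψ : Vec ℕ q → ℚ) → Q.∑ (vecsOver words n) (λ W → Q.ind (admissible? W) *ℚ ψ (headContent W)) ≡ ψ (zeros q)
    empty .0 refl ψ = trans (ℚₚ.+-identityʳ _) (trans (cong₂ _*ℚ_ (Q.ind-yes (admissible? []) ((λ ()) , (λ _ → refl) , λ ()))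
      (cong ψ (vec-ext (λ a → trans (Vecₚ.lookup∘tabulate (λ _ → 0) a) (sym (Vecₚ.lookup-replicate a 0)))))) (ℚₚ.*-identityˡ _))

  part : ∀ r J i λs → ℚ
  part r J i λs = G r (replicate (m / suc i) (J * suc i) ++ λs)

  G-recurrence : ∀ r λs → ℕtoℚ (m * r) *ℚ G r λs ≡
    Q.∑ (allFin r) (λ j → Q.∑ (allFin m) (λ i → Q.ind (suc (toℕ i) ∣? m) *ℚ
      (μ (suc (toℕ i)) *ℚ part (r ∸ suc (toℕ j)) (suc (toℕ j)) (toℕ i) λs)))
  G-recurrence r λs = trans (necklace-recurrence r ψ) (Q.∑-cong (allFin r) (λ j → trans
    (primitive-sum (λ γ → necklaceSum (r ∸ suc (toℕ j)) (λ α → ψ (α ⊞ suc (toℕ j) ⋆ γ))))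
    (Q.∑-cong (allFin m) (λ i → cong (λ x → Q.ind (suc (toℕ i) ∣? m) *ℚ (μ (suc (toℕ i)) *ℚ x))
      (merge (r ∸ suc (toℕ j)) (suc (toℕ j)) (suc (toℕ i)) (m / suc (toℕ i)))))))
    where
    ψ : Vec ℕ q → ℚ
    ψ α = letterSum q λs (λ β → start σ (α ⊞ β))
    -- Removing `J` copies of the `d`-th power of a word of length `s` removes each letter of that
    -- word `J d` times, which adds `s` equal parts to the list.
    merge : ∀ r J d s → Q.∑ (vecsOver (allFin q) s) (λ u → necklaceSum r (λ α → ψ (α ⊞ J ⋆ (d ⋆ content (lookup u))))) ≡ G r (replicate s (J * d) ++ λs)
    merge r J d s = trans (necklaceSum-∑ (vecsOver (allFin q) s) r (λ u α → ψ (α ⊞ J ⋆ (d ⋆ content (lookup u)))))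
      (necklaceSum-cong r (λ α → trans (Q.∑-cong (vecsOver (allFin q) s) (λ u → cong (λ γ → ψ (α ⊞ γ)) (⋆-⋆ J d (content (lookup u)))))
        (trans (letterSum-replicate q s (J * d) (λ γ → ψ (α ⊞ γ)))
        (trans (letterSum-cong q (replicate s (J * d)) (λ γ → letterSum-cong q λs (λ β → cong (start σ) (⊞-assoc α γ β))))
               (sym (letterSum-++ q (replicate s (J * d)) λs (λ β → start σ (α ⊞ β))))))))

  -- The sum of `μ` over the divisors of `m`, by `mobius-sum`.
  η : ℚ
  η = Q.ind (m ℕ.≟ 1)

  -- m times multiplication by the polynomial c_m
  twist : (ℕ → ℚ) → ℕ → ℚ
  twist v o = Q.∑ (allFin m) (λ i → Q.ind (suc (toℕ i) ∣? m) *ℚ (μ (suc (toℕ i)) *ℚ (θ (suc (toℕ i)) *ℚ v (m / suc (toℕ i) + o))))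

  divisor-parity : ∀ d .{{_ : NonZero d}} → d ∣ m → isEven d ≡ false × isEven (m / d) ≡ false
  divisor-parity d d∣m = go (isEven d) (isEven (m / d)) refl refl
    where
    m≡ : m ≡ m / d * d
    m≡ = sym (DM.m/n*n≡m d∣m)
    contra : isEven m ≡ true → ⊥
    contra e with () ← trans (sym e) m-odd
    go : ∀ a b → isEven d ≡ a → isEven (m / d) ≡ b → isEven d ≡ false × isEven (m / d) ≡ false
    go true _ e _ = ⊥-elim (contra (trans (cong isEven m≡) (isEven-*-even (m / d) d e)))
    go false true _ e = ⊥-elim (contra (trans (cong isEven (trans m≡ (ℕₚ.*-comm (m / d) d))) (isEven-*-even d (m / d) e)))
    go false false e e′ = e , e′

  -- The solution `U` is a parameter so that both the plain exponential and its multiple by a power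
  -- of 1 + t² can be substituted. The cube law for `κ` covers the values 0, 1 and -1 at once.
  module _ (κ : ℚ) (κ-cube : κ *ℚ (κ *ℚ κ) ≡ κ) (U : ℕ → ℕ → ℚ) (U-zero : ∀ o → U 0 o ≡ euler o)
    (U-suc : ∀ r o → ℕtoℚ (m * suc r) *ℚ U (suc r) o ≡
      Q.∑ (allFin (suc r)) (λ j → S (suc (toℕ j)) *ℚ twist (U (r ∸ toℕ j)) o +ℚ C (suc (toℕ j)) *ℚ (κ *ℚ (η *ℚ U (r ∸ toℕ j) o)))) where

    -- For odd `J` the `m / d` parts `J d` are odd: their signs multiply to `θ J` times `θ d`, and
    -- they shift the index by `m / d`, as the term of `c_m` belonging to `d` does. For even `J`
    -- they contribute `κ θ J` for every `d`, and only the sum of the Möbius values remains.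
    inner : ∀ J (v : ℕ → ℚ) λs → Q.∑ (allFin m) (λ i → Q.ind (suc (toℕ i) ∣? m) *ℚ (μ (suc (toℕ i)) *ℚ
        closed κ v (replicate (m / suc (toℕ i)) (J * suc (toℕ i)) ++ λs))) ≡
      closed κ (λ o → S J *ℚ twist v o +ℚ C J *ℚ (κ *ℚ (η *ℚ v o))) λs
    inner J v λs = trans (cases (isEven J) refl) (sym (trans (closed-linear κ (S J) (C J) (twist v) (λ o → κ *ℚ (η *ℚ v o)) λs)
        (cong (λ x → S J *ℚ closed κ (twist v) λs +ℚ C J *ℚ x) (trans (closed-*ˡ κ κ (λ o → η *ℚ v o) λs) (cong (κ *ℚ_) (closed-*ˡ κ η v λs))))))
      where
      open ≡-Reasoning
      F = allFin m
      cases : ∀ b → isEven J ≡ b → Q.∑ F (λ i → Q.ind (suc (toℕ i) ∣? m) *ℚ (μ (suc (toℕ i)) *ℚ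
          closed κ v (replicate (m / suc (toℕ i)) (J * suc (toℕ i)) ++ λs))) ≡
        S J *ℚ closed κ (twist v) λs +ℚ C J *ℚ (κ *ℚ (η *ℚ closed κ v λs))
      cases false e = begin
        Q.∑ F (λ i → Q.ind (suc (toℕ i) ∣? m) *ℚ (μ (suc (toℕ i)) *ℚ closed κ v (replicate (m / suc (toℕ i)) (J * suc (toℕ i)) ++ λs)))
          ≡⟨ Q.∑-cong F (λ i → trans (Q.ind-cong (suc (toℕ i) ∣? m) (λ d∣m → trans (cong (μ (suc (toℕ i)) *ℚ_) (oddPart i d∣m))
               (solve 4 (λ a b c d → a :* (b :* c :* d) := b :* (a :* (c :* d))) refl (μ (suc (toℕ i))) (θ J) (θ (suc (toℕ i))) (shifted i))))
               (solve 3 (λ a b c → a :* (b :* c) := b :* (a :* c)) refl (Q.ind (suc (toℕ i) ∣? m)) (θ J) (μ (suc (toℕ i)) *ℚ (θ (suc (toℕ i)) *ℚ shifted i)))) ⟩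
        Q.∑ F (λ i → θ J *ℚ (Q.ind (suc (toℕ i) ∣? m) *ℚ (μ (suc (toℕ i)) *ℚ (θ (suc (toℕ i)) *ℚ shifted i))))
          ≡⟨ Q.∑-*ˡ F (θ J) (λ i → Q.ind (suc (toℕ i) ∣? m) *ℚ (μ (suc (toℕ i)) *ℚ (θ (suc (toℕ i)) *ℚ shifted i))) ⟩
        θ J *ℚ Q.∑ F (λ i → Q.ind (suc (toℕ i) ∣? m) *ℚ (μ (suc (toℕ i)) *ℚ (θ (suc (toℕ i)) *ℚ shifted i)))
          ≡⟨ cong (θ J *ℚ_) (sym (trans (closed-∑ F κ _ λs) (Q.∑-cong F (λ i →
               trans (closed-*ˡ κ (Q.ind (suc (toℕ i) ∣? m)) (λ o → μ (suc (toℕ i)) *ℚ (θ (suc (toℕ i)) *ℚ v (m / suc (toℕ i) + o))) λs)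
                 (cong (Q.ind (suc (toℕ i) ∣? m) *ℚ_) (trans (closed-*ˡ κ (μ (suc (toℕ i))) (λ o → θ (suc (toℕ i)) *ℚ v (m / suc (toℕ i) + o)) λs)
                   (cong (μ (suc (toℕ i)) *ℚ_) (closed-*ˡ κ (θ (suc (toℕ i))) (λ o → v (m / suc (toℕ i) + o)) λs)))))))) ⟩
        θ J *ℚ closed κ (twist v) λs
          ≡⟨ solve 3 (λ t x y → t :* x := t :* x :+ con 0ℚ :* y) refl (θ J) (closed κ (twist v) λs) (κ *ℚ (η *ℚ closed κ v λs)) ⟩
        θ J *ℚ closed κ (twist v) λs +ℚ 0ℚ *ℚ (κ *ℚ (η *ℚ closed κ v λs))
          ≡⟨ cong₂ (λ x y → x *ℚ closed κ (twist v) λs +ℚ y *ℚ (κ *ℚ (η *ℚ closed κ v λs))) (S-odd J e) (C-odd J e) ⟨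
        S J *ℚ closed κ (twist v) λs +ℚ C J *ℚ (κ *ℚ (η *ℚ closed κ v λs)) ∎
        where
        shifted : Fin m → ℚ
        shifted i = closed κ (λ o → v (m / suc (toℕ i) + o)) λs
        oddPart : ∀ i → suc (toℕ i) ∣ m → closed κ v (replicate (m / suc (toℕ i)) (J * suc (toℕ i)) ++ λs) ≡ θ J *ℚ θ (suc (toℕ i)) *ℚ shifted i
        oddPart i d∣m = trans (closed-replicate-odd κ v (J * d) s λs (trans (isEven-*-odd J d d-odd) e))
          (cong (_*ℚ shifted i) (trans (power-odd (θ (J * d)) s (trans (cong (θ (J * d) *ℚ_) (θ-square (J * d))) (ℚₚ.*-identityʳ (θ (J * d)))) s-odd) (θ-*-odd J d e d-odd)))
          where
          d = suc (toℕ i)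
          s = m / d
          d-odd = proj₁ (divisor-parity d d∣m)
          s-odd = proj₂ (divisor-parity d d∣m)
      cases true e = begin
        Q.∑ F (λ i → Q.ind (suc (toℕ i) ∣? m) *ℚ (μ (suc (toℕ i)) *ℚ closed κ v (replicate (m / suc (toℕ i)) (J * suc (toℕ i)) ++ λs)))
          ≡⟨ Q.∑-cong F (λ i → trans (Q.ind-cong (suc (toℕ i) ∣? m) (λ d∣m → cong (μ (suc (toℕ i)) *ℚ_) (evenPart i d∣m)))
               (sym (ℚₚ.*-assoc (Q.ind (suc (toℕ i) ∣? m)) (μ (suc (toℕ i))) _))) ⟩
        Q.∑ F (λ i → Q.ind (suc (toℕ i) ∣? m) *ℚ μ (suc (toℕ i)) *ℚ (κ *ℚ θ J *ℚ X))
          ≡⟨ trans (Q.∑-*ʳ F (κ *ℚ θ J *ℚ X) (λ i → Q.ind (suc (toℕ i) ∣? m) *ℚ μ (suc (toℕ i)))) (cong (_*ℚ (κ *ℚ θ J *ℚ X)) (mobius-sum m m (s≤s z≤n) ℕₚ.≤-refl)) ⟩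
        η *ℚ (κ *ℚ θ J *ℚ X)
          ≡⟨ solve 5 (λ n k t x y → n :* (k :* t :* x) := con 0ℚ :* y :+ t :* (k :* (n :* x))) refl η κ (θ J) X (closed κ (twist v) λs) ⟩
        0ℚ *ℚ closed κ (twist v) λs +ℚ θ J *ℚ (κ *ℚ (η *ℚ X))
          ≡⟨ cong₂ (λ x y → x *ℚ closed κ (twist v) λs +ℚ y *ℚ (κ *ℚ (η *ℚ closed κ v λs))) (S-even J e) (C-even J e) ⟨
        S J *ℚ closed κ (twist v) λs +ℚ C J *ℚ (κ *ℚ (η *ℚ closed κ v λs)) ∎
        where
        X = closed κ v λs
        evenPart : ∀ i → suc (toℕ i) ∣ m → closed κ v (replicate (m / suc (toℕ i)) (J * suc (toℕ i)) ++ λs) ≡ κ *ℚ θ J *ℚ X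
        evenPart i d∣m = trans (closed-replicate-even κ v (J * d) s λs (trans (isEven-*-odd J d d-odd) e))
          (cong (_*ℚ X) (trans (power-odd (κ *ℚ θ (J * d)) s cube (proj₂ (divisor-parity d d∣m))) (cong (κ *ℚ_) (θ-*-even J d e d-odd))))
          where
          d = suc (toℕ i)
          s = m / d
          d-odd = proj₁ (divisor-parity d d∣m)
          t = θ (J * d)
          cube : κ *ℚ t *ℚ (κ *ℚ t *ℚ (κ *ℚ t)) ≡ κ *ℚ t
          cube = trans (solve 2 (λ k t → k :* t :* (k :* t :* (k :* t)) := k :* (k :* k) :* (t :* (t :* t))) refl κ t)
            (cong₂ _*ℚ_ κ-cube (trans (cong (t *ℚ_) (θ-square (J * d))) (ℚₚ.*-identityʳ t)))

    -- `R` bounds `r`, because the recurrence descends by arbitrary steps. It keeps `m * r + sum λs`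
    -- fixed, so the bound by `q` and the value of `κ` are inherited.
    G-closed : ∀ R r → r ≤ R → ∀ λs → Positive λs → m * r + sum λs ≤ q → signature σ (m * r + sum λs) ≡ κ →
               G r λs ≡ closed κ (U r) λs
    G-closed R zero _ λs pos le sig = trans (G-zero λs) (trans (foulkes σ q λs pos (ℕₚ.≤-trans (length≤sum λs pos) (subst (_≤ q) weight le)))
      (trans (cong (λ k → closed k euler λs) (trans (cong (signature σ) (sym weight)) sig)) (closed-cong κ λs (λ o → sym (U-zero o)))))
      where
      weight : m * 0 + sum λs ≡ sum λs
      weight = cong (_+ sum λs) (ℕₚ.*-zeroʳ m)
    G-closed (suc R) (suc r) (s≤s r≤R) λs pos le sig = *-cancel-ℕ (m * suc r) {{ℕₚ.m*n≢0 m (suc r)}} (begin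
      ℕtoℚ (m * suc r) *ℚ G (suc r) λs
        ≡⟨ G-recurrence (suc r) λs ⟩
      Q.∑ (allFin (suc r)) (λ j → Q.∑ (allFin m) (λ i → Q.ind (suc (toℕ i) ∣? m) *ℚ (μ (suc (toℕ i)) *ℚ part (r ∸ toℕ j) (suc (toℕ j)) (toℕ i) λs)))
        ≡⟨ Q.∑-cong (allFin (suc r)) (λ j → trans (Q.∑-cong (allFin m) (λ i → Q.ind-cong (suc (toℕ i) ∣? m) (λ d∣m → cong (μ (suc (toℕ i)) *ℚ_) (IH j i d∣m))))
             (inner (suc (toℕ j)) (U (r ∸ toℕ j)) λs)) ⟩
      Q.∑ (allFin (suc r)) (λ j → closed κ (λ o → S (suc (toℕ j)) *ℚ twist (U (r ∸ toℕ j)) o +ℚ C (suc (toℕ j)) *ℚ (κ *ℚ (η *ℚ U (r ∸ toℕ j) o))) λs)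
        ≡⟨ closed-∑ (allFin (suc r)) κ (λ j o → S (suc (toℕ j)) *ℚ twist (U (r ∸ toℕ j)) o +ℚ C (suc (toℕ j)) *ℚ (κ *ℚ (η *ℚ U (r ∸ toℕ j) o))) λs ⟨
      closed κ (λ o → Q.∑ (allFin (suc r)) (λ j → S (suc (toℕ j)) *ℚ twist (U (r ∸ toℕ j)) o +ℚ C (suc (toℕ j)) *ℚ (κ *ℚ (η *ℚ U (r ∸ toℕ j) o)))) λs
        ≡⟨ closed-cong κ λs (λ o → sym (U-suc r o)) ⟩
      closed κ (λ o → ℕtoℚ (m * suc r) *ℚ U (suc r) o) λs
        ≡⟨ closed-*ˡ κ (ℕtoℚ (m * suc r)) (U (suc r)) λs ⟩
      ℕtoℚ (m * suc r) *ℚ closed κ (U (suc r)) λs ∎)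
      where
      open ≡-Reasoning
      IH : ∀ (j : Fin (suc r)) (i : Fin m) → suc (toℕ i) ∣ m → part (r ∸ toℕ j) (suc (toℕ j)) (toℕ i) λs ≡
           closed κ (U (r ∸ toℕ j)) (replicate (m / suc (toℕ i)) (suc (toℕ j) * suc (toℕ i)) ++ λs)
      IH j i d∣m = G-closed R (r ∸ toℕ j) (ℕₚ.≤-trans (ℕₚ.m∸n≤m r (toℕ j)) r≤R) (replicate s (j⁺ * d) ++ λs)
        (positive-replicate-++ s (j⁺ * d) λs (s≤s z≤n) pos) (subst (_≤ q) (sym weight) le) (trans (cong (signature σ) weight) sig)
        where
        d = suc (toℕ i)
        j⁺ = suc (toℕ j)
        s = m / d
        rotations : s * (j⁺ * d) ≡ m * j⁺
        rotations = trans (cong (s *_) (ℕₚ.*-comm j⁺ d)) (trans (sym (ℕₚ.*-assoc s d j⁺)) (cong (_* j⁺) (DM.m/n*n≡m d∣m)))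
        weight : m * (r ∸ toℕ j) + sum (replicate s (j⁺ * d) ++ λs) ≡ m * suc r + sum λs
        weight = begin
          m * (r ∸ toℕ j) + sum (replicate s (j⁺ * d) ++ λs)   ≡⟨ cong (m * (r ∸ toℕ j) +_) (trans (sum-replicate-++ s (j⁺ * d) λs) (cong (_+ sum λs) rotations)) ⟩
          m * (r ∸ toℕ j) + (m * j⁺ + sum λs)                  ≡⟨ ℕₚ.+-assoc (m * (r ∸ toℕ j)) (m * j⁺) (sum λs) ⟨
          m * (r ∸ toℕ j) + m * j⁺ + sum λs                    ≡⟨ cong (_+ sum λs) (ℕₚ.*-distribˡ-+ m (r ∸ toℕ j) j⁺) ⟨
          m * (r ∸ toℕ j + j⁺) + sum λs                        ≡⟨ cong (λ x → m * x + sum λs) (ℕₚ.m∸n+n≡m {suc r} {j⁺} (Finₚ.toℕ<n j)) ⟩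
          m * suc r + sum λs                                  ∎

    necklaceSum-start : ∀ r → m * r ≤ q → signature σ (m * r) ≡ κ → necklaceSum r (start σ) ≡ U r 0
    necklaceSum-start r le sig = trans (necklaceSum-cong r (λ α → cong (start σ) (sym (⊞-zeros α))))
      (G-closed r r ℕₚ.≤-refl [] Allₚ.[] (subst (_≤ q) (sym (ℕₚ.+-identityʳ (m * r))) le) (trans (cong (signature σ) (ℕₚ.+-identityʳ (m * r))) sig))
      where
      ⊞-zeros : ∀ {q} (α : Vec ℕ q) → α ⊞ zeros q ≡ α
      ⊞-zeros [] = refl
      ⊞-zeros (x ∷ α) = cong₂ _∷_ (ℕₚ.+-identityʳ x) (⊞-zeros α)

-- Umbral evaluation of the exponential and its recurrence

Σ≡∑ : ∀ n (f : ℕ → ℚ) → Σℚ≤ n f ≡ Q.∑ (allFin (suc n)) (f ∘ toℕ)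
Σ≡∑ zero f = sym (ℚₚ.+-identityʳ (f 0))
Σ≡∑ (suc n) f = trans (Σ-front n f) (trans (cong (f 0 +ℚ_) (Σ≡∑ n (f ∘ suc))) (sym (Q.∑-allFin-suc (suc n) (f ∘ toℕ))))

ev-∑ : {A : Set} (xs : List A) (a : A → ℚ) (v : A → ℕ → ℚ) (p : Poly) →
  ev (λ j → Q.∑ xs (λ x → a x *ℚ v x j)) p ≡ Q.∑ xs (λ x → a x *ℚ ev (v x) p)
ev-∑ [] a v p = trans (ev-cong p (λ _ → sym (ℚₚ.*-zeroˡ 0ℚ))) (trans (ev-*ˡ 0ℚ (λ _ → 0ℚ) p) (ℚₚ.*-zeroˡ (ev (λ _ → 0ℚ) p)))
ev-∑ (x ∷ xs) a v p = trans (ev-+ (λ j → a x *ℚ v x j) (λ j → Q.∑ xs (λ x → a x *ℚ v x j)) p) (cong₂ _+ℚ_ (ev-*ˡ (a x) (v x) p) (ev-∑ xs a v p))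

powerSeq-∑ : {A : Set} (xs : List A) (a : A → ℚ) (v : A → ℕ → ℚ) (c : Poly) → ∀ k o →
  powerSeq c k (λ j → Q.∑ xs (λ x → a x *ℚ v x j)) o ≡ Q.∑ xs (λ x → a x *ℚ powerSeq c k (v x) o)
powerSeq-∑ xs a v c zero o = refl
powerSeq-∑ xs a v c (suc k) o = trans (ev-cong c (λ j → powerSeq-∑ xs a v c k (o + j))) (ev-∑ xs a (λ x j → powerSeq c k (v x) (o + j)) c)

powerSeq-cong : ∀ c k {u v : ℕ → ℚ} → (∀ i → u i ≡ v i) → ∀ o → powerSeq c k u o ≡ powerSeq c k v o
powerSeq-cong c zero e o = e o
powerSeq-cong c (suc k) e o = mulBy-cong c (powerSeq-cong c k e) o

wCoeff-cong : ∀ w c f n {u v : ℕ → ℚ} → (∀ i → u i ≡ v i) → wCoeff w c f n u ≡ wCoeff w c f n v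
wCoeff-cong w c f n e = Σ-cong n (λ k _ → cong (λ x → w k *ℚ (powQ f k n *ℚ x)) (powerSeq-cong c k e 0))

wCoeff-∑ : {A : Set} (xs : List A) (a : A → ℚ) (v : A → ℕ → ℚ) → ∀ w c f n →
  wCoeff w c f n (λ j → Q.∑ xs (λ x → a x *ℚ v x j)) ≡ Q.∑ xs (λ x → a x *ℚ wCoeff w c f n (v x))
wCoeff-∑ xs a v w c f n = begin
  Σℚ≤ n (λ k → w k *ℚ (powQ f k n *ℚ powerSeq c k (λ j → Q.∑ xs (λ x → a x *ℚ v x j)) 0))
    ≡⟨ Σ-cong n (λ k _ → trans (cong (λ y → w k *ℚ (powQ f k n *ℚ y)) (powerSeq-∑ xs a v c k 0))
         (trans (sym (ℚₚ.*-assoc (w k) (powQ f k n) _)) (trans (sym (Q.∑-*ˡ xs (w k *ℚ powQ f k n) (λ x → a x *ℚ powerSeq c k (v x) 0)))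
           (Q.∑-cong xs (λ x → solve 4 (λ w p a y → w :* p :* (a :* y) := a :* (w :* (p :* y))) refl (w k) (powQ f k n) (a x) (powerSeq c k (v x) 0)))))) ⟩
  Σℚ≤ n (λ k → Q.∑ xs (λ x → a x *ℚ term k x))
    ≡⟨ trans (Σ≡∑ n (λ k → Q.∑ xs (λ x → a x *ℚ term k x))) (Q.∑-swap (allFin (suc n)) xs (λ k x → a x *ℚ term (toℕ k) x)) ⟩
  Q.∑ xs (λ x → Q.∑ (allFin (suc n)) (λ k → a x *ℚ term (toℕ k) x))
    ≡⟨ Q.∑-cong xs (λ x → trans (sym (Σ≡∑ n (λ k → a x *ℚ term k x))) (Σ-*ˡ n (a x) (λ k → term k x))) ⟩
  Q.∑ xs (λ x → a x *ℚ wCoeff w c f n (v x)) ∎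
  where
  open ≡-Reasoning
  term : ℕ → _ → ℚ
  term k x = w k *ℚ (powQ f k n *ℚ powerSeq c k (v x) 0)

wCoeff-*ˡ : ∀ a w c f n u → wCoeff w c f n (λ j → a *ℚ u j) ≡ a *ℚ wCoeff w c f n u
wCoeff-*ˡ a w c f n u = trans (wCoeff-cong w c f n (λ j → sym (ℚₚ.+-identityʳ (a *ℚ u j))))
  (trans (wCoeff-∑ (tt ∷ []) (λ _ → a) (λ _ → u) w c f n) (ℚₚ.+-identityʳ _))

-- Only the powers of the parity of n contribute to the coefficient of tⁿ.
wCoeff-parity : ∀ w w′ c n u → (∀ k → isEven k ≡ isEven n → w k ≡ w′ k) → wCoeff w c atanS n u ≡ wCoeff w′ c atanS n u
wCoeff-parity w w′ c n u agree = Σ-cong n (λ k _ → term k (isEven k) (isEven n) refl refl)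
  where
  vanish : ∀ (w : ℕ → ℚ) k → isEven n ≡ not (isEven k) → w k *ℚ (powQ atanS k n *ℚ powerSeq c k u 0) ≡ 0ℚ
  vanish w k e = trans (cong (λ x → w k *ℚ (x *ℚ powerSeq c k u 0)) (powQ-parity atanS atan-odd k n e))
    (solve 2 (λ w y → w :* (con 0ℚ :* y) := con 0ℚ) refl (w k) (powerSeq c k u 0))
  differ : ∀ k → isEven n ≡ not (isEven k) → w k *ℚ (powQ atanS k n *ℚ powerSeq c k u 0) ≡ w′ k *ℚ (powQ atanS k n *ℚ powerSeq c k u 0)
  differ k e = trans (vanish w k e) (sym (vanish w′ k e))
  term : ∀ k a b → isEven k ≡ a → isEven n ≡ b → w k *ℚ (powQ atanS k n *ℚ powerSeq c k u 0) ≡ w′ k *ℚ (powQ atanS k n *ℚ powerSeq c k u 0)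
  term k true true e e′ = cong (_*ℚ (powQ atanS k n *ℚ powerSeq c k u 0)) (agree k (trans e (sym e′)))
  term k false false e e′ = cong (_*ℚ (powQ atanS k n *ℚ powerSeq c k u 0)) (agree k (trans e (sym e′)))
  term k true false e e′ = differ k (trans e′ (cong not (sym e)))
  term k false true e e′ = differ k (trans e′ (cong not (sym e)))

signature-cube : ∀ σ n → signature σ n *ℚ (signature σ n *ℚ signature σ n) ≡ signature σ n
signature-cube σ n with isEven n | σ
... | false | _ = refl
... | true | true = refl
... | true | false = refl

module Evaluation (q m₀ : ℕ) (σ : Bool) (m-odd : isEven (suc m₀) ≡ false) (c : Poly)
  (c-spec : ∀ u o → ℕtoℚ (suc m₀) *ℚ mulBy c u o ≡ NecklaceFunctional.twist q m₀ σ m-odd u o) where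

  open NecklaceFunctional q m₀ σ m-odd

  eulerFrom : ℕ → ℕ → ℚ
  eulerFrom o i = euler (o + i)

  -- The umbral value of `E^o` times the coefficient of `t^n` in exp(c arctan t).
  X : ℕ → ℕ → ℚ
  X n o = expCoeff c atanS refl n (eulerFrom o)

  X-zero : ∀ o → X 0 o ≡ euler o
  X-zero o = trans (solve 1 (λ x → con 1ℚ :* (con 1ℚ :* x) := x) refl (euler (o + 0))) (cong euler (ℕₚ.+-identityʳ o))

  -- Multiplication by `m c` replaces `E^o` by a combination of the powers `E^(m/d + o)`, and the
  -- coefficient depends linearly on the umbral values.
  X-twist : ∀ n o → ℕtoℚ m *ℚ expCoeff c atanS refl n (mulBy c (eulerFrom o)) ≡ twist (X n) o
  X-twist n o = begin
    ℕtoℚ m *ℚ expCoeff c atanS refl n (mulBy c (eulerFrom o))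
      ≡⟨ wCoeff-*ˡ (ℕtoℚ m) invFact c atanS n (mulBy c (eulerFrom o)) ⟨
    wCoeff invFact c atanS n (λ k → ℕtoℚ m *ℚ mulBy c (eulerFrom o) k)
      ≡⟨ wCoeff-cong invFact c atanS n (λ k → trans (c-spec (eulerFrom o) k) (Q.∑-cong (allFin m) (λ i →
           trans (assoc i (euler (o + (m / suc (toℕ i) + k)))) (cong (λ x → β i *ℚ euler x) (regroup i k))))) ⟩
    wCoeff invFact c atanS n (λ k → Q.∑ (allFin m) (λ i → β i *ℚ eulerFrom (m / suc (toℕ i) + o) k))
      ≡⟨ wCoeff-∑ (allFin m) β (λ i → eulerFrom (m / suc (toℕ i) + o)) invFact c atanS n ⟩
    Q.∑ (allFin m) (λ i → β i *ℚ X n (m / suc (toℕ i) + o))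
      ≡⟨ Q.∑-cong (allFin m) (λ i → assoc i (X n (m / suc (toℕ i) + o))) ⟨
    twist (X n) o ∎
    where
    open ≡-Reasoning
    β : Fin m → ℚ
    β i = Q.ind (suc (toℕ i) ∣? m) *ℚ (μ (suc (toℕ i)) *ℚ θ (suc (toℕ i)))
    assoc : ∀ i x → Q.ind (suc (toℕ i) ∣? m) *ℚ (μ (suc (toℕ i)) *ℚ (θ (suc (toℕ i)) *ℚ x)) ≡ β i *ℚ x
    assoc i x = solve 4 (λ a b c x → a :* (b :* (c :* x)) := a :* (b :* c) :* x) refl (Q.ind (suc (toℕ i) ∣? m)) (μ (suc (toℕ i))) (θ (suc (toℕ i))) x
    regroup : ∀ i k → o + (m / suc (toℕ i) + k) ≡ (m / suc (toℕ i) + o) + k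
    regroup i k = trans (sym (ℕₚ.+-assoc o (m / suc (toℕ i)) k)) (cong (_+ k) (ℕₚ.+-comm o (m / suc (toℕ i))))

  X-suc : ∀ r o → ℕtoℚ (m * suc r) *ℚ X (suc r) o ≡ Σℚ≤ r (λ i → S (suc i) *ℚ twist (X (r ∸ i)) o)
  X-suc r o = begin
    ℕtoℚ (m * suc r) *ℚ X (suc r) o
      ≡⟨ trans (cong (_*ℚ X (suc r) o) (ℕtoℚ-* m (suc r))) (ℚₚ.*-assoc (ℕtoℚ m) (ℕtoℚ (suc r)) (X (suc r) o)) ⟩
    ℕtoℚ m *ℚ (ℕtoℚ (suc r) *ℚ X (suc r) o)
      ≡⟨ cong (ℕtoℚ m *ℚ_) (expCoeff-suc c atanS refl r (eulerFrom o)) ⟩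
    ℕtoℚ m *ℚ Σℚ≤ r (λ i → ∂ atanS i *ℚ Y i)
      ≡⟨ Σ-*ˡ r (ℕtoℚ m) (λ i → ∂ atanS i *ℚ Y i) ⟨
    Σℚ≤ r (λ i → ℕtoℚ m *ℚ (∂ atanS i *ℚ Y i))
      ≡⟨ Σ-cong r (λ i _ → trans (solve 3 (λ m d y → m :* (d :* y) := d :* (m :* y)) refl (ℕtoℚ m) (∂ atanS i) (Y i)) (cong₂ _*ℚ_ (∂-atan i) (X-twist (r ∸ i) o))) ⟩
    Σℚ≤ r (λ i → S (suc i) *ℚ twist (X (r ∸ i)) o) ∎
    where
    open ≡-Reasoning
    Y : ℕ → ℚ
    Y i = expCoeff c atanS refl (r ∸ i) (mulBy c (eulerFrom o))

  -- The hypothesis `κ η = 0` removes the even `j` from the recurrence. It holds for `m ≥ 3` through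
  -- `η = 0`, and for `m = 1` and odd `r` through `κ = 0`.
  evaluate-exp : ∀ r → m * r ≤ q → signature σ (m * r) *ℚ η ≡ 0ℚ → necklaceSum r (start σ) ≡ X r 0
  evaluate-exp r le κη≡0 = necklaceSum-start κ (signature-cube σ (m * r)) X X-zero
    (λ n o → trans (X-suc n o) (trans (Σ≡∑ n (λ i → S (suc i) *ℚ twist (X (n ∸ i)) o)) (Q.∑-cong (allFin (suc n)) (λ j →
      trans (sym (ℚₚ.+-identityʳ (S (suc (toℕ j)) *ℚ twist (X (n ∸ toℕ j)) o)))
        (cong (S (suc (toℕ j)) *ℚ twist (X (n ∸ toℕ j)) o +ℚ_) (sym (kill (C (suc (toℕ j))) (X (n ∸ toℕ j) o)))))))) r le refl
    where
    κ = signature σ (m * r)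
    kill : ∀ a x → a *ℚ (κ *ℚ (η *ℚ x)) ≡ 0ℚ
    kill a x = trans (solve 4 (λ a k n x → a :* (k :* (n :* x)) := (k :* n) :* (a :* x)) refl a κ η x) (trans (cong (_*ℚ (a *ℚ x)) κη≡0) (ℚₚ.*-zeroˡ (a *ℚ x)))

if-ind : {P : Set} (d : Dec P) (u : ℕ → ℚ) (x : ℚ) (p : Poly) → ev u (if does d then pscale x p else []) ≡ Q.ind d *ℚ (x *ℚ ev u p)
if-ind (yes _) u x p = trans (ev-pscale u x p) (sym (ℚₚ.*-identityˡ (x *ℚ ev u p)))
if-ind (no _) u x p = sym (ℚₚ.*-zeroˡ (x *ℚ ev u p))

cPoly-spec : ∀ q m₀ σ (m-odd : isEven (suc m₀) ≡ false) u o →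
  ℕtoℚ (suc m₀) *ℚ mulBy (cPoly (suc m₀)) u o ≡ NecklaceFunctional.twist q m₀ σ m-odd u o
cPoly-spec q m₀ σ m-odd u o = begin
  ℕtoℚ m *ℚ ev uₒ (cPoly m)
    ≡⟨ cong (ℕtoℚ m *ℚ_) (ev-pscale uₒ (ℤ.+ 1 ℚ./ m) (Σpoly≤ m term)) ⟩
  ℕtoℚ m *ℚ ((ℤ.+ 1 ℚ./ m) *ℚ ev uₒ (Σpoly≤ m term))
    ≡⟨ trans (sym (ℚₚ.*-assoc (ℕtoℚ m) (ℤ.+ 1 ℚ./ m) _)) (trans (cong (_*ℚ ev uₒ (Σpoly≤ m term)) (*-inverse-ℕ m)) (ℚₚ.*-identityˡ _)) ⟩
  ev uₒ (Σpoly≤ m term)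
    ≡⟨ trans (ev-Σpoly uₒ m term) (Σ-cong m (λ j _ → if-ind (suc j ∣? m) uₒ (μ (suc j) *ℚ negOnePow (j / 2)) (Epow (m / suc j)))) ⟩
  Σℚ≤ m₀ value +ℚ value m
    -- The sum in `cPoly` runs up to `d = m + 1`, and this last `d` does not divide `m`.
    ≡⟨ cong (Σℚ≤ m₀ value +ℚ_) (trans (cong (_*ℚ (μ (suc m) *ℚ negOnePow (m / 2) *ℚ ev uₒ (Epow (m / suc m)))) (Q.ind-no (suc m ∣? m) (λ div → ℕₚ.1+n≰n (∣ₚ.∣⇒≤ div)))) (ℚₚ.*-zeroˡ (μ (suc m) *ℚ negOnePow (m / 2) *ℚ ev uₒ (Epow (m / suc m))))) ⟩
  Σℚ≤ m₀ value +ℚ 0ℚ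
    ≡⟨ trans (ℚₚ.+-identityʳ _) (Σ≡∑ m₀ value) ⟩
  Q.∑ (allFin m) (value ∘ toℕ)
    ≡⟨ Q.∑-cong (allFin m) (λ i → Q.ind-cong (suc (toℕ i) ∣? m) (λ d∣m → trans (ℚₚ.*-assoc (μ (suc (toℕ i))) (negOnePow (toℕ i / 2)) _)
         (cong (μ (suc (toℕ i)) *ℚ_) (cong₂ _*ℚ_ (θ-odd (toℕ i) (proj₁ (divisor-parity (suc (toℕ i)) d∣m)))
           (trans (ev-Epow uₒ (m / suc (toℕ i))) (cong u (ℕₚ.+-comm o (m / suc (toℕ i))))))))) ⟩
  twist u o ∎
  where
  open ≡-Reasoning
  open NecklaceFunctional q m₀ σ m-odd using (m; twist; divisor-parity)
  uₒ : ℕ → ℚ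
  uₒ j = u (o + j)
  term : ℕ → Poly
  term j = if does (suc j ∣? m) then pscale (μ (suc j) *ℚ negOnePow (j / 2)) (Epow (m / suc j)) else []
  value : ℕ → ℚ
  value j = Q.ind (suc j ∣? m) *ℚ (μ (suc j) *ℚ negOnePow (j / 2) *ℚ ev uₒ (Epow (m / suc j)))
  -- For odd `d` the exponent (d - 1)/2 in `cPoly` agrees with ⌊d/2⌋ in `θ`.
  θ-odd : ∀ j → isEven (suc j) ≡ false → θ j ≡ θ (suc j)
  θ-odd j e = trans (sym (cong (if_then θ j else -ℚ θ j) (trans (sym (not-involutive (isEven j))) (cong not (trans (sym (not-isEven j)) e))))) (sym (θ-suc j))

ev-rhsA : ∀ m .{{_ : NonZero m}} r → umbral (rhsA m r) ≡ wCoeff invFact (cPoly m) atanS r euler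
ev-rhsA m r = trans (umbralFrom≡ev 0 (rhsA m r)) (ev-wSum invFact (cPoly m) atanS r euler)

odd-mod : ∀ m → m % 2 ≡ 1 → isEven m ≡ false
odd-mod m e rewrite e = refl

-- For `m ≥ 3` the factor `η` is zero, so `κ` drops out of the recurrence, and with it the
-- difference between the two kinds of alternation.
part-a : ∀ σ m₀ → 3 ≤ suc m₀ → suc m₀ % 2 ≡ 1 → ∀ r →
  ℕtoℚ (countBy (λ π → altFrom (not σ) (valuesOf π) ∧ allCyclesLength (suc m₀) π) (perms (suc m₀ * r))) ≡ umbral (rhsA (suc m₀) r)
part-a σ m₀ m≥3 m%2≡1 r = trans (count-as-necklaceSum σ m₀ r) (trans
  (Evaluation.evaluate-exp (suc m₀ * r) m₀ σ m-odd (cPoly (suc m₀)) (cPoly-spec (suc m₀ * r) m₀ σ m-odd) r ℕₚ.≤-refl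
    (trans (cong (signature σ (suc m₀ * r) *ℚ_) (Q.ind-no (suc m₀ ℕ.≟ 1) (λ e → ℕₚ.<⇒≢ (ℕₚ.<-≤-trans (s≤s (s≤s z≤n)) m≥3) (sym e)))) (ℚₚ.*-zeroʳ (signature σ (suc m₀ * r)))))
  (sym (ev-rhsA (suc m₀) r)))
  where
  m-odd = odd-mod (suc m₀) m%2≡1

-- Cycles of length one

module CycleLengthOne (σ : Bool) (α : ℚ) (2α : -ℚ (ℕtoℚ 2 *ℚ α) ≡ (if σ then -ℚ 1ℚ else 1ℚ)) (r : ℕ) where

  open NecklaceFunctional (1 * r) 0 σ refl using (twist; η; necklaceSum; necklaceSum-start)

  twist-1 : ∀ v o → twist v o ≡ v (suc o)
  twist-1 v o = trans (ℚₚ.+-identityʳ _) (trans (cong (_*ℚ (μ 1 *ℚ (θ 1 *ℚ v (suc o)))) (Q.ind-yes (1 ∣? 1) (∣ₚ.1∣ 1)))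
    (solve 1 (λ x → con 1ℚ :* (con 1ℚ :* (con 1ℚ :* x)) := x) refl (v (suc o))))

  Epow-spec : ∀ u o → ℕtoℚ 1 *ℚ mulBy (Epow 1) u o ≡ twist u o
  Epow-spec u o = trans (ℚₚ.*-identityˡ _) (trans (ev-Epow (λ j → u (o + j)) 1) (trans (cong u (ℕₚ.+-comm o 1)) (sym (twist-1 u o))))

  open Evaluation (1 * r) 0 σ refl (Epow 1) Epow-spec

  κ : ℚ
  κ = if σ then -ℚ 1ℚ else 1ℚ

  P : QSeries
  P = onePlusTSqPow α

  oddW evenW : ℕ → ℚ
  oddW k = if isEven k then 0ℚ else invFact k
  evenW k = if isEven k then invFact k else 0ℚ

  XP : ℕ → ℕ → ℚ
  XP n o = (P ·q (λ k → X k o)) n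

  -- By Leibniz' rule the derivative of the exponential yields the odd `j`, and that of `P` the even
  -- `j`, since P′ = -(κt/(1 + t²)) P.
  XP-suc : ∀ n o → ℕtoℚ (1 * suc n) *ℚ XP (suc n) o ≡
    Q.∑ (allFin (suc n)) (λ j → S (suc (toℕ j)) *ℚ twist (XP (n ∸ toℕ j)) o +ℚ C (suc (toℕ j)) *ℚ (κ *ℚ (η *ℚ XP (n ∸ toℕ j) o)))
  XP-suc n o = begin
    ℕtoℚ (1 * suc n) *ℚ XP (suc n) o
      ≡⟨ cong (λ k → ℕtoℚ k *ℚ XP (suc n) o) (ℕₚ.*-identityˡ (suc n)) ⟩
    ∂ (P ·q x) n
      ≡⟨ leibniz P x n ⟩
    (∂ P ·q x) n +ℚ (P ·q ∂ x) n
      ≡⟨ cong₂ _+ℚ_ evenPart oddPart ⟩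
    κ *ℚ ((C ∘ suc) ·q (P ·q x)) n +ℚ ((S ∘ suc) ·q (P ·q y)) n
      ≡⟨ trans (ℚₚ.+-comm (κ *ℚ ((C ∘ suc) ·q (P ·q x)) n) (((S ∘ suc) ·q (P ·q y)) n)) (cong (((S ∘ suc) ·q (P ·q y)) n +ℚ_) (sym (Σ-*ˡ n κ _))) ⟩
    ((S ∘ suc) ·q (P ·q y)) n +ℚ Σℚ≤ n (λ i → κ *ℚ (C (suc i) *ℚ XP (n ∸ i) o))
      ≡⟨ Σ-+ n _ _ ⟨
    Σℚ≤ n (λ i → S (suc i) *ℚ XP (n ∸ i) (suc o) +ℚ κ *ℚ (C (suc i) *ℚ XP (n ∸ i) o))
      ≡⟨ Σ-cong n (λ i _ → cong₂ _+ℚ_ (cong (S (suc i) *ℚ_) (sym (twist-1 (XP (n ∸ i)) o)))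
           (solve 3 (λ k c x → k :* (c :* x) := c :* (k :* (con 1ℚ :* x))) refl κ (C (suc i)) (XP (n ∸ i) o))) ⟩
    Σℚ≤ n (λ i → S (suc i) *ℚ twist (XP (n ∸ i)) o +ℚ C (suc i) *ℚ (κ *ℚ (η *ℚ XP (n ∸ i) o)))
      ≡⟨ Σ≡∑ n _ ⟩
    Q.∑ (allFin (suc n)) (λ j → S (suc (toℕ j)) *ℚ twist (XP (n ∸ toℕ j)) o +ℚ C (suc (toℕ j)) *ℚ (κ *ℚ (η *ℚ XP (n ∸ toℕ j) o))) ∎
    where
    open ≡-Reasoning
    x y : QSeries
    x k = X k o
    y k = X k (suc o)
    evenPart : (∂ P ·q x) n ≡ κ *ℚ ((C ∘ suc) ·q (P ·q x)) n
    evenPart = trans (·q-cong {g = x} (λ k → trans (∂-onePlusTSqPow α k) (cong (_*ℚ ((C ∘ suc) ·q P) k) 2α)) (λ _ → refl) n)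
      (trans (·q-*ˡ κ ((C ∘ suc) ·q P) x n) (cong (κ *ℚ_) (·q-assoc (C ∘ suc) P x n)))
    ∂x : ∀ k → ∂ x k ≡ ((S ∘ suc) ·q y) k
    ∂x k = trans (cong (λ a → ℕtoℚ a *ℚ X (suc k) o) (sym (ℕₚ.*-identityˡ (suc k))))
      (trans (X-suc k o) (Σ-cong k (λ i _ → cong (S (suc i) *ℚ_) (twist-1 (X (k ∸ i)) o))))
    oddPart : (P ·q ∂ x) n ≡ ((S ∘ suc) ·q (P ·q y)) n
    oddPart = trans (·q-cong {P} {P} (λ _ → refl) ∂x n) (·q-leftComm P (S ∘ suc) y n)

  rhs : Poly
  rhs = (sinhPS Eatan +p (liftQ P ·p coshPS Eatan)) r

  umbral-rhs : umbral rhs ≡ wCoeff oddW (Epow 1) atanS r euler +ℚ Σℚ≤ r (λ i → P i *ℚ wCoeff evenW (Epow 1) atanS (r ∸ i) euler)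
  umbral-rhs = trans (umbralFrom≡ev 0 rhs) (trans (ev-padd euler (sinhPS Eatan r) ((liftQ P ·p coshPS Eatan) r)) (cong₂ _+ℚ_
    (ev-wSum oddW (Epow 1) atanS r euler)
    (trans (ev-Σpoly euler r _) (Σ-cong r (λ i _ → trans (ev-const* euler (P i) (coshPS Eatan (r ∸ i))) (cong (P i *ℚ_) (ev-wSum evenW (Epow 1) atanS (r ∸ i) euler)))))))

  wCoeff-zero : ∀ n → wCoeff (λ _ → 0ℚ) (Epow 1) atanS n euler ≡ 0ℚ
  wCoeff-zero n = Σ-zero n (λ k _ → ℚₚ.*-zeroˡ (powQ atanS k n *ℚ powerSeq (Epow 1) k euler 0))

  -- `P` is even and arctan is odd: the cosh term has no odd coefficients, and sinh shares its odd
  -- coefficients with the exponential.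
  umbral-rhs-odd : isEven r ≡ false → umbral rhs ≡ X r 0
  umbral-rhs-odd e = trans umbral-rhs (trans (cong₂ _+ℚ_
    (wCoeff-parity oddW invFact (Epow 1) r euler (λ k h → cong (if_then 0ℚ else invFact k) (trans h e)))
    (Σ-zero r (λ i le → term i le (isEven i) refl))) (ℚₚ.+-identityʳ _))
    where
    term : ∀ i → i ≤ r → ∀ b → isEven i ≡ b → P i *ℚ wCoeff evenW (Epow 1) atanS (r ∸ i) euler ≡ 0ℚ
    term i le false h = trans (cong (_*ℚ wCoeff evenW (Epow 1) atanS (r ∸ i) euler) (onePlusTSqPow-odd α i h)) (ℚₚ.*-zeroˡ (wCoeff evenW (Epow 1) atanS (r ∸ i) euler))
    term i le true h = trans (cong (P i *ℚ_) (trans (wCoeff-parity evenW (λ _ → 0ℚ) (Epow 1) (r ∸ i) euler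
      (λ k h′ → cong (if_then invFact k else 0ℚ) (trans h′ (trans (∸-parity-even i r le h) e)))) (wCoeff-zero (r ∸ i)))) (ℚₚ.*-zeroʳ (P i))

  -- Here sinh contributes nothing, and the even series `P` meets only even coefficients, where cosh
  -- agrees with the exponential.
  umbral-rhs-even : isEven r ≡ true → umbral rhs ≡ XP r 0
  umbral-rhs-even e = trans umbral-rhs (trans (cong₂ _+ℚ_
    (trans (wCoeff-parity oddW (λ _ → 0ℚ) (Epow 1) r euler (λ k h → cong (if_then 0ℚ else invFact k) (trans h e))) (wCoeff-zero r))
    (Σ-cong r (λ i le → term i le (isEven i) refl))) (ℚₚ.+-identityˡ _))
    where
    term : ∀ i → i ≤ r → ∀ b → isEven i ≡ b → P i *ℚ wCoeff evenW (Epow 1) atanS (r ∸ i) euler ≡ P i *ℚ X (r ∸ i) 0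
    term i le false h = trans (trans (cong (_*ℚ wCoeff evenW (Epow 1) atanS (r ∸ i) euler) (onePlusTSqPow-odd α i h)) (ℚₚ.*-zeroˡ (wCoeff evenW (Epow 1) atanS (r ∸ i) euler)))
      (sym (trans (cong (_*ℚ X (r ∸ i) 0) (onePlusTSqPow-odd α i h)) (ℚₚ.*-zeroˡ (X (r ∸ i) 0))))
    term i le true h = cong (P i *ℚ_) (wCoeff-parity evenW invFact (Epow 1) (r ∸ i) euler
      (λ k h′ → cong (if_then invFact k else 0ℚ) (trans h′ (trans (∸-parity-even i r le h) e))))

  -- The parity of `r` selects the solution of the recurrence: the signature is zero for odd `r`,
  -- and it is the sign that matches the factor `P` for even `r`.
  part-b : ℕtoℚ (countBy (λ π → altFrom (not σ) (valuesOf π) ∧ allCyclesLength 1 π) (perms (1 * r))) ≡ umbral rhs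
  part-b = trans (count-as-necklaceSum σ 0 r) (go (isEven r) refl)
    where
    parity : ∀ b → isEven r ≡ b → signature σ (1 * r) ≡ (if b then (if σ then -ℚ 1ℚ else 1ℚ) else 0ℚ)
    parity b e = cong (if_then (if σ then -ℚ 1ℚ else 1ℚ) else 0ℚ) (trans (cong isEven (ℕₚ.*-identityˡ r)) e)
    sign-cube : ∀ b → (if b then -ℚ 1ℚ else 1ℚ) *ℚ ((if b then -ℚ 1ℚ else 1ℚ) *ℚ (if b then -ℚ 1ℚ else 1ℚ)) ≡ (if b then -ℚ 1ℚ else 1ℚ)
    sign-cube true = refl
    sign-cube false = refl
    go : ∀ b → isEven r ≡ b → necklaceSum r (start σ) ≡ umbral rhs
    go false e = trans (evaluate-exp r ℕₚ.≤-refl (trans (cong (_*ℚ η) (parity false e)) (ℚₚ.*-zeroˡ η))) (sym (umbral-rhs-odd e))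
    go true e = trans (necklaceSum-start (if σ then -ℚ 1ℚ else 1ℚ) (sign-cube σ) XP
        (λ o → trans (ℚₚ.*-identityˡ (X 0 o)) (X-zero o)) XP-suc r ℕₚ.≤-refl (parity true e))
      (sym (umbral-rhs-even e))

theorem5p4 : ((m : ℕ) → (m≥3 : 3 ≤ m) → m % 2 ≡ 1 → (r : ℕ) →
    (ℕtoℚ (b m r) ≡ umbral (rhsA m {{>-nonZero (≤-trans (s≤s z≤n) m≥3)}} r))
    × (ℕtoℚ (b* m r) ≡ umbral (rhsA m {{>-nonZero (≤-trans (s≤s z≤n) m≥3)}} r)))
    × ((r : ℕ) → (ℕtoℚ (b 1 r) ≡ umbral (rhsB r)) × (ℕtoℚ (b* 1 r) ≡ umbral (rhsB* r)))
theorem5p4 =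
  (λ { (suc m₀) m≥3 m%2≡1 r → part-a false m₀ m≥3 m%2≡1 r , part-a true m₀ m≥3 m%2≡1 r }) ,
  -- The exponent is determined by `-2α = κ`, with `κ = 1` in the alternating and `κ = -1` in the
  -- reverse alternating case.
  (λ r → CycleLengthOne.part-b false (ℤ.-[1+ 0 ] ℚ./ 2) refl r , CycleLengthOne.part-b true (ℤ.+ 1 ℚ./ 2) refl r)
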